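{- Let $G$ be a finite, connected graph that contains at least one cycle. Then $D'(G)\leq D(G)$.
   Context: All graphs are simple. For a graph $G$, ${\rm Aut}(G)$ denotes its automorphism group. A vertex labeling $\phi: V(G)\to\{1,\dots,r\}$ is distinguishing if the only automorphism $\alpha\in{\rm Aut}(G)$ with $\phi(\alpha(x))=\phi(x)$ for all $x\in V(G)$ is the identity. The distinguishing number $D(G)$ is the smallest $r$ such that $G$ admits a distinguishing vertex labeling with $r$ labels. Analogously, an edge labeling $\psi:E(G)\to\{1,\dots,d\}$ is distinguishing if the only automorphism of $G$ preserving all edge labels (i.e. $\psi(\alpha(x)\alpha(y))=\psi(xy)$ for every edge $xy$) is the identity; the distinguishing index $D'(G)$ is the smallest $d$ such that $G$ admits a distinguishing edge labeling with $d$ labels. -}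

module Defs where

open import Data.Fin using (Fin; zero; suc; fromℕ; inject₁)
open import Data.Fin.Permutation using (Permutation′; _⟨$⟩ʳ_)
open import Data.Nat using (ℕ; _+_; _≤_)
open import Data.Nat.Properties using (≤-antisym)
open import Data.Product using (∃; _×_; _,_)
open import Function.Definitions using (Injective)
open import Level using (0ℓ)
open import Relation.Binary.Construct.Closure.ReflexiveTransitive using (Star)
open import Relation.Binary.Core using (Rel)
open import Relation.Binary.Definitions using (Decidable; Irreflexive; Symmetric)
open import Relation.Binary.PropositionalEquality using (_≡_)

-- Finite simple graphs, with the vertices enumerated as Fin order.  Decidable
-- adjacency is what makes the edge set finite constructively.
record Graph : Set₁ where
  infix 4 _~_
  field
    order    : ℕ
    _~_      : Rel (Fin order) 0ℓ
    ~-dec    : Decidable _~_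
    ~-sym    : Symmetric _~_
    ~-irrefl : Irreflexive _≡_ _~_

  Vertex : Set
  Vertex = Fin order

-- The empty graph is connected under this definition.
Connected : Graph → Set
Connected G = ∀ x y → Star _~_ x y
  where open Graph G

-- A cycle of length 3 + excess, given by its pairwise distinct vertices in
-- cyclic order.
record Cycle (G : Graph) : Set where
  open Graph G
  field
    excess   : ℕ
    vertices : Fin (3 + excess) → Vertex
    distinct : Injective _≡_ _≡_ vertices
    steps    : ∀ (i : Fin (2 + excess)) → vertices (inject₁ i) ~ vertices (suc i)
    closes   : vertices (fromℕ (2 + excess)) ~ vertices zero

record Automorphism (G : Graph) : Set where
  open Graph G
  field
    perm : Permutation′ order

  apply : Vertex → Vertex
  apply x = perm ⟨$⟩ʳ x

  field
    preserves : ∀ {x y} → x ~ y → apply x ~ apply y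
    reflects  : ∀ {x y} → apply x ~ apply y → x ~ y

  IsIdentity : Set
  IsIdentity = ∀ x → apply x ≡ x

-- Fin r plays the role of the label set {1, …, r}.
VertexLabelling : Graph → ℕ → Set
VertexLabelling G r = Graph.Vertex G → Fin r

-- A function on unordered edges.  Quantifying label-sym over both adjacency
-- proofs also makes the label independent of the proof chosen.
record EdgeLabelling (G : Graph) (d : ℕ) : Set where
  open Graph G
  field
    label     : ∀ {x y} → x ~ y → Fin d
    label-sym : ∀ {x y} (e : x ~ y) (e′ : y ~ x) → label e ≡ label e′

DistinguishingVertex : (G : Graph) {r : ℕ} → VertexLabelling G r → Set
DistinguishingVertex G φ =
  ∀ (α : Automorphism G) → let open Automorphism α in
  (∀ x → φ (apply x) ≡ φ x) → IsIdentity

DistinguishingEdge : (G : Graph) {d : ℕ} → EdgeLabelling G d → Set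
DistinguishingEdge G ψ =
  ∀ (α : Automorphism G) → let open Automorphism α in
  (∀ {x y} (e : x ~ y) → label (preserves e) ≡ label e) → IsIdentity
  where
  open Graph G
  open EdgeLabelling ψ

IsLeast : (ℕ → Set) → ℕ → Set
IsLeast P m = P m × (∀ k → P k → m ≤ k)

IsLeast-unique : ∀ {P : ℕ → Set} {m n} → IsLeast P m → IsLeast P n → m ≡ n
IsLeast-unique (pm , m≤) (pn , n≤) = ≤-antisym (m≤ _ pn) (n≤ _ pm)

-- D(G) and D′(G) are stated as predicates on their (unique) values, since D′(G)
-- does not exist for every G (for instance, for a single edge).
IsDistinguishingNumber : Graph → ℕ → Set
IsDistinguishingNumber G =
  IsLeast λ r → ∃ λ (φ : VertexLabelling G r) → DistinguishingVertex G φ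

IsDistinguishingIndex : Graph → ℕ → Set
IsDistinguishingIndex G =
  IsLeast λ d → ∃ λ (ψ : EdgeLabelling G d) → DistinguishingEdge G ψ

{-# OPTIONS --safe #-}

-- Fix a distinguishing vertex labelling φ with r labels and suppose that every
-- edge labelling with r labels is respected by some automorphism not preserving φ.
--
-- Store vertex labels on edges as far as this can be done invariantly: a vertex of
-- low degree with exactly one neighbour of higher degree is contracted onto that
-- neighbour, and the edge between them carries its label.  What remains is a network
-- in which an automorphism only has to preserve φ on the kept vertices.  It is a
-- point, a pair, a cycle, or it has vertices of degree at least three while
-- vertices of degree two are never adjacent.
--
-- For a pair one stores labels along a breadth-first search from it; as G has a
-- cycle, some edge is spare and can be used to prevent the pair from being swapped.
-- For a cycle one marks a few edges (only r = 2 and length at most five is special).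
--
-- For r ≥ 3 take a cycle of the network, store labels along a breadth-first
-- forest rooted at it, and give all other links the label 1, which is not used on
-- the cycle.  The cycle is then the only one without the label 1, so it is
-- invariant, and its own labels can be chosen to fix it pointwise.
--
-- For r = 2 label the link ab by φ(a) + φ(b).  An automorphism respecting this
-- preserves φ or complements it.  To exclude the complementing automorphism τ, flip
-- the label of one link at the end of a longest path: it is the only link
-- common to two cycles, hence fixed by whatever respects the new labelling.  This
-- fails only if τ reverses that link, and then a Pósa rotation leads to a
-- shorter chord, so that infinite descent applies.
module Submission where

open import Defs
open import Data.Nat as ℕ using (ℕ; zero; suc; _+_; _∸_; _⊓_; _≤_; _<_; _≤?_; _<?_; z≤n; s≤s)
open import Data.Product using (∃; ∃-syntax; _×_; _,_; proj₁; proj₂)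
open import Data.Nat.Properties
  using (+-0-commutativeMonoid; +-mono-≤; +-mono-<-≤; +-mono-≤-<; +-suc; +-∸-assoc; m∸n≤m; n∸n≡0; ∸-cancelˡ-≡;
         0≢1+n; n≮0; ≤-refl; ≤-reflexive; ≤-trans; ≤-antisym; ≤-pred; ≤-total; ≤∧≢⇒<; <⇒≤; <⇒≱; ≰⇒>; <-irrefl; <-asym; <-trans; <-≤-trans; <-cmp;
         n<1+n; n≤1+n; m≤n⇒m≤1+n; m≤n⇒m<n∨m≡n; m≤m+n; ⊓-comm; ⊓-idem; ⊓-sel; m⊓n≤m; m⊓n≤n; anyUpTo?)
open import Data.Nat.Induction using (<-wellFounded)
open import Algebra.Properties.CommutativeMonoid.Sum +-0-commutativeMonoid using (sum; sum-permute)
open import Data.Fin using (Fin; zero; suc; fromℕ; inject₁; toℕ)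
open import Data.Fin.Permutation as Perm using (permutation; _⟨$⟩ʳ_; _⟨$⟩ˡ_)
open import Data.Fin.Properties
  using (_≟_; any?; all?; injective⇒≤; toℕ-fromℕ; toℕ-inject₁; toℕ-injective; toℕ<n)
open import Data.Fin.Relation.Unary.Top using (view; ‵fromℕ; ‵inject₁)
open import Data.Maybe as Maybe using (Maybe; just; nothing; maybe)
open import Data.Sum using (_⊎_; inj₁; inj₂; [_,_]′)
open import Data.Empty using (⊥; ⊥-elim)
open import Data.Unit using (⊤; tt)
open import Data.Vec using (Vec; []; _∷_; lookup; tabulate)
open import Data.Vec.Properties using (lookup∘tabulate)
open import Function using (_∘_; id)
open import Induction.WellFounded using (Acc; acc)
open import Relation.Binary.Construct.Closure.ReflexiveTransitive using (Star; ε; _◅_)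
open import Relation.Binary.Definitions using (tri<; tri≈; tri>)
open import Relation.Binary.PropositionalEquality
  using (_≡_; _≢_; refl; sym; trans; cong; cong₂; subst; subst₂)
open import Relation.Nullary using (¬_; Dec; yes; no)
open import Relation.Nullary.Decidable
  using (_×-dec_; _⊎-dec_; _→-dec_; ¬?; map′; decidable-stable; from-yes)

-- Finite search

-- The obstacle is one of counting. A spanning tree has one edge less than there are vertices, so
-- storing labels on the edges towards a root leaves the root's own label without a place, and no
-- additional label is available to single the root out. Only an edge outside the tree can make up
-- for this, hence the need for a cycle. A contraction, on the other hand, is free of charge: its
-- rule is invariant under all automorphisms, so the carrying edge is found again without any mark.
--
-- Excluding the label 1 from a cycle costs one label. With three labels two remain there, which is
-- enough unless the cycle is short; with two labels only 0 remains, and nothing on the cycle can be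
-- told apart. Sums modulo 2 avoid this loss: over a connected network they determine the labels up
-- to a single bit, and this bit is all that the flipped link has to decide.

Searchable : Set → Set₁
Searchable A = ∀ {P : A → Set} → (∀ a → Dec (P a)) → Dec (∃ P)

vec-searchable : ∀ {A} n → Searchable A → Searchable (Vec A n)
vec-searchable zero _ P? =
  map′ (λ p → [] , p) (λ { ([] , p) → p }) (P? [])
vec-searchable (suc n) search P? =
  map′ (λ { (a , v , p) → a ∷ v , p }) (λ { (a ∷ v , p) → a , v , p })
    (search λ a → vec-searchable n search λ v → P? (a ∷ v))

module Automorphisms (G : Graph) where

  open Graph G public

  Aut : Set
  Aut = Automorphism G

  infixr 9 _·_
  _·_ : Aut → Vertex → Vertex
  _·_ = Automorphism.apply

  infix 10 _⁻¹
  _⁻¹ : Aut → Aut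
  α ⁻¹ = record
    { perm = Perm.flip perm
    ; preserves = λ {x} {y} x~y →
        reflects (subst (λ z → z ~ perm ⟨$⟩ʳ (perm ⟨$⟩ˡ y)) (sym (Perm.inverseʳ perm))
          (subst (x ~_) (sym (Perm.inverseʳ perm)) x~y))
    ; reflects = λ {x} {y} x~y →
        subst (_~ y) (Perm.inverseʳ perm)
          (subst (perm ⟨$⟩ʳ (perm ⟨$⟩ˡ x) ~_) (Perm.inverseʳ perm) (preserves x~y))
    }
    where open Automorphism α

  infixr 8 _⊙_
  _⊙_ : Aut → Aut → Aut
  α ⊙ β = record
    { perm = Automorphism.perm β Perm.∘ₚ Automorphism.perm α
    ; preserves = Automorphism.preserves α ∘ Automorphism.preserves β
    ; reflects = Automorphism.reflects β ∘ Automorphism.reflects α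
    }

  ⁻¹-inverseˡ : ∀ α v → (α ⁻¹) · α · v ≡ v
  ⁻¹-inverseˡ α v = Perm.inverseˡ (Automorphism.perm α)

  ⁻¹-inverseʳ : ∀ α v → α · (α ⁻¹) · v ≡ v
  ⁻¹-inverseʳ α v = Perm.inverseʳ (Automorphism.perm α)

  ·-injective : ∀ α {u v} → α · u ≡ α · v → u ≡ v
  ·-injective α {u} {v} eq =
    trans (sym (⁻¹-inverseˡ α u)) (trans (cong ((α ⁻¹) ·_) eq) (⁻¹-inverseˡ α v))

  Respects : ∀ {k} → (Vertex → Vertex → Fin k) → Aut → Set
  Respects L α = ∀ x y → x ~ y → L (α · x) (α · y) ≡ L x y

  -- The search runs over tables of values, so `P` has to be invariant under pointwise equality. A
  -- table of the inverse is searched for as well, which turns bijectivity into two finite checks.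
  automorphism-search : ∀ {P : (Vertex → Vertex) → Set} →
    (∀ {f g} → (∀ x → f x ≡ g x) → P f → P g) → (∀ f → Dec (P f)) →
    Dec (∃[ α ] P (α ·_))
  automorphism-search {P} P-resp P? =
    map′ from to
      (vec-searchable order any? λ f → vec-searchable order any? λ g →
        (all? λ x → lookup f (lookup g x) ≟ x) ×-dec
        (all? λ x → lookup g (lookup f x) ≟ x) ×-dec
        (all? λ x → all? λ y → ~-dec x y →-dec ~-dec (lookup f x) (lookup f y)) ×-dec
        (all? λ x → all? λ y → ~-dec (lookup f x) (lookup f y) →-dec ~-dec x y) ×-dec
        P? (lookup f))
    where
    Encoded : Vec Vertex order → Vec Vertex order → Set
    Encoded f g =
      (∀ x → lookup f (lookup g x) ≡ x) ×
      (∀ x → lookup g (lookup f x) ≡ x) ×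
      (∀ x y → x ~ y → lookup f x ~ lookup f y) ×
      (∀ x y → lookup f x ~ lookup f y → x ~ y) ×
      P (lookup f)

    from : (∃[ f ] ∃[ g ] Encoded f g) → ∃[ α ] P (α ·_)
    from (f , g , fg , gf , pres , refl′ , p) =
      record { perm = permutation (lookup f) (lookup g) fg gf
             ; preserves = λ {x} {y} → pres x y ; reflects = λ {x} {y} → refl′ x y } , p

    to : ∃[ α ] P (α ·_) → ∃[ f ] ∃[ g ] Encoded f g
    to (α , p) = f , g
      , (λ x → trans (f≗ _) (trans (cong (α ·_) (g≗ x)) (⁻¹-inverseʳ α x)))
      , (λ x → trans (g≗ _) (trans (cong ((α ⁻¹) ·_) (f≗ x)) (⁻¹-inverseˡ α x)))
      , (λ x y x~y → subst (_~ lookup f y) (sym (f≗ x))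
          (subst (α · x ~_) (sym (f≗ y)) (Automorphism.preserves α x~y)))
      , (λ x y fx~fy → Automorphism.reflects α
          (subst (_~ α · y) (f≗ x) (subst (lookup f x ~_) (f≗ y) fx~fy)))
      , P-resp (λ x → sym (f≗ x)) p
      where
      f = tabulate (α ·_)
      g = tabulate ((α ⁻¹) ·_)
      f≗ : ∀ x → lookup f x ≡ α · x
      f≗ = lookup∘tabulate (α ·_)
      g≗ : ∀ x → lookup g x ≡ (α ⁻¹) · x
      g≗ = lookup∘tabulate ((α ⁻¹) ·_)

  -- The second alternative hands over an automorphism together with a vertex that it moves;
  -- `Unbreakable` asks for such a witness, not for the failure of a universal statement.
  only-identity? : ∀ {P : (Vertex → Vertex) → Set} →
    (∀ {f g} → (∀ x → f x ≡ g x) → P f → P g) → (∀ f → Dec (P f)) →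
    (∀ α → P (α ·_) → ∀ x → α · x ≡ x) ⊎ (∃[ α ] P (α ·_) × ∃[ x ] α · x ≢ x)
  only-identity? {P} P-resp P?
    with automorphism-search {λ f → P f × ∃[ x ] f x ≢ x}
           (λ { f≗g (p , x , q) → P-resp f≗g p , x , λ r → q (trans (f≗g x) r) })
           (λ f → P? f ×-dec any? λ x → ¬? (f x ≟ x))
  ... | yes (α , p , q) = inj₂ (α , p , q)
  ... | no none = inj₁ λ α p x →
    decidable-stable (α · x ≟ x) λ q → none (α , p , x , q)

  distinguishing-vertex? : ∀ {r} (φ : VertexLabelling G r) →
    DistinguishingVertex G φ ⊎ ¬ DistinguishingVertex G φ
  distinguishing-vertex? φ
    with only-identity? {λ f → ∀ x → φ (f x) ≡ φ x}
           (λ f≗g p x → trans (cong φ (sym (f≗g x))) (p x))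
           (λ f → all? λ x → φ (f x) ≟ φ x)
  ... | inj₁ ok = inj₁ ok
  ... | inj₂ (α , p , x , q) = inj₂ λ ok → q (ok α p x)

  broken : ∀ {k} (L : Vertex → Vertex → Fin k) →
    (∀ α → Respects L α → ∀ x → α · x ≡ x) ⊎ (∃[ α ] Respects L α × ∃[ x ] α · x ≢ x)
  broken L = only-identity? {λ f → ∀ x y → x ~ y → L (f x) (f y) ≡ L x y}
    (λ f≗g p x y x~y → trans (cong₂ L (sym (f≗g x)) (sym (f≗g y))) (p x y x~y))
    (λ f → all? λ x → all? λ y → ~-dec x y →-dec (L (f x) (f y) ≟ L x y))

  fromMatrix : ∀ {k} (L : Vertex → Vertex → Fin k) → (∀ x y → L x y ≡ L y x) →
    (∀ α → Respects L α → ∀ x → α · x ≡ x) →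
    ∃[ ψ ] DistinguishingEdge G {k} ψ
  fromMatrix L L-sym ok =
    record { label = λ {x} {y} _ → L x y ; label-sym = λ {x} {y} _ _ → L-sym x y } ,
    λ α p → ok α (λ x y → p {x} {y})

  toMatrix : ∀ {k x₀ y₀} → x₀ ~ y₀ → (ψ : EdgeLabelling G k) → DistinguishingEdge G ψ →
    ∃[ L ] (∀ (x y : Vertex) → L x y ≡ L y x) × (∀ α → Respects L α → ∀ x → α · x ≡ x)
  toMatrix {k} e₀ ψ ok = L , L-sym , λ α p → ok α λ {x} {y} e →
      trans (sym (L-label (Automorphism.preserves α e))) (trans (p x y e) (L-label e))
    where
    open EdgeLabelling ψ
    L : Vertex → Vertex → Fin k
    L x y with ~-dec x y
    ... | yes e = label e
    -- `Fin k` might be empty, so the entry at a non-edge borrows the label of a known edge.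
    -- `Respects` looks at edges only and never sees it.
    ... | no _ = label e₀

    L-sym : ∀ x y → L x y ≡ L y x
    L-sym x y with ~-dec x y | ~-dec y x
    ... | yes e | yes e′ = label-sym e e′
    ... | yes e | no ¬e = ⊥-elim (¬e (~-sym e))
    ... | no ¬e | yes e = ⊥-elim (¬e (~-sym e))
    ... | no _ | no _ = refl

    L-label : ∀ {x y} (e : x ~ y) → L x y ≡ label e
    L-label {x} {y} e with ~-dec x y
    ... | yes e′ = trans (label-sym e′ (~-sym e)) (sym (label-sym e (~-sym e)))
    ... | no ¬e = ⊥-elim (¬e e)

  distinguishing-edge? : ∀ {x₀ y₀} → x₀ ~ y₀ → ∀ k →
    Dec (∃ λ (ψ : EdgeLabelling G k) → DistinguishingEdge G ψ)
  distinguishing-edge? e₀ k = map′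
    (λ { (M , M-sym , ok) → fromMatrix (matrix M) M-sym ok })
    (λ { (ψ , ok) → let (L , L-sym , ok′) = toMatrix e₀ ψ ok in
         encode L , (λ x y → trans (encode-≗ L x y) (trans (L-sym x y) (sym (encode-≗ L y x)))) ,
         λ α p → ok′ α λ x y e →
           trans (sym (encode-≗ L _ _)) (trans (p x y e) (encode-≗ L x y)) })
    (vec-searchable order (vec-searchable order any?) λ M →
      (all? λ x → all? λ y → matrix M x y ≟ matrix M y x) ×-dec only? (matrix M))
    where
    matrix : Vec (Vec (Fin k) order) order → Vertex → Vertex → Fin k
    matrix M x y = lookup (lookup M x) y

    encode : (Vertex → Vertex → Fin k) → Vec (Vec (Fin k) order) order
    encode L = tabulate λ x → tabulate (L x)

    encode-≗ : ∀ L x y → matrix (encode L) x y ≡ L x y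
    encode-≗ L x y = trans (cong (λ row → lookup row y) (lookup∘tabulate (λ x → tabulate (L x)) x))
      (lookup∘tabulate (L x) y)

    only? : ∀ L → Dec (∀ α → Respects L α → ∀ x → α · x ≡ x)
    only? L with broken L
    ... | inj₁ ok = yes ok
    ... | inj₂ (α , p , x , q) = no λ ok → q (ok α p x)

  distinguishing-number? : ∀ r →
    Dec (∃ λ (φ : VertexLabelling G r) → DistinguishingVertex G φ)
  distinguishing-number? r = map′
    (λ { (v , ok) → lookup v , ok })
    (λ { (φ , ok) → tabulate φ , λ α p → ok α λ x →
         trans (sym (lookup∘tabulate φ _)) (trans (p x) (lookup∘tabulate φ x)) })
    (vec-searchable order any? {λ v → DistinguishingVertex G (lookup v)} λ v →
      dec (distinguishing-vertex? (lookup v)))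
    where
    dec : ∀ {A : Set} → A ⊎ ¬ A → Dec A
    dec (inj₁ a) = yes a
    dec (inj₂ ¬a) = no ¬a

least : ∀ {P : ℕ → Set} → (∀ k → Dec (P k)) → ∀ n → P n → ∃[ m ] IsLeast P m
least {P} P? n pn with P? 0
... | yes p = 0 , p , λ _ _ → z≤n
least P? zero pn | no ¬p = ⊥-elim (¬p pn)
least {P} P? (suc n) pn | no ¬p with least {P ∘ suc} (P? ∘ suc) n pn
... | m , pm , m≤ = suc m , pm , λ { zero p → ⊥-elim (¬p p) ; (suc k) p → s≤s (m≤ k p) }

Rigid : (G : Graph) {r : ℕ} → VertexLabelling G r → Set
Rigid G φ = ∀ α → (∀ v → φ (α · v) ≡ φ v) → ∀ v → α · v ≡ v
  where open Automorphisms G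

-- By `Rigid`, an automorphism that moves a vertex cannot preserve `φ`. Recording this failure means
-- that a labelling `L` already wins when it forces `φ` to be preserved; it need not be seen to
-- force the identity.
Unbreakable : (G : Graph) {r : ℕ} → VertexLabelling G r → Set
Unbreakable G {r} φ = ∀ (L : Vertex → Vertex → Fin r) → (∀ x y → L x y ≡ L y x) →
  ∃[ α ] Respects L α × ¬ (∀ x → φ (α · x) ≡ φ x)
  where open Automorphisms G

-- Graphs with an invariant pair of vertices

module Balls {n : ℕ} (R : Fin n → Fin n → Set) where

  data Ball (A : Fin n → Set) : ℕ → Fin n → Set where
    here : ∀ {v} → A v → Ball A 0 v
    stay : ∀ {k v} → Ball A k v → Ball A (suc k) v
    step : ∀ {k u v} → R u v → Ball A k u → Ball A (suc k) v

  Ball-map : ∀ {A B} (f : Fin n → Fin n) → (∀ {u v} → R u v → R (f u) (f v)) →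
    (∀ {v} → A v → B (f v)) → ∀ {k v} → Ball A k v → Ball B k (f v)
  Ball-map f f-R f-A (here a) = here (f-A a)
  Ball-map f f-R f-A (stay b) = stay (Ball-map f f-R f-A b)
  Ball-map f f-R f-A (step r b) = step (f-R r) (Ball-map f f-R f-A b)

module Distance {n : ℕ} (R : Fin n → Fin n → Set) (R? : ∀ u v → Dec (R u v))
  (Dom : Fin n → Set) (Dom? : ∀ v → Dec (Dom v)) (R-dom : ∀ {u v} → R u v → Dom u)
  (A : Fin n → Set) (A? : ∀ v → Dec (A v))
  (reach : ∀ v → Dom v → ∃[ a ] A a × Star R a v)
  where

  open Balls R

  Ball? : ∀ k v → Dec (Ball A k v)
  Ball? zero v = map′ here (λ { (here a) → a }) (A? v)
  Ball? (suc k) v = map′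
    [ stay , (λ { (u , r , b) → step r b }) ]′
    (λ { (stay b) → inj₁ b ; (step r b) → inj₂ (_ , r , b) })
    (Ball? k v ⊎-dec any? λ u → R? u v ×-dec Ball? k u)

  walk-ball : ∀ {k u v} → Star R u v → Ball A k u → ∃[ j ] Ball A j v
  walk-ball {k} ε b = k , b
  walk-ball (r ◅ rs) b = walk-ball rs (step r b)

  abstract
    nearest : ∀ v → Dom v → ∃[ m ] IsLeast (λ k → Ball A k v) m
    nearest v d =
      let (a , a∈A , walk) = reach v d
          (k , b) = walk-ball walk (here a∈A)
      in least (λ j → Ball? j v) k b

    dist : Fin n → ℕ
    dist v with Dom? v
    ... | yes d = proj₁ (nearest v d)
    -- A placeholder: every fact about `dist` below assumes `Dom`.
    ... | no _ = 0

    dist-least : ∀ v → Dom v → IsLeast (λ k → Ball A k v) (dist v)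
    dist-least v d with Dom? v
    ... | yes d′ = proj₂ (nearest v d′)
    ... | no ¬d = ⊥-elim (¬d d)

  dist-ball : ∀ {v} → Dom v → Ball A (dist v) v
  dist-ball d = proj₁ (dist-least _ d)

  dist-min : ∀ {v k} → Dom v → Ball A k v → dist v ≤ k
  dist-min d b = proj₂ (dist-least _ d) _ b

  dist≡0 : ∀ {v} → Dom v → dist v ≡ 0 → A v
  dist≡0 {v} d eq with dist v | dist-ball d
  dist≡0 d refl | zero | here a = a

  dist-source : ∀ {v} → Dom v → A v → dist v ≡ 0
  dist-source d a = ≤-antisym (dist-min d (here a)) z≤n

  dist-step : ∀ {u v} → Dom v → R u v → dist v ≤ suc (dist u)
  dist-step d r = dist-min d (step r (dist-ball (R-dom r)))

  parent : ∀ {v k} → Dom v → dist v ≡ suc k → ∃[ u ] R u v × dist u ≡ k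
  parent {v} {k} d eq with subst (λ j → Ball A j v) eq (dist-ball d)
  ... | stay b = ⊥-elim (<⇒≱ (n<1+n k) (subst (_≤ k) eq (dist-min d b)))
  ... | step {u = u} r b = u , r ,
    ≤-antisym (dist-min (R-dom r) b) (≤-pred (subst (_≤ suc (dist u)) eq (dist-step d r)))

argmax : ∀ {n} (f : Fin (suc n) → ℕ) → ∃[ i ] ∀ j → f j ≤ f i
argmax {zero} f = zero , λ { zero → ≤-refl }
argmax {suc n} f with argmax (f ∘ suc)
... | i , max with ≤-total (f zero) (f (suc i))
... | inj₁ le = suc i , λ { zero → le ; (suc j) → max j }
... | inj₂ ge = zero , λ { zero → ≤-refl ; (suc j) → ≤-trans (max j) ge }

module _ {G : Graph} (cycle : Cycle G) where
  open Graph G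
  open Cycle cycle

  private
    next : ∀ i → ∃[ j ] vertices i ~ vertices j × (toℕ j ≡ suc (toℕ i) ⊎ (toℕ j ≡ 0 × toℕ i ≡ 2 + excess))
    next i with view i
    ... | ‵fromℕ = zero , closes , inj₂ (refl , toℕ-fromℕ (2 + excess))
    ... | ‵inject₁ k = suc k , steps k , inj₁ (cong suc (sym (toℕ-inject₁ k)))

    previous : ∀ i → ∃[ j ] vertices j ~ vertices i × (toℕ i ≡ suc (toℕ j) ⊎ (toℕ i ≡ 0 × toℕ j ≡ 2 + excess))
    previous zero = fromℕ (2 + excess) , closes , inj₂ (refl , toℕ-fromℕ (2 + excess))
    previous (suc j) = inject₁ j , steps j , inj₁ (cong suc (sym (toℕ-inject₁ j)))

  -- If successor and predecessor coincided, the cycle would have length at most two.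
  cycle-neighbours : ∀ i → ∃[ j ] ∃[ k ] j ≢ k × vertices j ~ vertices i × vertices k ~ vertices i
  cycle-neighbours i with next i | previous i
  ... | j , i~j , nj | k , k~i , pk = j , k , distinct-neighbours nj pk , ~-sym i~j , k~i
    where
    distinct-neighbours : (toℕ j ≡ suc (toℕ i) ⊎ (toℕ j ≡ 0 × toℕ i ≡ 2 + excess)) →
      (toℕ i ≡ suc (toℕ k) ⊎ (toℕ i ≡ 0 × toℕ k ≡ 2 + excess)) → j ≢ k
    distinct-neighbours (inj₁ p) (inj₁ q) refl = <-irrefl (trans p (cong suc q)) (s≤s (m≤n⇒m≤1+n ≤-refl))
    distinct-neighbours (inj₁ p) (inj₂ (q , s)) refl with trans (sym s) (trans p (cong suc q))
    ... | ()
    distinct-neighbours (inj₂ (p , s)) (inj₁ q) refl with trans (sym s) (trans q (cong suc p))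
    ... | ()
    distinct-neighbours (inj₂ (p , s)) (inj₂ (q , t)) refl with trans (sym s) q
    ... | ()

module PairRoot (G : Graph) (connected : Connected G) (cycle : Cycle G) where

  open Automorphisms G
  open Balls _~_

  module From (x : Vertex) = Distance _~_ ~-dec (λ _ → ⊤) (λ _ → yes tt) (λ _ → tt) (_≡ x) (_≟ x)
    (λ v _ → x , refl , connected x v)

  Fixes : Vertex → Vertex → Aut → Set
  Fixes x y α = α · x ≡ x × α · y ≡ y

  Swaps : Vertex → Vertex → Aut → Set
  Swaps x y α = α · x ≡ y × α · y ≡ x

  dist-image : ∀ α {x x′} → α · x ≡ x′ → ∀ v → From.dist x′ (α · v) ≡ From.dist x v
  dist-image α {x} refl v = ≤-antisym
    (From.dist-min (α · x) {α · v} tt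
      (Ball-map {_≡ x} {_≡ α · x} (α ·_) (Automorphism.preserves α) (cong (α ·_)) (From.dist-ball x {v} tt)))
    (From.dist-min x {v} tt (subst (Ball (_≡ x) (From.dist (α · x) (α · v))) (⁻¹-inverseˡ α v)
      (Ball-map {_≡ α · x} {_≡ x} ((α ⁻¹) ·_) (Automorphism.preserves (α ⁻¹))
        (λ eq → trans (cong ((α ⁻¹) ·_) eq) (⁻¹-inverseˡ α x)) (From.dist-ball (α · x) {α · v} tt))))

  module _ {k : ℕ} (φ : VertexLabelling G (2 + k)) (unbreakable : Unbreakable G φ)
    (x y : Vertex) (x≢y : x ≢ y) (pair : ∀ α → Fixes x y α ⊎ Swaps x y α)
    where

    Label : Set
    Label = Fin (2 + k)

    dx dy level : Vertex → ℕ
    dx = From.dist x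
    dy = From.dist y
    level v = dx v ⊓ dy v

    level-image : ∀ α v → level (α · v) ≡ level v
    level-image α v with pair α
    ... | inj₁ (αx , αy) = cong₂ _⊓_ (dist-image α αx v) (dist-image α αy v)
    ... | inj₂ (αx , αy) = trans (cong₂ _⊓_ (dist-image α αy v) (dist-image α αx v)) (⊓-comm (dy v) (dx v))

    level-zero : ∀ v → level v ≡ 0 → v ≡ x ⊎ v ≡ y
    level-zero v eq with ⊓-sel (dx v) (dy v)
    ... | inj₁ e = inj₁ (From.dist≡0 x tt (trans (sym e) eq))
    ... | inj₂ e = inj₂ (From.dist≡0 y tt (trans (sym e) eq))

    Below : Vertex → Vertex → Set
    Below u v = u ~ v × level u < level v

    below : ∀ v {l} → level v ≡ suc l → ∃[ u ] Below u v
    below v eq with ⊓-sel (dx v) (dy v)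
    ... | inj₁ e with From.parent x {v} tt (trans (sym e) eq)
    ... | u , u~v , du = u , u~v ,
      subst (level u <_) (sym eq) (s≤s (subst (level u ≤_) du (m⊓n≤m (dx u) (dy u))))
    below v eq | inj₂ e with From.parent y {v} tt (trans (sym e) eq)
    ... | u , u~v , du = u , u~v ,
      subst (level u <_) (sym eq) (s≤s (subst (level u ≤_) du (m⊓n≤n (dx u) (dy u))))

    -- All automorphisms preserve levels, so an edge between two levels knows its lower end. `down`
    -- receives that end first and may therefore be asymmetric.
    module Layered (down across : Vertex → Vertex → Label) (across-sym : ∀ u v → across u v ≡ across v u) where

      label : Vertex → Vertex → Label
      label u v with <-cmp (level u) (level v)
      ... | tri< _ _ _ = down u v
      ... | tri≈ _ _ _ = across u v
      ... | tri> _ _ _ = down v u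

      label-sym : ∀ u v → label u v ≡ label v u
      label-sym u v with <-cmp (level u) (level v) | <-cmp (level v) (level u)
      ... | tri< _ _ _ | tri> _ _ _ = refl
      ... | tri≈ _ _ _ | tri≈ _ _ _ = across-sym u v
      ... | tri> _ _ _ | tri< _ _ _ = refl
      ... | tri< _ _ u≯v | tri< v<u _ _ = ⊥-elim (u≯v v<u)
      ... | tri< u<v _ _ | tri≈ _ eq _ = ⊥-elim (<-irrefl (sym eq) u<v)
      ... | tri≈ _ eq _ | tri< v<u _ _ = ⊥-elim (<-irrefl (sym eq) v<u)
      ... | tri≈ _ eq _ | tri> _ _ u<v = ⊥-elim (<-irrefl eq u<v)
      ... | tri> _ _ v<u | tri≈ _ eq _ = ⊥-elim (<-irrefl eq v<u)
      ... | tri> u≮v _ _ | tri> _ _ u<v = ⊥-elim (u≮v u<v)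

      label-down : ∀ {u v} → level u < level v → label u v ≡ down u v
      label-down {u} {v} u<v with <-cmp (level u) (level v)
      ... | tri< _ _ _ = refl
      ... | tri≈ ¬u<v _ _ = ⊥-elim (¬u<v u<v)
      ... | tri> ¬u<v _ _ = ⊥-elim (¬u<v u<v)

      label-across : ∀ {u v} → level u ≡ level v → label u v ≡ across u v
      label-across {u} {v} eq with <-cmp (level u) (level v)
      ... | tri< _ u≢v _ = ⊥-elim (u≢v eq)
      ... | tri≈ _ _ _ = refl
      ... | tri> _ u≢v _ = ⊥-elim (u≢v eq)

      bad : ∃[ α ] Respects label α × ¬ (∀ v → φ (α · v) ≡ φ v)
      bad = unbreakable label label-sym

      module _ {α : Aut} (resp : Respects label α) where

        respects-down : ∀ {u v} → Below u v → down (α · u) (α · v) ≡ down u v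
        respects-down {u} {v} (u~v , u<v) = trans
          (sym (label-down (subst₂ _<_ (sym (level-image α u)) (sym (level-image α v)) u<v)))
          (trans (resp u v u~v) (label-down u<v))

        respects-across : ∀ {u v} → u ~ v → level u ≡ level v → across (α · u) (α · v) ≡ across u v
        respects-across {u} {v} u~v eq = trans
          (sym (label-across (trans (level-image α u) (trans eq (sym (level-image α v))))))
          (trans (resp u v u~v) (label-across eq))

    preserved : ∀ α → Fixes x y α → (∀ {u v} → Below u v → φ (α · v) ≡ φ v) → ∀ v → φ (α · v) ≡ φ v
    preserved α (αx , αy) up v with level v in eq
    ... | suc l = up (proj₂ (below v eq))
    ... | zero with level-zero v eq
    ... | inj₁ refl = cong φ αx
    ... | inj₂ refl = cong φ αy

    -- Labelling p v and q v differently makes v the only vertex whose downward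
    -- edges carry two labels, whence v is fixed and need not carry its own label.
    two-below : ∀ v (side : Vertex → Label) {p q} → Below p v → Below q v →
      side p ≡ zero → side q ≡ suc zero →
      (∀ α → Swaps x y α → α · v ≡ v → side (α · p) ≢ side p) → ⊥
    two-below v side {p} {q} p<v q<v sp sq no-swap = ¬pres (preserved α fixes up)
      where
      down : Vertex → Vertex → Label
      down u w with w ≟ v
      ... | yes _ = side u
      ... | no _ = φ w

      down-at : ∀ u {w} → w ≡ v → down u w ≡ side u
      down-at u {w} eq with w ≟ v
      ... | yes _ = refl
      ... | no w≢v = ⊥-elim (w≢v eq)

      down-off : ∀ u {w} → w ≢ v → down u w ≡ φ w
      down-off u {w} w≢v with w ≟ v
      ... | yes eq = ⊥-elim (w≢v eq)
      ... | no _ = refl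

      open Layered down (λ _ _ → zero) (λ _ _ → refl)

      α = proj₁ bad
      resp = proj₁ (proj₂ bad)
      ¬pres = proj₂ (proj₂ bad)

      -- If `v` were moved, the images of both edges `p v` and `q v` would carry `φ (α · v)`,
      -- although these edges have the labels 0 and 1.
      αv : α · v ≡ v
      αv with α · v ≟ v
      ... | yes eq = eq
      ... | no αv≢v = ⊥-elim (0≢1 (trans (sym (through p<v sp)) (through q<v sq)))
        where
        0≢1 : zero ≢ suc zero
        0≢1 ()
        through : ∀ {u s} → Below u v → side u ≡ s → φ (α · v) ≡ s
        through {u} u<v su = trans (sym (down-off (α · u) αv≢v))
          (trans (respects-down {α} resp u<v) (trans (down-at u refl) su))

      fixes : Fixes x y α
      fixes = [ id , (λ s → ⊥-elim (no-swap α s αv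
        (trans (sym (down-at (α · p) αv)) (trans (respects-down {α} resp p<v) (down-at p refl))))) ]′ (pair α)

      up : ∀ {u w} → Below u w → φ (α · w) ≡ φ w
      up {u} {w} u<w with w ≟ v
      ... | yes refl = cong φ αv
      ... | no w≢v = trans (sym (down-off (α · u) (λ eq → w≢v (·-injective α (trans eq (sym αv))))))
        (trans (respects-down {α} resp u<w) (down-off u w≢v))

    -- Descend to a parent that is again equidistant. If there is none, the parent towards `x` is
    -- nearer to `x` and the one towards `y` nearer to `y`. Labelling the downward edges of `v` by
    -- the nearer root then exposes a swap that fixes `v`, since it would interchange the two
    -- labels.
    no-equidistant : ∀ l v → dx v ≡ l → dy v ≡ l → ⊥
    no-equidistant zero v ex ey = x≢y (trans (sym (From.dist≡0 x tt ex)) (From.dist≡0 y tt ey))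
    no-equidistant (suc l) v ex ey
      with From.parent x {v} tt ex | From.parent y {v} tt ey
    ... | p , p~v , dxp | q , q~v , dyq
      with dy p ℕ.≟ l | dx q ℕ.≟ l
    ... | yes dyp | _ = no-equidistant l p dxp dyp
    ... | no _ | yes dxq = no-equidistant l q dxq dyq
    ... | no dyp≢l | no dxq≢l = two-below v side
          (p~v , lower (m⊓n≤m (dx p) (dy p)) dxp) (q~v , lower (m⊓n≤n (dx q) (dy q)) dyq)
          (side-x p-x) (side-y (<-asym q-y)) λ α swap _ eq →
            0≢1 (trans (sym (trans eq (side-x p-x))) (side-y λ lt → <-asym p-x
              (subst₂ _<_ (dist-image α (proj₂ swap) p) (dist-image α (proj₁ swap) p) lt)))
      where
      0≢1 : zero ≢ suc zero
      0≢1 ()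

      side : Vertex → Label
      side u with dx u <? dy u
      ... | yes _ = zero
      ... | no _ = suc zero

      side-x : ∀ {u} → dx u < dy u → side u ≡ zero
      side-x {u} lt with dx u <? dy u
      ... | yes _ = refl
      ... | no ¬lt = ⊥-elim (¬lt lt)

      side-y : ∀ {u} → ¬ (dx u < dy u) → side u ≡ suc zero
      side-y {u} ¬lt with dx u <? dy u
      ... | yes lt = ⊥-elim (¬lt lt)
      ... | no _ = refl

      lower : ∀ {u d} → level u ≤ d → d ≡ l → level u < level v
      lower le refl = subst (_ <_) (sym (trans (cong₂ _⊓_ ex ey) (⊓-idem (suc l)))) (s≤s le)

      p-x : dx p < dy p
      p-x = subst (_< dy p) (sym dxp) (≤∧≢⇒< (≤-pred (subst (_≤ suc (dy p)) ey (From.dist-step y {p} {v} tt p~v)))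
        (dyp≢l ∘ sym))

      q-y : dy q < dx q
      q-y = subst (_< dx q) (sym dyq) (≤∧≢⇒< (≤-pred (subst (_≤ suc (dx q)) ex (From.dist-step x {q} {v} tt q~v)))
        (dxq≢l ∘ sym))

    no-swap-fix : ∀ α v → Swaps x y α → α · v ≡ v → ⊥
    no-swap-fix α v (αx , αy) αv = no-equidistant (dx v) v refl
      (trans (cong dy (sym αv)) (dist-image α αx v))

    -- As a swap fixes no vertex, the last condition of `two-below` is void, and any two lower
    -- neighbours may be labelled differently.
    unique-below : ∀ {v p q} → Below p v → Below q v → p ≢ q → ⊥
    unique-below {v} {p} {q} p<v q<v p≢q = two-below v side p<v q<v side-p side-q
      λ α swap αv _ → no-swap-fix α v swap αv
      where
      side : Vertex → Label
      side u with u ≟ p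
      ... | yes _ = zero
      ... | no _ = suc zero

      side-p : side p ≡ zero
      side-p with p ≟ p
      ... | yes _ = refl
      ... | no p≢p = ⊥-elim (p≢p refl)

      side-q : side q ≡ suc zero
      side-q with q ≟ p
      ... | yes q≡p = ⊥-elim (p≢q (sym q≡p))
      ... | no _ = refl

    -- The edge `a b` is spare, as it leads to no lower level. It becomes the only edge inside a
    -- level with label 1, so the pair of its ends is invariant. The downward edges of `a` and `b`,
    -- which exist on a positive level, tell the two apart instead of carrying `φ`; fixed vertices
    -- need no stored label.
    no-horizontal : ∀ {a b l} → a ~ b → level a ≡ suc l → level b ≡ suc l → ⊥
    no-horizontal {a} {b} a~b la lb = ¬pres (preserved α fixes up)
      where
      0≢1 : zero ≢ suc zero
      0≢1 ()

      a≢b : a ≢ b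
      a≢b eq = ~-irrefl eq a~b

      down : Vertex → Vertex → Label
      down u w with w ≟ a | w ≟ b
      ... | yes _ | _ = zero
      ... | no _ | yes _ = suc zero
      ... | no _ | no _ = φ w

      down-a : ∀ u {w} → w ≡ a → down u w ≡ zero
      down-a u {w} eq with w ≟ a | w ≟ b
      ... | yes _ | _ = refl
      ... | no w≢a | _ = ⊥-elim (w≢a eq)

      down-b : ∀ u {w} → w ≡ b → down u w ≡ suc zero
      down-b u {w} eq with w ≟ a | w ≟ b
      ... | yes w≡a | _ = ⊥-elim (a≢b (trans (sym w≡a) eq))
      ... | no _ | yes _ = refl
      ... | no _ | no w≢b = ⊥-elim (w≢b eq)

      down-off : ∀ u {w} → w ≢ a → w ≢ b → down u w ≡ φ w
      down-off u {w} w≢a w≢b with w ≟ a | w ≟ b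
      ... | yes eq | _ = ⊥-elim (w≢a eq)
      ... | no _ | yes eq = ⊥-elim (w≢b eq)
      ... | no _ | no _ = refl

      Marked : Vertex → Vertex → Set
      Marked u w = (u ≡ a × w ≡ b) ⊎ (u ≡ b × w ≡ a)

      marked? : ∀ u w → Dec (Marked u w)
      marked? u w = (u ≟ a ×-dec w ≟ b) ⊎-dec (u ≟ b ×-dec w ≟ a)

      across : Vertex → Vertex → Label
      across u w with marked? u w
      ... | yes _ = suc zero
      ... | no _ = zero

      across-marked : ∀ u w → across u w ≡ suc zero → Marked u w
      across-marked u w eq with marked? u w
      ... | yes m = m

      flip : ∀ {u w} → Marked u w → Marked w u
      flip (inj₁ (p , q)) = inj₂ (q , p)
      flip (inj₂ (p , q)) = inj₁ (q , p)

      across-sym : ∀ u w → across u w ≡ across w u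
      across-sym u w with marked? u w | marked? w u
      ... | yes _ | yes _ = refl
      ... | yes m | no ¬m = ⊥-elim (¬m (flip m))
      ... | no ¬m | yes m = ⊥-elim (¬m (flip m))
      ... | no _ | no _ = refl

      across-ab : across a b ≡ suc zero
      across-ab with marked? a b
      ... | yes _ = refl
      ... | no ¬m = ⊥-elim (¬m (inj₁ (refl , refl)))

      open Layered down across across-sym

      α = proj₁ bad
      resp = proj₁ (proj₂ bad)
      ¬pres = proj₂ (proj₂ bad)

      not-swapped : α · a ≢ b
      not-swapped αa≡b = let (u , u<a) = below a la in
        0≢1 (trans (sym (down-a u refl)) (trans (sym (respects-down {α} resp u<a)) (down-b (α · u) αa≡b)))

      αab : α · a ≡ a × α · b ≡ b
      αab = [ id , (λ (αa≡b , _) → ⊥-elim (not-swapped αa≡b)) ]′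
        (across-marked _ _ (trans (respects-across {α} resp a~b (trans la (sym lb))) across-ab))

      fixes : Fixes x y α
      fixes = [ id , (λ s → ⊥-elim (no-swap-fix α a s (proj₁ αab))) ]′ (pair α)

      up : ∀ {u w} → Below u w → φ (α · w) ≡ φ w
      up {u} {w} u<w with w ≟ a | w ≟ b
      ... | yes refl | _ = cong φ (proj₁ αab)
      ... | no _ | yes refl = cong φ (proj₂ αab)
      ... | no w≢a | no w≢b = trans
        (sym (down-off (α · u)
          (λ eq → w≢a (·-injective α (trans eq (sym (proj₁ αab)))))
          (λ eq → w≢b (·-injective α (trans eq (sym (proj₂ αab)))))))
        (trans (respects-down {α} resp u<w) (down-off u w≢a w≢b))

    -- At a vertex of greatest level on the cycle no neighbour along the cycle is higher: one on the
    -- same level contradicts `no-horizontal`, two below contradict `unique-below`. On level 0 three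
    -- distinct vertices would have to be among `x` and `y`.
    impossible : ⊥
    impossible with argmax (level ∘ Cycle.vertices cycle)
    ... | i , max with cycle-neighbours cycle i
    ... | j , k , j≢k , j~i , k~i = go (level (c i)) refl
      where
      c = Cycle.vertices cycle

      c≢ : c j ≢ c k
      c≢ eq = j≢k (Cycle.distinct cycle eq)

      go : ∀ l → level (c i) ≡ l → ⊥
      go zero eq with level-zero (c i) eq
        | level-zero (c j) (≤-antisym (subst (level (c j) ≤_) eq (max j)) z≤n)
        | level-zero (c k) (≤-antisym (subst (level (c k) ≤_) eq (max k)) z≤n)
      ... | inj₁ p | inj₁ q | _ = ~-irrefl (trans q (sym p)) j~i
      ... | inj₂ p | inj₂ q | _ = ~-irrefl (trans q (sym p)) j~i
      ... | inj₁ p | _ | inj₁ q = ~-irrefl (trans q (sym p)) k~i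
      ... | inj₂ p | _ | inj₂ q = ~-irrefl (trans q (sym p)) k~i
      ... | inj₁ _ | inj₂ p | inj₂ q = c≢ (trans p (sym q))
      ... | inj₂ _ | inj₁ p | inj₁ q = c≢ (trans p (sym q))
      go (suc l) eq with level (c j) ℕ.≟ level (c i) | level (c k) ℕ.≟ level (c i)
      ... | yes p | _ = no-horizontal j~i (trans p eq) eq
      ... | no _ | yes p = no-horizontal k~i (trans p eq) eq
      ... | no p | no q = unique-below (j~i , ≤∧≢⇒< (max j) p) (k~i , ≤∧≢⇒< (max k) q) c≢

-- Equivariant contraction

sum-mono : ∀ {n} (f g : Fin n → ℕ) → (∀ v → f v ≤ g v) → sum f ≤ sum g
sum-mono {zero} f g le = z≤n
sum-mono {suc n} f g le = +-mono-≤ (le zero) (sum-mono (f ∘ suc) (g ∘ suc) (le ∘ suc))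

sum-strict : ∀ {n} (f g : Fin n → ℕ) → (∀ v → f v ≤ g v) → ∀ x → f x < g x → sum f < sum g
sum-strict f g le zero lt = +-mono-<-≤ lt (sum-mono (f ∘ suc) (g ∘ suc) (le ∘ suc))
sum-strict f g le (suc x) lt = +-mono-≤-< (le zero) (sum-strict (f ∘ suc) (g ∘ suc) (le ∘ suc) x lt)

indicator : ∀ {A : Set} → Dec A → ℕ
indicator (yes _) = 1
indicator (no _) = 0

module Degrees {n : ℕ} (_—_ : Fin n → Fin n → Set) (link? : ∀ a b → Dec (a — b)) where

  Has₂ Has₃ : Fin n → Set
  Has₂ a = ∃[ b ] ∃[ c ] b ≢ c × a — b × a — c
  Has₃ a = ∃[ b ] ∃[ c ] ∃[ d ] b ≢ c × b ≢ d × c ≢ d × a — b × a — c × a — d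

  has₂? : ∀ a → Dec (Has₂ a)
  has₂? a = any? λ b → any? λ c → ¬? (b ≟ c) ×-dec link? a b ×-dec link? a c

  has₃? : ∀ a → Dec (Has₃ a)
  has₃? a = any? λ b → any? λ c → any? λ d → ¬? (b ≟ c) ×-dec ¬? (b ≟ d) ×-dec ¬? (c ≟ d) ×-dec
    link? a b ×-dec link? a c ×-dec link? a d

  module _ (f : Fin n → Fin n) (f-injective : ∀ {a b} → f a ≡ f b → a ≡ b)
    (f-link : ∀ {a b} → a — b → f a — f b) where

    has₂-map : ∀ {a} → Has₂ a → Has₂ (f a)
    has₂-map (b , c , b≢c , ab , ac) = f b , f c , b≢c ∘ f-injective , f-link ab , f-link ac

    has₃-map : ∀ {a} → Has₃ a → Has₃ (f a)
    has₃-map (b , c , d , b≢c , b≢d , c≢d , ab , ac , ad) =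
      f b , f c , f d , b≢c ∘ f-injective , b≢d ∘ f-injective , c≢d ∘ f-injective ,
      f-link ab , f-link ac , f-link ad

  -- For `B` one takes `Has₂`, which contracts a vertex of degree one onto its neighbour, and
  -- `Has₃`, which contracts a vertex of degree at most two onto its only neighbour of degree at
  -- least three.
  Leads : (Fin n → Set) → Fin n → Fin n → Set
  Leads B v w = ¬ B v × B w × v — w × (∀ u → B u → v — u → u ≡ w)

  leads? : ∀ {B} → (∀ v → Dec (B v)) → ∀ v w → Dec (Leads B v w)
  leads? B? v w = ¬? (B? v) ×-dec B? w ×-dec link? v w ×-dec
    all? λ u → B? u →-dec (link? v u →-dec u ≟ w)

module Skeletons (G : Graph) (connected : Connected G) where

  open Automorphisms G

  -- A vertex v with ρ v ≢ v has been contracted onto ρ v, and the edges with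
  -- own x y ≡ just v are those that will carry the label of v.
  record Skeleton : Set where
    field
      ρ : Vertex → Vertex
      ρ-idempotent : ∀ v → ρ (ρ v) ≡ ρ v
      ρ-image : ∀ α v → ρ (α · v) ≡ α · ρ v
      own : Vertex → Vertex → Maybe Vertex
      own-sym : ∀ x y → own x y ≡ own y x
      own-image : ∀ α x y → own (α · x) (α · y) ≡ Maybe.map (α ·_) (own x y)
      own-contracted : ∀ {x y v} → own x y ≡ just v → ρ x ≡ ρ y
      owner : ∀ v → ρ v ≢ v → ∃[ x ] ∃[ y ] x ~ y × own x y ≡ just v

    Kept : Vertex → Set
    Kept v = ρ v ≡ v

    kept? : ∀ v → Dec (Kept v)
    kept? v = ρ v ≟ v

    infix 4 _—_
    -- Adjacency in the quotient by `ρ`. Several edges may represent one link; `Lift` gives all of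
    -- them the label of the link.
    _—_ : Vertex → Vertex → Set
    a — b = a ≢ b × ∃[ x ] ∃[ y ] x ~ y × ρ x ≡ a × ρ y ≡ b

    link? : ∀ a b → Dec (a — b)
    link? a b = ¬? (a ≟ b) ×-dec any? λ x → any? λ y → ~-dec x y ×-dec (ρ x ≟ a) ×-dec (ρ y ≟ b)

    link-sym : ∀ {a b} → a — b → b — a
    link-sym (a≢b , x , y , x~y , ρx , ρy) = a≢b ∘ sym , y , x , ~-sym x~y , ρy , ρx

    link-kept : ∀ {a b} → a — b → Kept a
    link-kept (_ , x , _ , _ , refl , _) = ρ-idempotent x

    link-image : ∀ α {a b} → a — b → α · a — α · b
    link-image α (a≢b , x , y , x~y , ρx , ρy) =
      a≢b ∘ ·-injective α , α · x , α · y , Automorphism.preserves α x~y ,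
      trans (ρ-image α x) (cong (α ·_) ρx) , trans (ρ-image α y) (cong (α ·_) ρy)

    link-preimage : ∀ α {a b} → α · a — b → a — (α ⁻¹) · b
    link-preimage α {a} {b} l = subst (_— (α ⁻¹) · b) (⁻¹-inverseˡ α a) (link-image (α ⁻¹) l)

    kept-image : ∀ α {v} → Kept v → Kept (α · v)
    kept-image α {v} k = trans (ρ-image α v) (cong (α ·_) k)

    link-walk : ∀ {x y} → Star _~_ x y → Star _—_ (ρ x) (ρ y)
    link-walk ε = ε
    link-walk {x} {y} (_◅_ {j = z} x~z walk) with ρ x ≟ ρ z
    ... | yes eq = subst (λ a → Star _—_ a (ρ y)) (sym eq) (link-walk walk)
    ... | no ρx≢ρz = (ρx≢ρz , x , z , x~z , refl , refl) ◅ link-walk walk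

    kept-connected : ∀ {a b} → Kept a → Kept b → Star _—_ a b
    kept-connected {a} {b} ka kb = subst₂ (Star _—_) ka kb (link-walk (connected a b))

    open Degrees _—_ link? public

    has₂-image : ∀ α {a} → Has₂ a → Has₂ (α · a)
    has₂-image α = has₂-map (α ·_) (·-injective α) (link-image α)

    has₃-image : ∀ α {a} → Has₃ a → Has₃ (α · a)
    has₃-image α = has₃-map (α ·_) (·-injective α) (link-image α)

    size : ℕ
    size = sum λ v → indicator (kept? v)

  module Contract (s : Skeleton) {B : Vertex → Set} (B? : ∀ v → Dec (B v))
    (B-image : ∀ α {v} → B v → B (α · v)) where

    open Skeleton s

    leads-image : ∀ α {v w} → Leads B v w → Leads B (α · v) (α · w)
    leads-image α {v} {w} (¬bv , bw , vw , uniq) =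
      (λ b → ¬bv (subst B (⁻¹-inverseˡ α v) (B-image (α ⁻¹) b))) , B-image α bw , link-image α vw ,
      λ u bu l → trans (sym (⁻¹-inverseʳ α u))
        (cong (α ·_) (uniq ((α ⁻¹) · u) (B-image (α ⁻¹) bu) (link-preimage α l)))

    leads-preimage : ∀ α {v w} → Leads B (α · v) (α · w) → Leads B v w
    leads-preimage α {v} {w} l =
      subst₂ (Leads B) (⁻¹-inverseˡ α v) (⁻¹-inverseˡ α w) (leads-image (α ⁻¹) l)

    exit? : ∀ v → Dec (∃[ w ] Leads B v w)
    exit? v = any? (leads? B? v)

    step : Vertex → Vertex
    step v with exit? v
    ... | yes (w , _) = w
    ... | no _ = v

    step-leads : ∀ {v w} → Leads B v w → step v ≡ w
    step-leads {v} {w} l with exit? v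
    ... | yes (w′ , _ , bw′ , vw′ , _) = proj₂ (proj₂ (proj₂ l)) w′ bw′ vw′
    ... | no none = ⊥-elim (none (w , l))

    step-stays : ∀ {v} → ¬ (∃[ w ] Leads B v w) → step v ≡ v
    step-stays {v} none with exit? v
    ... | yes e = ⊥-elim (none e)
    ... | no _ = refl

    step-target : ∀ {v w} → Leads B v w → step w ≡ w
    step-target (_ , bw , _) = step-stays λ { (_ , ¬bw , _) → ¬bw bw }

    step-idempotent : ∀ v → step (step v) ≡ step v
    step-idempotent v with exit? v
    ... | yes (w , l) = step-target l
    ... | no none = step-stays none

    step-kept : ∀ {v} → Kept v → Kept (step v)
    step-kept {v} k with exit? v
    ... | yes (w , _ , _ , vw , _) = link-kept (link-sym vw)
    ... | no _ = k

    step-image : ∀ α v → step (α · v) ≡ α · step v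
    step-image α v with exit? v
    ... | yes (w , l) = step-leads (leads-image α l)
    ... | no none = step-stays λ { (w , l) → none ((α ⁻¹) · w ,
      leads-preimage α (subst (Leads B (α · v)) (sym (⁻¹-inverseʳ α w)) l)) }

    ρ′ : Vertex → Vertex
    ρ′ v = step (ρ v)

    claim : Vertex → Vertex → Maybe Vertex
    claim a b with leads? B? a b | leads? B? b a
    ... | yes _ | _ = just a
    ... | no _ | yes _ = just b
    ... | no _ | no _ = nothing

    claim-sym : ∀ a b → claim a b ≡ claim b a
    claim-sym a b with leads? B? a b | leads? B? b a
    ... | yes (_ , bb , _) | yes (¬bb , _) = ⊥-elim (¬bb bb)
    ... | yes _ | no _ = refl
    ... | no _ | yes _ = refl
    ... | no _ | no _ = refl

    claim-leads : ∀ {a b} → Leads B a b → claim a b ≡ just a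
    claim-leads {a} {b} l with leads? B? a b | leads? B? b a
    ... | yes _ | _ = refl
    ... | no ¬l | _ = ⊥-elim (¬l l)

    claim-image : ∀ α a b → claim (α · a) (α · b) ≡ Maybe.map (α ·_) (claim a b)
    claim-image α a b with leads? B? a b | leads? B? b a
    ... | yes l | _ = claim-leads (leads-image α l)
    ... | no _ | yes l = trans (claim-sym (α · a) (α · b)) (claim-leads (leads-image α l))
    ... | no ¬ab | no ¬ba with leads? B? (α · a) (α · b) | leads? B? (α · b) (α · a)
    ... | yes l | _ = ⊥-elim (¬ab (leads-preimage α l))
    ... | no _ | yes l = ⊥-elim (¬ba (leads-preimage α l))
    ... | no _ | no _ = refl

    claim-joined : ∀ {a b v} → claim a b ≡ just v → step a ≡ step b
    claim-joined {a} {b} eq with leads? B? a b | leads? B? b a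
    ... | yes l | _ = trans (step-leads l) (sym (step-target l))
    ... | no _ | yes l = trans (step-target l) (sym (step-leads l))

    -- Earlier owners take precedence. Since `claim` looks only at the images under `ρ`, all edges
    -- that represent the link from a contracted vertex to its target go to that vertex at once; no
    -- choice is made, which keeps ownership equivariant.
    own′ : Vertex → Vertex → Maybe Vertex
    own′ x y = maybe just (claim (ρ x) (ρ y)) (own x y)

    own′-image : ∀ α x y → own′ (α · x) (α · y) ≡ Maybe.map (α ·_) (own′ x y)
    own′-image α x y rewrite own-image α x y | ρ-image α x | ρ-image α y with own x y
    ... | just v = refl
    ... | nothing = claim-image α (ρ x) (ρ y)

    own′-contracted : ∀ {x y v} → own′ x y ≡ just v → ρ′ x ≡ ρ′ y
    own′-contracted {x} {y} eq with own x y in own≡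
    ... | just _ = cong step (own-contracted own≡)
    ... | nothing = claim-joined eq

    owner′ : ∀ v → ρ′ v ≢ v → ∃[ x ] ∃[ y ] x ~ y × own′ x y ≡ just v
    owner′ v moved with kept? v
    ... | no ¬k with owner v ¬k
    ... | x , y , x~y , eq = x , y , x~y , cong (maybe just (claim (ρ x) (ρ y))) eq
    owner′ v moved | yes k with exit? v
    ... | no none = ⊥-elim (moved (trans (cong step k) (step-stays none)))
    ... | yes (w , l@(_ , _ , (v≢w , x , y , x~y , ρx , ρy) , _)) with own x y in own≡
    ... | just _ = ⊥-elim (v≢w (trans (sym ρx) (trans (own-contracted own≡) ρy)))
    ... | nothing = x , y , x~y , trans (cong (maybe just (claim (ρ x) (ρ y))) own≡)
          (trans (cong₂ claim ρx ρy) (claim-leads l))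

    contract : Skeleton
    contract = record
      { ρ = ρ′
      ; ρ-idempotent = λ v → trans (cong step (step-kept (ρ-idempotent v))) (step-idempotent (ρ v))
      ; ρ-image = λ α v → trans (cong step (ρ-image α v)) (step-image α (ρ v))
      ; own = own′
      ; own-sym = λ x y → cong₂ (maybe just) (claim-sym (ρ x) (ρ y)) (own-sym x y)
      ; own-image = own′-image
      ; own-contracted = own′-contracted
      ; owner = owner′
      }

    kept-before : ∀ {v} → ρ′ v ≡ v → Kept v
    kept-before {v} k = subst Kept k (step-kept (ρ-idempotent v))

    contract-smaller : ∀ {v w} → Leads B v w → Skeleton.size contract < size
    contract-smaller {v} {w} l@(_ , _ , vw@(v≢w , _) , _) = sum-strict _ _ le v lt
      where
      le : ∀ u → indicator (Skeleton.kept? contract u) ≤ indicator (kept? u)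
      le u with Skeleton.kept? contract u | kept? u
      ... | yes _ | yes _ = ≤-refl
      ... | yes k | no ¬k = ⊥-elim (¬k (kept-before k))
      ... | no _ | _ = z≤n

      lt : indicator (Skeleton.kept? contract v) < indicator (kept? v)
      lt with Skeleton.kept? contract v | kept? v
      ... | yes k | _ = ⊥-elim (v≢w (trans (sym k) (trans (cong step (link-kept vw)) (step-leads l))))
      ... | no _ | yes _ = s≤s z≤n
      ... | no _ | no ¬k = ⊥-elim (¬k (link-kept vw))

  Irreducible : Skeleton → Set
  Irreducible s = (∀ v w → ¬ Leads Has₂ v w) × (∀ v w → ¬ Leads Has₃ v w)
    where open Skeleton s

  irreducible-from : ∀ s → Acc _<_ (Skeleton.size s) → ∃[ s′ ] Irreducible s′
  irreducible-from s (acc smaller)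
    with any? (λ v → any? λ w → Skeleton.leads? s (Skeleton.has₂? s) v w)
       | any? (λ v → any? λ w → Skeleton.leads? s (Skeleton.has₃? s) v w)
  ... | yes (v , w , l) | _ = irreducible-from contract (smaller (contract-smaller l))
    where open Contract s (Skeleton.has₂? s) (Skeleton.has₂-image s)
  ... | no _ | yes (v , w , l) = irreducible-from contract (smaller (contract-smaller l))
    where open Contract s (Skeleton.has₃? s) (Skeleton.has₃-image s)
  ... | no ¬₂ | no ¬₃ = s , (λ v w l → ¬₂ (v , w , l)) , (λ v w l → ¬₃ (v , w , l))

  whole : Skeleton
  whole = record
    { ρ = id
    ; ρ-idempotent = λ _ → refl
    ; ρ-image = λ _ _ → refl
    ; own = λ _ _ → nothing
    ; own-sym = λ _ _ → refl
    ; own-image = λ _ _ _ → refl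
    ; own-contracted = λ ()
    ; owner = λ v moved → ⊥-elim (moved refl)
    }

  irreducible : ∃[ s ] Irreducible s
  irreducible = irreducible-from whole (<-wellFounded _)

-- Networks and their shapes

-- An abstract connected graph on the kept vertices, with those properties of the
-- irreducible skeleton that the remaining argument uses.
record Network (G : Graph) {r : ℕ} (φ : VertexLabelling G r) : Set₁ where
  open Automorphisms G
  infix 4 _—_
  field
    Kept : Vertex → Set
    kept? : ∀ v → Dec (Kept v)
    _—_ : Vertex → Vertex → Set
    link? : ∀ a b → Dec (a — b)
    link-sym : ∀ {a b} → a — b → b — a
    link-irrefl : ∀ {a} → ¬ a — a
    link-kept : ∀ {a b} → a — b → Kept a
    link-image : ∀ α {a b} → a — b → α · a — α · b
    kept-image : ∀ α {a} → Kept a → Kept (α · a)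
    kept-connected : ∀ {a b} → Kept a → Kept b → Star _—_ a b

  RespectsLinks : (Vertex → Vertex → Fin r) → Aut → Set
  RespectsLinks L α = ∀ a b → a — b → L (α · a) (α · b) ≡ L a b

  PreservesOff : Aut → Set
  PreservesOff α = ∀ v → ¬ Kept v → φ (α · v) ≡ φ v

  PreservesKept : Aut → Set
  PreservesKept α = ∀ v → Kept v → φ (α · v) ≡ φ v

  field
    rigid : Rigid G φ
    unbreakable : ∀ (L : Vertex → Vertex → Fin r) → (∀ a b → L a b ≡ L b a) →
      ∃[ α ] RespectsLinks L α × PreservesOff α × ¬ PreservesKept α

  open Degrees _—_ link? public

  field
    irreducible₂ : ∀ v w → ¬ Leads Has₂ v w
    irreducible₃ : ∀ v w → ¬ Leads Has₃ v w

module FromSkeleton (G : Graph) (connected : Connected G) {r : ℕ} (φ : VertexLabelling G r)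
  (rigid : Rigid G φ) (unbreakable : Unbreakable G φ) where

  open Automorphisms G
  open Skeletons G connected

  module _ (s : Skeleton) (irr : Irreducible s) where
    open Skeleton s

    module Lift (L : Vertex → Vertex → Fin r) (L-sym : ∀ a b → L a b ≡ L b a) where

      -- An owned edge carries the label of its owner. By equivariance of `own`, whatever respects
      -- `lift` preserves `φ` at contracted vertices, and the failure is confined to kept ones.
      lift : Vertex → Vertex → Fin r
      lift x y = maybe φ (L (ρ x) (ρ y)) (own x y)

      lift-sym : ∀ x y → lift x y ≡ lift y x
      lift-sym x y = cong₂ (maybe φ) (L-sym (ρ x) (ρ y)) (own-sym x y)

      α : Aut
      α = proj₁ (unbreakable lift lift-sym)
      respects : Respects lift α
      respects = proj₁ (proj₂ (unbreakable lift lift-sym))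

      links : ∀ a b → a — b → L (α · a) (α · b) ≡ L a b
      links _ _ (a≢b , x , y , x~y , refl , refl) with own x y in own≡ | respects x y x~y
      ... | just v | _ = ⊥-elim (a≢b (own-contracted own≡))
      ... | nothing | eq rewrite own-image α x y | own≡ | ρ-image α x | ρ-image α y = eq

      off : ∀ v → ¬ Kept v → φ (α · v) ≡ φ v
      off v ¬k with owner v ¬k
      ... | x , y , x~y , own≡ with respects x y x~y
      ... | eq rewrite own-image α x y | own≡ = eq

      moved : ¬ (∀ v → Kept v → φ (α · v) ≡ φ v)
      moved on = proj₂ (proj₂ (unbreakable lift lift-sym)) λ v → by-cases v (kept? v)
        where
        by-cases : ∀ v → Dec (Kept v) → φ (α · v) ≡ φ v
        by-cases v (yes k) = on v k
        by-cases v (no ¬k) = off v ¬k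

    network : Network G φ
    network = record
      { Kept = Kept ; kept? = kept? ; _—_ = _—_ ; link? = link? ; link-sym = link-sym
      ; link-irrefl = λ l → proj₁ l refl
      ; link-kept = link-kept ; link-image = link-image ; kept-image = kept-image
      ; kept-connected = kept-connected
      ; rigid = rigid
      ; unbreakable = λ L L-sym → let open Lift L L-sym in α , links , off , moved
      ; irreducible₂ = proj₁ irr
      ; irreducible₃ = proj₂ irr
      }

module NetworkLemmas {G : Graph} {r : ℕ} {φ : VertexLabelling G r} (N : Network G φ) where

  open Automorphisms G public
  open Network N public

  spread : ∀ {P : Vertex → Set} → (∀ {a b} → P a → a — b → P b) →
    ∀ {a} → P a → Kept a → ∀ b → Kept b → P b
  spread {P} next {a} pa ka b kb = along (kept-connected ka kb) pa
    where
    along : ∀ {c} → Star _—_ c b → P c → P b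
    along ε p = p
    along (l ◅ walk) p = along walk (next p l)

  distinct-links : ∀ {a b} → a — b → a ≢ b
  distinct-links l refl = link-irrefl l

  kept-preimage : ∀ α {a} → Kept (α · a) → Kept a
  kept-preimage α {a} k = subst Kept (⁻¹-inverseˡ α a) (kept-image (α ⁻¹) k)

  has₃-image : ∀ α {a} → Has₃ a → Has₃ (α · a)
  has₃-image α = has₃-map (α ·_) (·-injective α) (link-image α)

  off-inverse : ∀ α → PreservesOff α → PreservesOff (α ⁻¹)
  off-inverse α off v ¬k = trans (sym (off ((α ⁻¹) · v) (¬k ∘ k))) (cong φ (⁻¹-inverseʳ α v))
    where
    k : Kept ((α ⁻¹) · v) → Kept v
    k = subst Kept (⁻¹-inverseʳ α v) ∘ kept-image α

  off-compose : ∀ α β → PreservesOff α → PreservesOff β → PreservesOff (α ⊙ β)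
  off-compose α β offα offβ v ¬k =
    trans (offα (β · v) (¬k ∘ kept-preimage β)) (offβ v ¬k)

  rigid-kept : ∀ α → PreservesOff α → PreservesKept α → ∀ v → α · v ≡ v
  rigid-kept α off on = rigid α λ v → by-cases v (kept? v)
    where
    by-cases : ∀ v → Dec (Kept v) → φ (α · v) ≡ φ v
    by-cases v (yes k) = on v k
    by-cases v (no ¬k) = off v ¬k

  not-third : ∀ {a b c d} → ¬ Has₃ a → a — b → a — c → a — d → b ≢ c → d ≡ b ⊎ d ≡ c
  not-third {a} {b} {c} {d} ¬3 ab ac ad b≢c with d ≟ b | d ≟ c
  ... | yes p | _ = inj₁ p
  ... | no _ | yes q = inj₂ q
  ... | no p | no q = ⊥-elim (¬3 (b , c , d , b≢c , p ∘ sym , q ∘ sym , ab , ac , ad))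

  other : ∀ {a b} → Has₂ a → ∃[ c ] a — c × c ≢ b
  other {a} {b} (c , d , c≢d , ac , ad) with c ≟ b
  ... | no c≢b = c , ac , c≢b
  ... | yes refl = d , ad , c≢d ∘ sym

  Singleton : Set
  Singleton = ∃[ a ] Kept a × ∀ b → Kept b → b ≡ a

  Pair : Set
  Pair = ∃[ a ] ∃[ b ] a ≢ b × Kept a × Kept b × ∀ c → Kept c → c ≡ a ⊎ c ≡ b

  Ring : Set
  Ring = (∀ v → Kept v → Has₂ v) × (∀ v → Kept v → ¬ Has₃ v)

  Branching : Set
  Branching = (∀ v → Kept v → Has₂ v) × (∃[ b ] Has₃ b) ×
    (∀ u v → ¬ Has₃ u → u — v → Has₃ v)

  -- A vertex without two links has no link at all or just one, and then `irreducible₂` gives its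
  -- neighbour no further link either. If every degree is at least two, the existence of a degree
  -- above two separates the last two shapes.
  classify : ∀ {k} → Kept k → Singleton ⊎ Pair ⊎ Ring ⊎ Branching
  classify {k} kk with any? (λ v → kept? v ×-dec ¬? (has₂? v))
  ... | yes (v , kv , ¬2) with any? (link? v)
  ...   | no ¬1 = inj₁ (v , kv , spread (λ { {a} refl l → ⊥-elim (¬1 (_ , l)) }) refl kv)
  ...   | yes (w , vw) = inj₂ (inj₁ (v , w , distinct-links vw , kv , link-kept (link-sym vw) ,
            spread (λ { (inj₁ refl) l → inj₂ (only-v l) ; (inj₂ refl) l → inj₁ (only-w l) }) (inj₁ refl) kv))
    where
    only-v : ∀ {u} → v — u → u ≡ w
    only-v {u} vu with u ≟ w
    ... | yes eq = eq
    ... | no u≢w = ⊥-elim (¬2 (u , w , u≢w , vu , vw))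
    only-w : ∀ {u} → w — u → u ≡ v
    only-w {u} wu with u ≟ v
    ... | yes eq = eq
    ... | no u≢v = ⊥-elim (irreducible₂ v w (¬2 , (u , v , u≢v , wu , link-sym vw) , vw , λ _ _ → only-v))
  classify {k} kk | no all₂ with any? has₃?
  ...   | no none = inj₂ (inj₂ (inj₁ (two , λ v _ 3v → none (v , 3v))))
    where
    two : ∀ v → Kept v → Has₂ v
    two v kv = decidable-stable (has₂? v) λ ¬2 → all₂ (v , kv , ¬2)
  ...   | yes (b , 3b) = inj₂ (inj₂ (inj₂ (two , (b , 3b) , big)))
    where
    two : ∀ v → Kept v → Has₂ v
    two v kv = decidable-stable (has₂? v) λ ¬2 → all₂ (v , kv , ¬2)

    -- A vertex of degree two with a neighbour of degree two has no large neighbour at all, since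
    -- exactly one would contradict `irreducible₃`. The same then holds for its neighbours, and
    -- smallness spreads as far as `b`.
    Small : Vertex → Set
    Small u = ¬ Has₃ u × (∀ v → u — v → ¬ Has₃ v)

    small-spreads : ∀ {u v} → Small u → u — v → Small v
    small-spreads {u} {v} (¬3u , ¬3) uv = ¬3 v uv , λ w vw 3w →
      irreducible₃ v w (¬3 v uv , 3w , vw , λ x 3x vx →
        [ (λ { refl → ⊥-elim (¬3u 3x) }) , id ]′
          (not-third (¬3 v uv) (link-sym uv) vw vx λ { refl → ¬3u 3w }))

    kb : Kept b
    kb = let (_ , _ , _ , _ , _ , _ , l , _) = 3b in link-kept l

    big : ∀ u v → ¬ Has₃ u → u — v → Has₃ v
    big u v ¬3u uv = decidable-stable (has₃? v) λ ¬3v →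
      proj₁ (spread small-spreads (¬3u , all-small ¬3v) (link-kept uv) b kb) 3b
      where
      all-small : ¬ Has₃ v → ∀ w → u — w → ¬ Has₃ w
      all-small ¬3v w uw 3w = irreducible₃ u w (¬3u , 3w , uw , λ x 3x ux →
        [ (λ { refl → ⊥-elim (¬3v 3x) }) , id ]′
          (not-third ¬3u uv uw ux λ { refl → ¬3v 3w }))

  Pinned : Aut → Vertex → Set
  Pinned α v = α · v ≡ v × (∀ u → v — u → α · u ≡ u)

  -- Besides `v` there is at most one neighbour of `w`, and `α`, fixing `w` and `v`, cannot send it
  -- anywhere else.
  pinned-spreads : ∀ α → (∀ v → Kept v → ¬ Has₃ v) → ∀ {v w} → Pinned α v → v — w → Pinned α w
  pinned-spreads α ¬3 {v} {w} (αv , fixed) vw = αw , λ u wu → go u wu (u ≟ v)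
    where
    αw = fixed w vw
    go : ∀ u → w — u → Dec (u ≡ v) → α · u ≡ u
    go u wu (yes refl) = αv
    go u wu (no u≢v) with not-third (¬3 w (link-kept wu)) (link-sym vw) wu
                            (subst (_— α · u) αw (link-image α wu)) (u≢v ∘ sym)
    ... | inj₁ αu≡v = ⊥-elim (u≢v (·-injective α (trans αu≡v (sym αv))))
    ... | inj₂ eq = eq

  pinned-preserves : ∀ α → (∀ v → Kept v → ¬ Has₃ v) → ∀ {v} → Kept v → Pinned α v → PreservesKept α
  pinned-preserves α ¬3 kv pinned u ku =
    cong φ (proj₁ (spread (pinned-spreads α ¬3) pinned kv u ku))

  -- Along a link a — b the value φ (α · a) ∙ φ (α · b) determines one label from
  -- the other, so α agrees with φ at every kept vertex or at none.
  latin : ∀ (_∙_ : Fin r → Fin r → Fin r) → (∀ a b → a ∙ b ≡ b ∙ a) → (∀ {a b c} → a ∙ b ≡ a ∙ c → b ≡ c) →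
    ∃[ α ] (∀ a b → a — b → φ (α · a) ∙ φ (α · b) ≡ φ a ∙ φ b) × PreservesOff α ×
      (∀ v → Kept v → φ (α · v) ≢ φ v)
  latin _∙_ ∙-comm ∙-cancel with unbreakable (λ a b → φ a ∙ φ b) (λ a b → ∙-comm (φ a) (φ b))
  ... | α , links , off , moved = α , links , off , λ v kv eq → moved (spread
    (λ {a} {b} φa l → ∙-cancel (trans (cong (_∙ φ (α · b)) (sym φa)) (links a b l))) eq kv)

module Marking {G : Graph} {k : ℕ} {φ : VertexLabelling G (2 + k)} (N : Network G φ) where

  open NetworkLemmas N

  mark : ∀ {M : Vertex → Vertex → Set} → (∀ a b → Dec (M a b)) → (∀ {a b} → M a b → M b a) →
    ∃[ α ] (∀ {a b} → a — b → M a b → M (α · a) (α · b)) × PreservesOff α × ¬ PreservesKept α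
  mark {M} M? M-sym with unbreakable L L-sym
    where
    L : Vertex → Vertex → Fin (2 + k)
    L a b with M? a b
    ... | yes _ = suc zero
    ... | no _ = zero

    L-sym : ∀ a b → L a b ≡ L b a
    L-sym a b with M? a b | M? b a
    ... | yes _ | yes _ = refl
    ... | no _ | no _ = refl
    ... | yes m | no ¬m = ⊥-elim (¬m (M-sym m))
    ... | no ¬m | yes m = ⊥-elim (¬m (M-sym m))
  ... | α , links , off , moved = α , marked , off , moved
    where
    marked : ∀ {a b} → a — b → M a b → M (α · a) (α · b)
    marked {a} {b} l m with M? a b | M? (α · a) (α · b) | links a b l
    ... | _ | yes m′ | _ = m′
    ... | yes _ | no _ | ()
    ... | no ¬m | no _ | _ = ⊥-elim (¬m m)

SamePair : ∀ {n} → Fin n → Fin n → Fin n → Fin n → Set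
SamePair u v a b = (a ≡ u × b ≡ v) ⊎ (a ≡ v × b ≡ u)

samePair? : ∀ {n} (u v a b : Fin n) → Dec (SamePair u v a b)
samePair? u v a b = (a ≟ u ×-dec b ≟ v) ⊎-dec (a ≟ v ×-dec b ≟ u)

samePair-swap : ∀ {n} {u v a b : Fin n} → SamePair u v a b → SamePair u v b a
samePair-swap (inj₁ (p , q)) = inj₂ (q , p)
samePair-swap (inj₂ (p , q)) = inj₁ (q , p)

-- Two-regular networks

-- Marking w₀w₁, w₁w₂ and w₃w₄ on a path whose inner vertices have degree two
-- pins the path, unless it closes up to a cycle of length at most five.
record Hexapath {n : ℕ} (R : Fin n → Fin n → Set) : Set where
  field
    w₀ w₁ w₂ w₃ w₄ w₅ : Fin n
    step₀₁ : R w₀ w₁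
    step₁₂ : R w₁ w₂
    step₂₃ : R w₂ w₃
    step₃₄ : R w₃ w₄
    near₂ : ∀ {x} → R w₂ x → x ≡ w₁ ⊎ x ≡ w₃
    near₃ : ∀ {x} → R w₃ x → x ≡ w₂ ⊎ x ≡ w₄
    near₄ : ∀ {x} → R w₄ x → x ≡ w₃ ⊎ x ≡ w₅
    ₀≢₁ : w₀ ≢ w₁
    ₀≢₂ : w₀ ≢ w₂
    ₀≢₃ : w₀ ≢ w₃
    ₀≢₄ : w₀ ≢ w₄
    ₀≢₅ : w₀ ≢ w₅
    ₁≢₂ : w₁ ≢ w₂
    ₁≢₃ : w₁ ≢ w₃
    ₁≢₄ : w₁ ≢ w₄
    ₂≢₃ : w₂ ≢ w₃
    ₂≢₄ : w₂ ≢ w₄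

  Mark : Fin n → Fin n → Set
  Mark a b = SamePair w₀ w₁ a b ⊎ SamePair w₁ w₂ a b ⊎ SamePair w₃ w₄ a b

  mark? : ∀ a b → Dec (Mark a b)
  mark? a b = samePair? w₀ w₁ a b ⊎-dec samePair? w₁ w₂ a b ⊎-dec samePair? w₃ w₄ a b

  mark-sym : ∀ {a b} → Mark a b → Mark b a
  mark-sym (inj₁ m) = inj₁ (samePair-swap m)
  mark-sym (inj₂ (inj₁ m)) = inj₂ (inj₁ (samePair-swap m))
  mark-sym (inj₂ (inj₂ m)) = inj₂ (inj₂ (samePair-swap m))

  private
    at₀ : ∀ {y} → Mark w₀ y → y ≡ w₁
    at₀ (inj₁ (inj₁ (_ , q))) = q
    at₀ (inj₁ (inj₂ (p , _))) = ⊥-elim (₀≢₁ p)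
    at₀ (inj₂ (inj₁ (inj₁ (p , _)))) = ⊥-elim (₀≢₁ p)
    at₀ (inj₂ (inj₁ (inj₂ (p , _)))) = ⊥-elim (₀≢₂ p)
    at₀ (inj₂ (inj₂ (inj₁ (p , _)))) = ⊥-elim (₀≢₃ p)
    at₀ (inj₂ (inj₂ (inj₂ (p , _)))) = ⊥-elim (₀≢₄ p)

    at₂ : ∀ {y} → Mark w₂ y → y ≡ w₁
    at₂ (inj₁ (inj₁ (p , _))) = ⊥-elim (₀≢₂ (sym p))
    at₂ (inj₁ (inj₂ (p , _))) = ⊥-elim (₁≢₂ (sym p))
    at₂ (inj₂ (inj₁ (inj₁ (p , _)))) = ⊥-elim (₁≢₂ (sym p))
    at₂ (inj₂ (inj₁ (inj₂ (_ , q)))) = q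
    at₂ (inj₂ (inj₂ (inj₁ (p , _)))) = ⊥-elim (₂≢₃ p)
    at₂ (inj₂ (inj₂ (inj₂ (p , _)))) = ⊥-elim (₂≢₄ p)

    at₃ : ∀ {y} → Mark w₃ y → y ≡ w₄
    at₃ (inj₁ (inj₁ (p , _))) = ⊥-elim (₀≢₃ (sym p))
    at₃ (inj₁ (inj₂ (p , _))) = ⊥-elim (₁≢₃ (sym p))
    at₃ (inj₂ (inj₁ (inj₁ (p , _)))) = ⊥-elim (₁≢₃ (sym p))
    at₃ (inj₂ (inj₁ (inj₂ (p , _)))) = ⊥-elim (₂≢₃ (sym p))
    at₃ (inj₂ (inj₂ (inj₁ (_ , q)))) = q
    at₃ (inj₂ (inj₂ (inj₂ (p , q)))) = trans q p

    at₄ : ∀ {y} → Mark w₄ y → y ≡ w₃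
    at₄ (inj₁ (inj₁ (p , _))) = ⊥-elim (₀≢₄ (sym p))
    at₄ (inj₁ (inj₂ (p , _))) = ⊥-elim (₁≢₄ (sym p))
    at₄ (inj₂ (inj₁ (inj₁ (p , _)))) = ⊥-elim (₁≢₄ (sym p))
    at₄ (inj₂ (inj₁ (inj₂ (p , _)))) = ⊥-elim (₂≢₄ (sym p))
    at₄ (inj₂ (inj₂ (inj₁ (p , q)))) = trans q p
    at₄ (inj₂ (inj₂ (inj₂ (_ , q)))) = q

    unmarked : ∀ {a b} → a ≢ w₀ → a ≢ w₁ → a ≢ w₂ → a ≢ w₃ → a ≢ w₄ → ¬ Mark a b
    unmarked a₀ a₁ a₂ a₃ a₄ (inj₁ (inj₁ (p , _))) = a₀ p
    unmarked a₀ a₁ a₂ a₃ a₄ (inj₁ (inj₂ (p , _))) = a₁ p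
    unmarked a₀ a₁ a₂ a₃ a₄ (inj₂ (inj₁ (inj₁ (p , _)))) = a₁ p
    unmarked a₀ a₁ a₂ a₃ a₄ (inj₂ (inj₁ (inj₂ (p , _)))) = a₂ p
    unmarked a₀ a₁ a₂ a₃ a₄ (inj₂ (inj₂ (inj₁ (p , _)))) = a₃ p
    unmarked a₀ a₁ a₂ a₃ a₄ (inj₂ (inj₂ (inj₂ (p , _)))) = a₄ p

    centre : ∀ {a b c} → Mark c a → Mark c b → a ≢ b → c ≡ w₁
    centre {a} {b} {c} ma mb a≢b with c ≟ w₀ | c ≟ w₁ | c ≟ w₂ | c ≟ w₃ | c ≟ w₄
    ... | _ | yes eq | _ | _ | _ = eq
    ... | yes refl | _ | _ | _ | _ = ⊥-elim (a≢b (trans (at₀ ma) (sym (at₀ mb))))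
    ... | _ | _ | yes refl | _ | _ = ⊥-elim (a≢b (trans (at₂ ma) (sym (at₂ mb))))
    ... | _ | _ | _ | yes refl | _ = ⊥-elim (a≢b (trans (at₃ ma) (sym (at₃ mb))))
    ... | _ | _ | _ | _ | yes refl = ⊥-elim (a≢b (trans (at₄ ma) (sym (at₄ mb))))
    ... | no a₀ | no a₁ | no a₂ | no a₃ | no a₄ = ⊥-elim (unmarked a₀ a₁ a₂ a₃ a₄ ma)

    around : ∀ {x} → Mark w₁ x → x ≡ w₀ ⊎ x ≡ w₂
    around (inj₁ (inj₁ (p , _))) = ⊥-elim (₀≢₁ (sym p))
    around (inj₁ (inj₂ (_ , q))) = inj₁ q
    around (inj₂ (inj₁ (inj₁ (_ , q)))) = inj₂ q
    around (inj₂ (inj₁ (inj₂ (p , _)))) = ⊥-elim (₁≢₂ p)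
    around (inj₂ (inj₂ (inj₁ (p , _)))) = ⊥-elim (₁≢₃ p)
    around (inj₂ (inj₂ (inj₂ (p , _)))) = ⊥-elim (₁≢₄ p)

  -- Only `w₁` is the end of two marked edges, so it is fixed and the pair of `w₀` and `w₂` is
  -- preserved. If these two were exchanged, `f w₃` would be a neighbour of `w₀` other than `w₁`. By
  -- the `near` fields it is none of `w₂`, `w₃`, `w₄` and thus on no marked edge, whereas `w₃` is on
  -- one.
  pins : (∀ {a b} → R a b → R b a) → (∀ {a} → ¬ R a a) →
    (f : Fin n → Fin n) → (∀ {a b} → f a ≡ f b → a ≡ b) → (∀ {a b} → R a b → R (f a) (f b)) →
    (∀ {a b} → R a b → Mark a b → Mark (f a) (f b)) →
    f w₀ ≡ w₀ × f w₁ ≡ w₁ × f w₂ ≡ w₂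
  pins R-sym R-irr f f-inj f-R f-mark = go (around m₁₀) (around m₁₂)
    where
    m₁₀ᶠ : Mark (f w₁) (f w₀)
    m₁₀ᶠ = f-mark (R-sym step₀₁) (inj₁ (inj₂ (refl , refl)))
    m₁₂ᶠ : Mark (f w₁) (f w₂)
    m₁₂ᶠ = f-mark step₁₂ (inj₂ (inj₁ (inj₁ (refl , refl))))

    fw₁ : f w₁ ≡ w₁
    fw₁ = centre m₁₀ᶠ m₁₂ᶠ (₀≢₂ ∘ f-inj)

    m₁₀ : Mark w₁ (f w₀)
    m₁₀ = subst (λ a → Mark a (f w₀)) fw₁ m₁₀ᶠ
    m₁₂ : Mark w₁ (f w₂)
    m₁₂ = subst (λ a → Mark a (f w₂)) fw₁ m₁₂ᶠ

    go : f w₀ ≡ w₀ ⊎ f w₀ ≡ w₂ → f w₂ ≡ w₀ ⊎ f w₂ ≡ w₂ → f w₀ ≡ w₀ × f w₁ ≡ w₁ × f w₂ ≡ w₂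
    go (inj₁ p) (inj₂ q) = p , fw₁ , q
    go (inj₁ p) (inj₁ q) = ⊥-elim (₀≢₂ (f-inj (trans p (sym q))))
    go (inj₂ p) (inj₂ q) = ⊥-elim (₀≢₂ (f-inj (trans p (sym q))))
    go (inj₂ _) (inj₁ q) = ⊥-elim (unmarked x₀ x₁ x₂ x₃ x₄
        (f-mark step₃₄ (inj₂ (inj₂ (inj₁ (refl , refl))))))
      where
      back : ∀ {w} → f w₃ ≡ w → R w w₀
      back refl = R-sym (subst (λ a → R a (f w₃)) q (f-R step₂₃))
      x₀ : f w₃ ≢ w₀
      x₀ eq = R-irr (back eq)
      x₁ : f w₃ ≢ w₁
      x₁ eq = ₁≢₃ (sym (f-inj (trans eq (sym fw₁))))
      x₂ : f w₃ ≢ w₂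
      x₂ eq = [ ₀≢₁ , ₀≢₃ ]′ (near₂ (back eq))
      x₃ : f w₃ ≢ w₃
      x₃ eq = [ ₀≢₂ , ₀≢₄ ]′ (near₃ (back eq))
      x₄ : f w₃ ≢ w₄
      x₄ eq = [ ₀≢₃ , ₀≢₅ ]′ (near₄ (back eq))

other-label : ∀ {a b c : Fin 2} → a ≢ b → b ≢ c → a ≡ c
other-label {zero} {zero} a≢b _ = ⊥-elim (a≢b refl)
other-label {zero} {suc zero} {zero} _ _ = refl
other-label {zero} {suc zero} {suc zero} _ b≢c = ⊥-elim (b≢c refl)
other-label {suc zero} {zero} {zero} _ b≢c = ⊥-elim (b≢c refl)
other-label {suc zero} {zero} {suc zero} _ _ = refl
other-label {suc zero} {suc zero} a≢b _ = ⊥-elim (a≢b refl)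

infixl 6 _⊕_
_⊕_ : Fin 2 → Fin 2 → Fin 2
zero ⊕ b = b
suc zero ⊕ zero = suc zero
suc zero ⊕ suc zero = zero

⊕-comm : ∀ a b → a ⊕ b ≡ b ⊕ a
⊕-comm zero zero = refl
⊕-comm zero (suc zero) = refl
⊕-comm (suc zero) zero = refl
⊕-comm (suc zero) (suc zero) = refl

⊕-cancel : ∀ {a b c} → a ⊕ b ≡ a ⊕ c → b ≡ c
⊕-cancel {zero} eq = eq
⊕-cancel {suc zero} {zero} {zero} _ = refl
⊕-cancel {suc zero} {zero} {suc zero} ()
⊕-cancel {suc zero} {suc zero} {zero} ()
⊕-cancel {suc zero} {suc zero} {suc zero} _ = refl

module Complementing {G : Graph} {φ : VertexLabelling G 2} (N : Network G φ) where

  open NetworkLemmas N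

  Complements : Aut → Set
  Complements τ = PreservesOff τ × ∀ v → Kept v → φ (τ · v) ≢ φ v

  -- `τ ⁻¹ ⊙ σ` changes each kept label twice, which with two labels restores it, so rigidity
  -- applies. The uniqueness is what later makes reversals found on different paths comparable.
  complements-unique : ∀ σ τ → Complements σ → Complements τ → ∀ v → σ · v ≡ τ · v
  complements-unique σ τ (offσ , onσ) (offτ , onτ) v =
    trans (sym (⁻¹-inverseʳ τ (σ · v))) (cong (τ ·_)
      (rigid-kept (τ ⁻¹ ⊙ σ) (off-compose (τ ⁻¹) σ (off-inverse τ offτ) offσ) same v))
    where
    same : ∀ v → Kept v → φ ((τ ⁻¹) · σ · v) ≡ φ v
    same v kv = other-label
      (λ eq → onτ _ (kept-image (τ ⁻¹) (kept-image σ kv))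
        (trans (cong φ (⁻¹-inverseʳ τ (σ · v))) (sym eq)))
      (onσ v kv)

  complements-involutive : ∀ τ → Complements τ → ∀ v → τ · τ · v ≡ v
  complements-involutive τ (off , on) = rigid-kept (τ ⊙ τ) (off-compose τ τ off off)
    λ v kv → other-label (on (τ · v) (kept-image τ kv)) (on v kv)

  complementer : ∃[ τ ] Complements τ
  complementer with latin _⊕_ ⊕-comm ⊕-cancel
  ... | τ , _ , off , on = τ , off , on

  complements-moves : ∀ τ → Complements τ → ∀ {v} → Kept v → τ · v ≢ v
  complements-moves _ (_ , on) kv eq = on _ kv (cong φ eq)

module TwoLabelRing {G : Graph} {φ : VertexLabelling G 2} (N : Network G φ)
  (has₂ : ∀ v → Network.Kept N v → Network.Has₂ N v)
  (¬has₃ : ∀ v → Network.Kept N v → ¬ Network.Has₃ N v) where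

  open NetworkLemmas N
  open Complementing N
  open Marking N

  near : ∀ {a b c x} → a — b → a — c → b ≢ c → a — x → x ≡ b ⊎ x ≡ c
  near ab ac b≢c ax = not-third (¬has₃ _ (link-kept ab)) ab ac ax b≢c

  τ : Aut
  τ = proj₁ complementer
  comp : Complements τ
  comp = proj₂ complementer

  moves : ∀ {v} → Kept v → τ · v ≢ v
  moves = complements-moves τ comp

  involutive : ∀ {u v} → τ · u ≡ v → τ · v ≡ u
  involutive refl = complements-involutive τ comp _

  -- The involution `τ` exchanges `a` and `b` and so fixes their only common neighbour, although it
  -- moves every kept vertex. This disposes of odd cycles, on which every involution has a fixed
  -- vertex.
  no-midpoint : ∀ {a b c} → τ · a ≡ b → a — c → b — c → (∀ x → a — x → b — x → x ≡ c) → ⊥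
  no-midpoint {a} {b} {c} τa ac bc only = moves (link-kept (link-sym ac))
    (only (τ · c) (subst (_— τ · c) (involutive τa) (link-image τ bc))
      (subst (_— τ · c) τa (link-image τ ac)))

  module Triangle {a b c} (ab : a — b) (bc : b — c) (ca : c — a) where

    no-swap : ∀ {x y z} → x — y → y — z → z — x → τ · x ≡ y → ⊥
    no-swap xy yz zx τx = no-midpoint τx (link-sym zx) yz λ w xw yw →
      [ (λ { refl → ⊥-elim (link-irrefl yw) }) , id ]′
        (near xy (link-sym zx) (distinct-links yz) xw)

    closed : ∀ {x y} → x ≡ a ⊎ x ≡ b ⊎ x ≡ c → x — y → y ≡ a ⊎ y ≡ b ⊎ y ≡ c
    closed (inj₁ refl) l = inj₂ (near ab (link-sym ca) (distinct-links bc) l)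
    closed (inj₂ (inj₁ refl)) l =
      [ inj₁ , inj₂ ∘ inj₂ ]′ (near (link-sym ab) bc (distinct-links (link-sym ca)) l)
    closed (inj₂ (inj₂ refl)) l = [ inj₁ , inj₂ ∘ inj₁ ]′ (near ca (link-sym bc) (distinct-links ab) l)

    impossible : ⊥
    impossible with spread closed (inj₁ refl) (link-kept ab) (τ · a) (kept-image τ (link-kept ab))
    ... | inj₁ eq = moves (link-kept ab) eq
    ... | inj₂ (inj₁ eq) = no-swap ab bc ca eq
    ... | inj₂ (inj₂ eq) = no-swap (link-sym ca) (link-sym bc) (link-sym ab) eq

  module Pentagon {a b c d e} (ab : a — b) (bc : b — c) (cd : c — d) (de : d — e) (ea : e — a)
    (a≢c : a ≢ c) (b≢d : b ≢ d) (c≢e : c ≢ e) (d≢a : d ≢ a) (e≢b : e ≢ b) where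

    no-far-swap : ∀ {x y z u v} → x — y → y — z → z — u → u — v → v — x →
      x ≢ z → y ≢ u → z ≢ v → u ≢ x → v ≢ y → τ · x ≡ z → ⊥
    no-far-swap xy yz zu uv vx x≢z y≢u z≢v u≢x v≢y τx =
      no-midpoint τx xy (link-sym yz) λ w xw zw → go w zw (near xy (link-sym vx) (v≢y ∘ sym) xw)
      where
      go : ∀ w → _ — w → w ≡ _ ⊎ w ≡ _ → w ≡ _
      go w zw (inj₁ eq) = eq
      go w zw (inj₂ refl) = ⊥-elim ([ x≢z ∘ sym , distinct-links zu ]′
        (near vx (link-sym uv) (u≢x ∘ sym) (link-sym zw)))

    -- An exchange of `x` and `y` also exchanges their outer neighbours `v` and `z`, and these have
    -- the midpoint `u`.
    no-near-swap : ∀ {x y z u v} → x — y → y — z → z — u → u — v → v — x →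
      x ≢ z → y ≢ u → z ≢ v → u ≢ x → v ≢ y → τ · x ≡ y → ⊥
    no-near-swap {x} {y} {z} {u} {v} xy yz zu uv vx x≢z y≢u z≢v u≢x v≢y τx
      with near (link-sym xy) yz x≢z (subst (_— τ · v) τx (link-image τ (link-sym vx)))
    ... | inj₁ τv≡x = v≢y (trans (sym (involutive τv≡x)) τx)
    ... | inj₂ τv≡z = no-far-swap (link-sym uv) (link-sym zu) (link-sym yz) (link-sym xy) (link-sym vx)
          (z≢v ∘ sym) (y≢u ∘ sym) (x≢z ∘ sym) (v≢y ∘ sym) (u≢x ∘ sym) τv≡z

    closed : ∀ {x y} → x ≡ a ⊎ x ≡ b ⊎ x ≡ c ⊎ x ≡ d ⊎ x ≡ e → x — y →
      y ≡ a ⊎ y ≡ b ⊎ y ≡ c ⊎ y ≡ d ⊎ y ≡ e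
    closed (inj₁ refl) l =
      [ inj₂ ∘ inj₂ ∘ inj₂ ∘ inj₂ , inj₂ ∘ inj₁ ]′ (near (link-sym ea) ab e≢b l)
    closed (inj₂ (inj₁ refl)) l = [ inj₁ , inj₂ ∘ inj₂ ∘ inj₁ ]′ (near (link-sym ab) bc a≢c l)
    closed (inj₂ (inj₂ (inj₁ refl))) l =
      [ inj₂ ∘ inj₁ , inj₂ ∘ inj₂ ∘ inj₂ ∘ inj₁ ]′ (near (link-sym bc) cd b≢d l)
    closed (inj₂ (inj₂ (inj₂ (inj₁ refl)))) l =
      [ inj₂ ∘ inj₂ ∘ inj₁ , inj₂ ∘ inj₂ ∘ inj₂ ∘ inj₂ ]′ (near (link-sym cd) de c≢e l)
    closed (inj₂ (inj₂ (inj₂ (inj₂ refl)))) l =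
      [ inj₂ ∘ inj₂ ∘ inj₂ ∘ inj₁ , inj₁ ]′ (near (link-sym de) ea d≢a l)

    impossible : ⊥
    impossible with spread closed (inj₁ refl) (link-kept ab) (τ · a) (kept-image τ (link-kept ab))
    ... | inj₁ eq = moves (link-kept ab) eq
    ... | inj₂ (inj₁ eq) = no-near-swap ab bc cd de ea a≢c b≢d c≢e d≢a e≢b eq
    ... | inj₂ (inj₂ (inj₁ eq)) = no-far-swap ab bc cd de ea a≢c b≢d c≢e d≢a e≢b eq
    ... | inj₂ (inj₂ (inj₂ (inj₁ eq))) = no-far-swap (link-sym ea) (link-sym de) (link-sym cd)
          (link-sym bc) (link-sym ab) (d≢a ∘ sym) (c≢e ∘ sym) (b≢d ∘ sym) (a≢c ∘ sym) (e≢b ∘ sym) eq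
    ... | inj₂ (inj₂ (inj₂ (inj₂ eq))) = no-near-swap (link-sym ea) (link-sym de) (link-sym cd)
          (link-sym bc) (link-sym ab) (d≢a ∘ sym) (c≢e ∘ sym) (b≢d ∘ sym) (a≢c ∘ sym) (e≢b ∘ sym) eq

  module Square {a b c d} (ab : a — b) (bc : b — c) (cd : c — d) (da : d — a)
    (a≢c : a ≢ c) (b≢d : b ≢ d) where

    Corner : Vertex → Set
    Corner x = x ≡ a ⊎ x ≡ b ⊎ x ≡ c ⊎ x ≡ d

    closed : ∀ {x y} → Corner x → x — y → Corner y
    closed (inj₁ refl) l = [ inj₂ ∘ inj₁ , inj₂ ∘ inj₂ ∘ inj₂ ]′ (near ab (link-sym da) b≢d l)
    closed (inj₂ (inj₁ refl)) l = [ inj₁ , inj₂ ∘ inj₂ ∘ inj₁ ]′ (near (link-sym ab) bc a≢c l)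
    closed (inj₂ (inj₂ (inj₁ refl))) l =
      [ inj₂ ∘ inj₁ , inj₂ ∘ inj₂ ∘ inj₂ ]′ (near (link-sym bc) cd b≢d l)
    closed (inj₂ (inj₂ (inj₂ refl))) l =
      [ inj₁ , inj₂ ∘ inj₂ ∘ inj₁ ]′ (near da (link-sym cd) a≢c l)

    corners : ∀ v → Kept v → Corner v
    corners = spread closed (inj₁ refl) (link-kept ab)

    preserves-corners : ∀ α → φ (α · a) ≡ φ a → φ (α · b) ≡ φ b → φ (α · c) ≡ φ c → φ (α · d) ≡ φ d →
      PreservesKept α
    preserves-corners α pa pb pc pd v kv with corners v kv
    ... | inj₁ refl = pa
    ... | inj₂ (inj₁ refl) = pb
    ... | inj₂ (inj₂ (inj₁ refl)) = pc
    ... | inj₂ (inj₂ (inj₂ refl)) = pd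

    edge : φ a ≡ φ b → φ c ≡ φ d → ⊥
    edge φab φcd with mark (samePair? a b) samePair-swap
    ... | α , marked , off , moved with marked ab (inj₁ (refl , refl))
    ... | inj₁ (αa , αb) = moved (preserves-corners α (cong φ αa) (cong φ αb) (cong φ αc) (cong φ αd))
      where
      αc : α · c ≡ c
      αc = [ (λ eq → ⊥-elim (a≢c (sym (·-injective α (trans eq (sym αa)))))) , id ]′
        (near (link-sym ab) bc a≢c (subst (_— α · c) αb (link-image α bc)))
      αd : α · d ≡ d
      αd = [ (λ eq → ⊥-elim (b≢d (sym (·-injective α (trans eq (sym αb)))))) , id ]′
        (near ab (link-sym da) b≢d (subst (_— α · d) αa (link-image α (link-sym da))))
    ... | inj₂ (αa , αb) = moved (preserves-corners α
        (trans (cong φ αa) (sym φab)) (trans (cong φ αb) φab)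
        (trans (cong φ αc) (sym φcd)) (trans (cong φ αd) φcd))
      where
      αc : α · c ≡ d
      αc = [ (λ eq → ⊥-elim (a≢c (·-injective α (trans αa (sym eq))))) , id ]′
        (near ab (link-sym da) b≢d (subst (_— α · c) αb (link-image α bc)))
      αd : α · d ≡ c
      αd = [ (λ eq → ⊥-elim (b≢d (·-injective α (trans αb (sym eq))))) , id ]′
        (near (link-sym ab) bc a≢c (subst (_— α · d) αa (link-image α (link-sym da))))

    vertex : φ a ≡ φ c → ⊥
    vertex φac with mark {λ x y → SamePair a b x y ⊎ SamePair b c x y}
      (λ x y → samePair? a b x y ⊎-dec samePair? b c x y)
      [ inj₁ ∘ samePair-swap , inj₂ ∘ samePair-swap ]′
    ... | α , marked , off , moved = moved (finish ends)
      where
      a≢b = distinct-links ab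
      b≢c = distinct-links bc

      αb : α · b ≡ b
      αb with marked ab (inj₁ (inj₁ (refl , refl))) | marked bc (inj₂ (inj₁ (refl , refl)))
      ... | inj₁ (inj₁ (_ , q)) | _ = q
      ... | inj₂ (inj₂ (_ , q)) | _ = q
      ... | _ | inj₁ (inj₂ (p , _)) = p
      ... | _ | inj₂ (inj₁ (p , _)) = p
      ... | inj₁ (inj₂ (p , _)) | inj₁ (inj₁ (_ , s)) = ⊥-elim (a≢c (·-injective α (trans p (sym s))))
      ... | inj₁ (inj₂ (p , _)) | inj₂ (inj₂ (_ , s)) = ⊥-elim (a≢c (·-injective α (trans p (sym s))))
      ... | inj₂ (inj₁ (p , _)) | inj₁ (inj₁ (_ , s)) = ⊥-elim (a≢c (·-injective α (trans p (sym s))))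
      ... | inj₂ (inj₁ (p , _)) | inj₂ (inj₂ (_ , s)) = ⊥-elim (a≢c (·-injective α (trans p (sym s))))

      toward : ∀ {x} → b — x → α · x ≡ a ⊎ α · x ≡ c
      toward l = near (link-sym ab) bc a≢c (subst (_— _) αb (link-image α l))

      ends : φ (α · a) ≡ φ a × φ (α · c) ≡ φ c × (∀ {x} → α · x ≡ a ⊎ α · x ≡ c → x ≡ a ⊎ x ≡ c)
      ends with toward (link-sym ab) | toward bc
      ... | inj₁ p | inj₁ q = ⊥-elim (a≢c (·-injective α (trans p (sym q))))
      ... | inj₂ p | inj₂ q = ⊥-elim (a≢c (·-injective α (trans p (sym q))))
      ... | inj₁ p | inj₂ q = cong φ p , cong φ q ,
        [ (λ eq → inj₁ (·-injective α (trans eq (sym p)))) , (λ eq → inj₂ (·-injective α (trans eq (sym q)))) ]′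
      ... | inj₂ p | inj₁ q = trans (cong φ p) (sym φac) , trans (cong φ q) φac ,
        [ (λ eq → inj₂ (·-injective α (trans eq (sym q)))) , (λ eq → inj₁ (·-injective α (trans eq (sym p)))) ]′

      finish : φ (α · a) ≡ φ a × φ (α · c) ≡ φ c × (∀ {x} → α · x ≡ a ⊎ α · x ≡ c → x ≡ a ⊎ x ≡ c) →
        PreservesKept α
      finish (pa , pc , back) = preserves-corners α pa (cong φ αb) pc (cong φ αd)
        where
        d≢ac : ¬ (d ≡ a ⊎ d ≡ c)
        d≢ac = [ distinct-links da , distinct-links cd ∘ sym ]′
        αd : α · d ≡ d
        αd with corners (α · d) (kept-image α (link-kept da))
        ... | inj₁ eq = ⊥-elim (d≢ac (back (inj₁ eq)))
        ... | inj₂ (inj₁ eq) = ⊥-elim (b≢d (·-injective α (trans αb (sym eq))))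
        ... | inj₂ (inj₂ (inj₁ eq)) = ⊥-elim (d≢ac (back (inj₂ eq)))
        ... | inj₂ (inj₂ (inj₂ eq)) = eq

  -- A square does have fixed-point-free involutions, so `φ` is consulted. Either two opposite
  -- corners agree or the ends of two opposite sides do, and the marks are placed such that the only
  -- reflection left preserves `φ`.
  square : ∀ {a b c d} → a — b → b — c → c — d → d — a → a ≢ c → b ≢ d → ⊥
  square {a} {b} {c} {d} ab bc cd da a≢c b≢d with φ a ≟ φ c | φ b ≟ φ d | φ a ≟ φ b
  ... | yes p | _ | _ = Square.vertex ab bc cd da a≢c b≢d p
  ... | no _ | yes q | _ = Square.vertex bc cd da ab b≢d (a≢c ∘ sym) q
  ... | no p | no q | yes s = Square.edge ab bc cd da a≢c b≢d s
        (other-label (p ∘ sym) (λ eq → q (trans (sym s) eq)))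
  ... | no p | no q | no s = Square.edge bc cd da ab b≢d (a≢c ∘ sym)
        (other-label (s ∘ sym) p) (other-label (q ∘ sym) (s ∘ sym))

  impossible : ∀ {k} → Kept k → ⊥
  impossible {w₁} k with has₂ w₁ k
  ... | w₀ , w₂ , w₀≢w₂ , w₁w₀ , w₁w₂ with other {b = w₁} (has₂ w₂ (link-kept (link-sym w₁w₂)))
  ... | w₃ , w₂w₃ , w₃≢w₁ with other {b = w₂} (has₂ w₃ (link-kept (link-sym w₂w₃)))
  ... | w₄ , w₃w₄ , w₄≢w₂ with other {b = w₃} (has₂ w₄ (link-kept (link-sym w₃w₄)))
  ... | w₅ , w₄w₅ , w₅≢w₃ with w₀ ≟ w₃ | w₀ ≟ w₄ | w₀ ≟ w₅
  ... | yes refl | _ | _ = Triangle.impossible (link-sym w₁w₀) w₁w₂ w₂w₃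
  ... | no _ | yes refl | _ = square (link-sym w₁w₀) w₁w₂ w₂w₃ w₃w₄ w₀≢w₂ (w₃≢w₁ ∘ sym)
  ... | no ₀≢₃ | no ₀≢₄ | w₀≟w₅ = go w₀≟w₅
    where
    w₁≢w₄ : w₁ ≢ w₄
    w₁≢w₄ refl = [ ₀≢₃ ∘ sym , distinct-links w₂w₃ ∘ sym ]′ (near w₁w₀ w₁w₂ w₀≢w₂ (link-sym w₃w₄))

    path : w₀ ≢ w₅ → Hexapath _—_
    path ₀≢₅ = record
      { w₀ = w₀ ; w₁ = w₁ ; w₂ = w₂ ; w₃ = w₃ ; w₄ = w₄ ; w₅ = w₅
      ; step₀₁ = link-sym w₁w₀ ; step₁₂ = w₁w₂ ; step₂₃ = w₂w₃ ; step₃₄ = w₃w₄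
      ; near₂ = near (link-sym w₁w₂) w₂w₃ (w₃≢w₁ ∘ sym)
      ; near₃ = near (link-sym w₂w₃) w₃w₄ (w₄≢w₂ ∘ sym)
      ; near₄ = near (link-sym w₃w₄) w₄w₅ (w₅≢w₃ ∘ sym)
      ; ₀≢₁ = distinct-links (link-sym w₁w₀) ; ₀≢₂ = w₀≢w₂ ; ₀≢₃ = ₀≢₃ ; ₀≢₄ = ₀≢₄ ; ₀≢₅ = ₀≢₅
      ; ₁≢₂ = distinct-links w₁w₂ ; ₁≢₃ = w₃≢w₁ ∘ sym ; ₁≢₄ = w₁≢w₄
      ; ₂≢₃ = distinct-links w₂w₃ ; ₂≢₄ = w₄≢w₂ ∘ sym
      }

    go : Dec (w₀ ≡ w₅) → ⊥
    go (yes refl) = Pentagon.impossible (link-sym w₁w₀) w₁w₂ w₂w₃ w₃w₄ w₄w₅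
      w₀≢w₂ (w₃≢w₁ ∘ sym) (w₄≢w₂ ∘ sym) (₀≢₃ ∘ sym) (w₁≢w₄ ∘ sym)
    go (no ₀≢₅) with mark (Hexapath.mark? (path ₀≢₅)) (Hexapath.mark-sym (path ₀≢₅))
    ... | α , marked , off , moved = moved (pinned-preserves α ¬has₃ k (αw₁ , λ u l →
            [ (λ { refl → αw₀ }) , (λ { refl → αw₂ }) ]′ (near w₁w₀ w₁w₂ w₀≢w₂ l)))
      where
      pinned = Hexapath.pins (path ₀≢₅) link-sym link-irrefl (α ·_) (·-injective α) (link-image α) marked
      αw₀ = proj₁ pinned
      αw₁ = proj₁ (proj₂ pinned)
      αw₂ = proj₂ (proj₂ pinned)

module ManyLabelRing {G : Graph} {k : ℕ} {φ : VertexLabelling G (3 + k)} (N : Network G φ)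
  (has₂ : ∀ v → Network.Kept N v → Network.Has₂ N v)
  (¬has₃ : ∀ v → Network.Kept N v → ¬ Network.Has₃ N v) where

  open NetworkLemmas N

  -- Three labels allow two adjacent links to have labels of their own, 2 and 1, against 0
  -- elsewhere. This fixes the common end and both other ends.
  impossible : ∀ {v} → Kept v → ⊥
  impossible {v} kv with has₂ v kv
  ... | a , b , a≢b , va , vb = moved (pinned-preserves α ¬has₃ kv (αv , λ u l →
          [ (λ { refl → αa }) , (λ { refl → αb }) ]′ (not-third (¬has₃ v kv) va vb l a≢b)))
    where
    L : Vertex → Vertex → Fin (3 + k)
    L x y with samePair? v a x y | samePair? v b x y
    ... | yes _ | _ = suc (suc zero)
    ... | no _ | yes _ = suc zero
    ... | no _ | no _ = zero

    L-sym : ∀ x y → L x y ≡ L y x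
    L-sym x y with samePair? v a x y | samePair? v b x y | samePair? v a y x | samePair? v b y x
    ... | yes _ | _ | yes _ | _ = refl
    ... | yes m | _ | no ¬m | _ = ⊥-elim (¬m (samePair-swap m))
    ... | no ¬m | _ | yes m | _ = ⊥-elim (¬m (samePair-swap m))
    ... | no _ | yes _ | no _ | yes _ = refl
    ... | no _ | no _ | no _ | no _ = refl
    ... | no _ | yes m | no _ | no ¬m = ⊥-elim (¬m (samePair-swap m))
    ... | no _ | no ¬m | no _ | yes m = ⊥-elim (¬m (samePair-swap m))

    L-a : ∀ x y → L x y ≡ suc (suc zero) → SamePair v a x y
    L-a x y eq with samePair? v a x y | samePair? v b x y
    ... | yes m | _ = m
    L-a x y () | no _ | yes _
    L-a x y () | no _ | no _

    L-b : ∀ x y → L x y ≡ suc zero → SamePair v b x y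
    L-b x y eq with samePair? v a x y | samePair? v b x y
    L-b x y () | yes _ | _
    ... | no _ | yes m = m
    L-b x y () | no _ | no _

    L-va : L v a ≡ suc (suc zero)
    L-va with samePair? v a v a
    ... | yes _ = refl
    ... | no ¬m = ⊥-elim (¬m (inj₁ (refl , refl)))

    L-vb : L v b ≡ suc zero
    L-vb with samePair? v a v b | samePair? v b v b
    ... | yes (inj₁ (_ , b≡a)) | _ = ⊥-elim (a≢b (sym b≡a))
    ... | yes (inj₂ (v≡a , _)) | _ = ⊥-elim (distinct-links va v≡a)
    ... | no _ | yes _ = refl
    ... | no _ | no ¬m = ⊥-elim (¬m (inj₁ (refl , refl)))

    broken-by = unbreakable L L-sym
    α = proj₁ broken-by
    moved = proj₂ (proj₂ (proj₂ broken-by))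

    images : SamePair v a (α · v) (α · a) × SamePair v b (α · v) (α · b)
    images = L-a _ _ (trans (proj₁ (proj₂ broken-by) v a va) L-va) ,
             L-b _ _ (trans (proj₁ (proj₂ broken-by) v b vb) L-vb)

    all-fixed : α · v ≡ v × α · a ≡ a × α · b ≡ b
    all-fixed with images
    ... | inj₁ (p , q) , inj₁ (_ , s) = p , q , s
    ... | inj₁ (p , _) , inj₂ (s , _) = ⊥-elim (distinct-links vb (trans (sym p) s))
    ... | inj₂ (p , _) , inj₁ (s , _) = ⊥-elim (distinct-links va (trans (sym s) p))
    ... | inj₂ (p , _) , inj₂ (s , _) = ⊥-elim (a≢b (trans (sym p) s))

    αv = proj₁ all-fixed
    αa = proj₁ (proj₂ all-fixed)
    αb = proj₂ (proj₂ all-fixed)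

-- Recognising a cycle

-- Paths are functions on ℕ of which only the first m values matter.
module Paths {n : ℕ} (R : Fin n → Fin n → Set) where

  InjectiveBelow : ℕ → (ℕ → Fin n) → Set
  InjectiveBelow m p = ∀ {i j} → i < m → j < m → p i ≡ p j → i ≡ j

  IsPath : ℕ → (ℕ → Fin n) → Set
  IsPath m p = InjectiveBelow m p × (∀ i → suc i < m → R (p i) (p (suc i)))

  injective-bounded : ∀ {m p} → InjectiveBelow m p → m ≤ n
  injective-bounded {m} {p} inj = injective⇒≤ {f = p ∘ toℕ} λ {i} {j} eq →
    toℕ-injective
      (inj (toℕ<n i) (toℕ<n j) eq)

  locate : ∀ (p : ℕ → Fin n) m x → Dec (∃[ i ] i < m × p i ≡ x)
  locate p m x = anyUpTo? (λ i → p i ≟ x) m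

  infixr 5 _∷ᵖ_
  _∷ᵖ_ : Fin n → (ℕ → Fin n) → ℕ → Fin n
  (x ∷ᵖ p) zero = x
  (x ∷ᵖ p) (suc i) = p i

  extend : ∀ {m p x} → IsPath (suc m) p → R x (p 0) → ¬ (∃[ i ] i < suc m × p i ≡ x) →
    IsPath (suc (suc m)) (x ∷ᵖ p)
  extend {m} {p} {x} (inj , steps) r fresh = inj′ , steps′
    where
    inj′ : InjectiveBelow (suc (suc m)) (x ∷ᵖ p)
    inj′ {zero} {zero} _ _ _ = refl
    inj′ {zero} {suc j} _ (s≤s j<) eq = ⊥-elim (fresh (j , j< , sym eq))
    inj′ {suc i} {zero} (s≤s i<) _ eq = ⊥-elim (fresh (i , i< , eq))
    inj′ {suc i} {suc j} (s≤s i<) (s≤s j<) eq = cong suc (inj i< j< eq)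
    steps′ : ∀ i → suc i < suc (suc m) → R ((x ∷ᵖ p) i) (p i)
    steps′ zero _ = r
    steps′ (suc i) (s≤s lt) = steps i lt

  -- Injectivity bounds the number of vertices by `n`, so it is enough to refute a path of greatest
  -- length. Greatest refers to every path `q`, not just to extensions of `p`; in this form the
  -- property survives a rotation.
  longest : (∀ m p → IsPath m p → (∀ q → ¬ IsPath (suc m) q) → ⊥) → ∀ m p → ¬ IsPath m p
  longest stuck m p path = go n m p path (m≤m+n n m)
    where
    go : ∀ fuel m p → IsPath m p → n ≤ fuel + m → ⊥
    go zero m p path n≤ = stuck m p path λ q path′ →
      <⇒≱ (s≤s n≤) (injective-bounded (proj₁ path′))
    go (suc fuel) m p path n≤ = stuck m p path λ q path′ →
      go fuel (suc m) q path′ (subst (n ≤_) (sym (+-suc fuel m)) n≤)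

argmax-upto : ∀ (f : ℕ → ℕ) s → ∃[ i ] i ≤ s × ∀ j → j ≤ s → f j ≤ f i
argmax-upto f zero = 0 , z≤n , λ { zero _ → ≤-refl }
argmax-upto f (suc s) with argmax-upto f s
... | i , i≤s , max with ≤-total (f (suc s)) (f i)
... | inj₁ le = i , m≤n⇒m≤1+n i≤s , λ j j≤ → [ (λ j< → max j (≤-pred j<)) , (λ { refl → le }) ]′ (m≤n⇒m<n∨m≡n j≤)
... | inj₂ ge = suc s , ≤-refl , λ j j≤ →
      [ (λ j< → ≤-trans (max j (≤-pred j<)) ge) , (λ { refl → ≤-refl }) ]′ (m≤n⇒m<n∨m≡n j≤)

record Circuit {n : ℕ} (R : Fin n → Fin n → Set) : Set where
  field
    p : ℕ → Fin n
    s : ℕ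
    path : Paths.IsPath R (suc s) p
    2≤s : 2 ≤ s
    closing : R (p s) (p 0)

record Pattern (n r : ℕ) : Set where
  field
    κ : Fin n → Fin n → Fin (2 + r)
    κ-sym : ∀ a b → κ a b ≡ κ b a
    κ≢1 : ∀ a b → κ a b ≢ suc zero

module CircuitSides {n : ℕ} {R : Fin n → Fin n → Set} (R-sym : ∀ {a b} → R a b → R b a) (C : Circuit R) where

  open Circuit C public

  injective : Paths.InjectiveBelow R (suc s) p
  injective = proj₁ path

  On : Fin n → Set
  On v = ∃[ i ] i < suc s × p i ≡ v

  Side : Fin n → Fin n → Set
  Side a b = (∃[ i ] i < s × SamePair (p i) (p (suc i)) a b) ⊎ SamePair (p s) (p 0) a b

  side? : ∀ a b → Dec (Side a b)
  side? a b = anyUpTo? (λ i → samePair? (p i) (p (suc i)) a b) s ⊎-dec samePair? (p s) (p 0) a b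

  side-sym : ∀ {a b} → Side a b → Side b a
  side-sym (inj₁ (i , i<s , m)) = inj₁ (i , i<s , samePair-swap m)
  side-sym (inj₂ m) = inj₂ (samePair-swap m)

  side-step : ∀ {i} → i < s → Side (p i) (p (suc i))
  side-step {i} i<s = inj₁ (i , i<s , inj₁ (refl , refl))

  side-link : ∀ {a b} → Side a b → R a b
  side-link (inj₁ (i , i<s , inj₁ (refl , refl))) = proj₂ path i (s≤s i<s)
  side-link (inj₁ (i , i<s , inj₂ (refl , refl))) = R-sym (proj₂ path i (s≤s i<s))
  side-link (inj₂ (inj₁ (refl , refl))) = closing
  side-link (inj₂ (inj₂ (refl , refl))) = R-sym closing

  side-on : ∀ {a b} → Side a b → On a
  side-on (inj₁ (i , i<s , inj₁ (refl , _))) = i , m≤n⇒m≤1+n i<s , refl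
  side-on (inj₁ (i , i<s , inj₂ (refl , _))) = suc i , s≤s i<s , refl
  side-on (inj₂ (inj₁ (refl , _))) = s , ≤-refl , refl
  side-on (inj₂ (inj₂ (refl , _))) = 0 , s≤s z≤n , refl

  side-near : ∀ {i x} → suc i < s → Side (p (suc i)) x → x ≡ p i ⊎ x ≡ p (suc (suc i))
  side-near {i} lt (inj₁ (j , j<s , inj₁ (eq , refl))) with injective (m≤n⇒m≤1+n lt) (m≤n⇒m≤1+n j<s) eq
  ... | refl = inj₂ refl
  side-near {i} lt (inj₁ (j , j<s , inj₂ (eq , refl))) with injective (m≤n⇒m≤1+n lt) (s≤s j<s) eq
  ... | refl = inj₁ refl
  side-near lt (inj₂ (inj₁ (eq , _))) with injective (m≤n⇒m≤1+n lt) ≤-refl eq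
  ... | refl = ⊥-elim (<-irrefl refl lt)
  side-near lt (inj₂ (inj₂ (eq , _))) with injective (m≤n⇒m≤1+n lt) (s≤s z≤n) eq
  ... | ()

  two-sides : ∀ i → i ≤ s → ∃[ j ] ∃[ l ] j ≤ s × l ≤ s × j ≢ l × Side (p j) (p i) × Side (p l) (p i)
  two-sides zero _ = 1 , s , <⇒≤ 2≤s , ≤-refl , (λ { refl → <-irrefl refl 2≤s }) ,
    side-sym (side-step (<⇒≤ 2≤s)) , inj₂ (inj₁ (refl , refl))
  two-sides (suc i) i<s with m≤n⇒m<n∨m≡n i<s
  ... | inj₁ lt = i , suc (suc i) , <⇒≤ i<s , lt , (λ ()) , side-step i<s , side-sym (side-step lt)
  ... | inj₂ refl = i , 0 , <⇒≤ i<s , z≤n , (λ { refl → <-irrefl refl 2≤s }) , side-step i<s ,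
    inj₂ (inj₂ (refl , refl))

  on? : ∀ v → Dec (On v)
  on? v = anyUpTo? (λ i → p i ≟ v) (suc s)

module Recognition {G : Graph} {r : ℕ} {φ : VertexLabelling G (2 + r)} (N : Network G φ)
  (C : Circuit (Network._—_ N)) (P : Pattern (Graph.order G) r) where

  open NetworkLemmas N
  open CircuitSides link-sym C
  open Pattern P

  Label : Set
  Label = Fin (2 + r)

  p₀-kept : Kept (p 0)
  p₀-kept = link-kept (link-sym closing)

  open Distance _—_ link? Kept kept? link-kept On on?
    (λ v kv → p 0 , (0 , s≤s z≤n , refl) , kept-connected p₀-kept kv)

  Up : Vertex → Vertex → Set
  Up u v = u — v × suc (dist u) ≡ dist v

  up? : ∀ v → Dec (∃[ u ] Up u v)
  up? v = any? λ u → link? u v ×-dec (suc (dist u) ℕ.≟ dist v)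

  -- The parent of `v` in a breadth-first forest. The search chooses it, so automorphisms need not
  -- preserve the forest; `carried` copes with a forest link whose image is none.
  root : Vertex → Vertex
  root v with up? v
  ... | yes (u , _) = u
  ... | no _ = v

  root-up : ∀ {v} → ∃[ u ] Up u v → Up (root v) v
  root-up {v} e with up? v
  ... | yes (_ , up) = up
  ... | no ¬e = ⊥-elim (¬e e)

  Tree : Vertex → Vertex → Set
  Tree u v = root v ≡ u × Up u v

  tree? : ∀ u v → Dec (Tree u v)
  tree? u v = root v ≟ u ×-dec link? u v ×-dec (suc (dist u) ℕ.≟ dist v)

  tree-below : ∀ {u v} → Tree u v → dist u < dist v
  tree-below (_ , _ , e) = subst (dist _ <_) e (n<1+n _)

  tree-asym : ∀ {u v} → Tree u v → ¬ Tree v u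
  tree-asym t t′ = <-irrefl refl (<-trans (tree-below t) (tree-below t′))

  -- The label 1 is used by no side of the cycle, and off the cycle the links
  -- not labelled 1 form a forest; so the cycle is the only one avoiding it.
  L : Vertex → Vertex → Label
  L a b with side? a b | tree? a b | tree? b a
  ... | yes _ | _ | _ = κ a b
  ... | no _ | yes _ | _ = φ b
  ... | no _ | no _ | yes _ = φ a
  ... | no _ | no _ | no _ = suc zero

  L-sym : ∀ a b → L a b ≡ L b a
  L-sym a b with side? a b | side? b a
  ... | yes _ | yes _ = κ-sym a b
  ... | yes m | no ¬m = ⊥-elim (¬m (side-sym m))
  ... | no ¬m | yes m = ⊥-elim (¬m (side-sym m))
  ... | no _ | no _ with tree? a b | tree? b a
  ... | yes t | yes t′ = ⊥-elim (tree-asym t t′)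
  ... | yes _ | no _ = refl
  ... | no _ | yes _ = refl
  ... | no _ | no _ = refl

  L-side : ∀ {a b} → Side a b → L a b ≡ κ a b
  L-side {a} {b} m with side? a b
  ... | yes _ = refl
  ... | no ¬m = ⊥-elim (¬m m)

  L-tree : ∀ {a b} → ¬ Side a b → Tree a b → L a b ≡ φ b
  L-tree {a} {b} ¬m t with side? a b | tree? a b
  ... | yes m | _ = ⊥-elim (¬m m)
  ... | no _ | yes _ = refl
  ... | no _ | no ¬t = ⊥-elim (¬t t)

  L-other : ∀ {a b} → ¬ Side a b → ¬ Tree a b → ¬ Tree b a → L a b ≡ suc zero
  L-other {a} {b} ¬m ¬t ¬t′ with side? a b | tree? a b | tree? b a
  ... | yes m | _ | _ = ⊥-elim (¬m m)
  ... | no _ | yes t | _ = ⊥-elim (¬t t)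
  ... | no _ | no _ | yes t′ = ⊥-elim (¬t′ t′)
  ... | no _ | no _ | no _ = refl

  dist-on : ∀ {v} → On v → dist v ≡ 0
  dist-on on@(i , i≤s , refl) = dist-source (p-kept i i≤s) on
    where
    p-kept : ∀ i → i < suc s → Kept (p i)
    p-kept zero _ = p₀-kept
    p-kept (suc i) i<s = link-kept (link-sym (proj₂ path i i<s))

  side-flat : ∀ {a b} → Side a b → dist a ≡ 0
  side-flat m = dist-on (side-on m)

  data Kind (a b : Vertex) : Set where
    on-side : Side a b → Kind a b
    downward : Tree a b → Kind a b
    upward : Tree b a → Kind a b

  kind : ∀ {a b} → L a b ≢ suc zero → Kind a b
  kind {a} {b} L≢1 with side? a b | tree? a b | tree? b a
  ... | yes m | _ | _ = on-side m
  ... | no _ | yes t | _ = downward t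
  ... | no _ | no _ | yes t = upward t
  ... | no _ | no _ | no _ = ⊥-elim (L≢1 refl)

  module Image (α : Aut) (respects : RespectsLinks L α) where

    side-kind : ∀ {a b} → Side a b → Kind (α · a) (α · b)
    side-kind {a} {b} m = kind λ L≡1 → κ≢1 a b
      (trans (sym (L-side m)) (trans (sym (respects a b (side-link m))) L≡1))

    -- At a vertex of the image that is farthest from the cycle, both incident
    -- sides would have to be the unique forest link leaving it downwards.
    image-flat : ∀ i → i ≤ s → dist (α · p i) ≡ 0
    image-flat with argmax-upto (λ i → dist (α · p i)) s
    ... | i , i≤s , max with two-sides i i≤s
    ... | j , l , j≤s , l≤s , j≢l , ji , li = λ j′ j′≤s →
        ≤-antisym (subst (dist (α · p j′) ≤_) (top (dist (α · p i)) refl) (max j′ j′≤s)) z≤n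
      where
      down : ∀ {d} → dist (α · p i) ≡ suc d → ∀ {j} → j ≤ s → Kind (α · p j) (α · p i) → α · p j ≡ root (α · p i)
      down eq _ (on-side m) = ⊥-elim (0≢1+n (trans (sym (side-flat (side-sym m))) eq))
      down _ _ (downward t) = sym (proj₁ t)
      down _ j≤s (upward t) = ⊥-elim (<⇒≱ (tree-below t) (max _ j≤s))

      top : ∀ d → dist (α · p i) ≡ d → dist (α · p i) ≡ 0
      top zero eq = eq
      top (suc d) eq = ⊥-elim (j≢l (injective (s≤s j≤s) (s≤s l≤s)
        (·-injective α (trans (down eq j≤s (side-kind ji)) (sym (down eq l≤s (side-kind li)))))))

    on-flat : ∀ {v} → On v → dist (α · v) ≡ 0
    on-flat (i , s≤s i≤s , refl) = image-flat i i≤s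

    side-image : ∀ {a b} → Side a b → Side (α · a) (α · b)
    side-image {a} {b} m = flat (side-kind m)
      where
      flat : Kind (α · a) (α · b) → Side (α · a) (α · b)
      flat (on-side m′) = m′
      flat (downward t) = ⊥-elim (n≮0 (subst (dist (α · a) <_) (on-flat (side-on (side-sym m))) (tree-below t)))
      flat (upward t) = ⊥-elim (n≮0 (subst (dist (α · b) <_) (on-flat (side-on m)) (tree-below t)))

    κ-image : ∀ {a b} → Side a b → κ (α · a) (α · b) ≡ κ a b
    κ-image m = trans (sym (L-side (side-image m))) (trans (respects _ _ (side-link m)) (L-side m))

    module _ (α₀ : α · p 0 ≡ p 0) (α₁ : α · p 1 ≡ p 1) where

      fixed-pair : ∀ i → suc i ≤ s → α · p i ≡ p i × α · p (suc i) ≡ p (suc i)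
      fixed-pair zero _ = α₀ , α₁
      fixed-pair (suc i) lt with fixed-pair i (<⇒≤ lt)
      ... | αi , αsi = αsi , go (side-near lt (subst (λ a → Side a (α · p (suc (suc i)))) αsi
                                  (side-image (side-step lt))))
        where
        go : α · p (suc (suc i)) ≡ p i ⊎ α · p (suc (suc i)) ≡ p (suc (suc i)) →
          α · p (suc (suc i)) ≡ p (suc (suc i))
        go (inj₂ eq) = eq
        go (inj₁ eq) with injective (s≤s lt) (s≤s (≤-trans (n≤1+n i) (<⇒≤ lt))) (·-injective α (trans eq (sym αi)))
        ... | ()

      fixed : ∀ {v} → On v → α · v ≡ v
      fixed (zero , _ , refl) = α₀
      fixed (suc i , s≤s lt , refl) = proj₂ (fixed-pair i lt)

      fixed⁻¹ : ∀ {v} → On v → (α ⁻¹) · v ≡ v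
      fixed⁻¹ {v} on = trans (cong ((α ⁻¹) ·_) (sym (fixed on))) (⁻¹-inverseˡ α v)

      open Balls _—_

      dist-shrinks : ∀ β → (∀ {v} → On v → β · v ≡ v) → ∀ {v} → Kept v → dist (β · v) ≤ dist v
      dist-shrinks β fix {v} kv = dist-min (kept-image β kv)
        (Ball-map (β ·_) (link-image β) (λ {u} on → subst On (sym (fix on)) on) (dist-ball kv))

      dist-image : ∀ {v} → Kept v → dist (α · v) ≡ dist v
      dist-image {v} kv = ≤-antisym (dist-shrinks α fixed kv)
        (subst (λ u → dist u ≤ dist (α · v)) (⁻¹-inverseˡ α v) (dist-shrinks (α ⁻¹) fixed⁻¹ (kept-image α kv)))

      dist-image⁻¹ : ∀ {v} → Kept v → dist ((α ⁻¹) · v) ≡ dist v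
      dist-image⁻¹ {v} kv = trans (sym (dist-image (kept-image (α ⁻¹) kv))) (cong dist (⁻¹-inverseʳ α v))

      respects⁻¹ : RespectsLinks L (α ⁻¹)
      respects⁻¹ a b l = trans (sym (respects _ _ (link-image (α ⁻¹) l)))
        (cong₂ L (⁻¹-inverseʳ α a) (⁻¹-inverseʳ α b))

      -- The link from the parent to `v` carries `φ v`. Its image joins the same two levels and is
      -- either a forest link, carrying `φ (β · v)`, or a link labelled 1. In `kept-preserved` this
      -- is applied to `α` at `v` and to the inverse at `α · v`: if both end in the second
      -- alternative, both labels are 1 and agree after all.
      carried : ∀ β → RespectsLinks L β → (∀ {v} → Kept v → dist (β · v) ≡ dist v) →
        ∀ {v d} → Kept v → dist v ≡ suc d → φ (β · v) ≡ φ v ⊎ φ v ≡ suc zero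
      carried β resp β-dist {v} {d} kv eq =
        go (tree? (β · u) (β · v)) (resp u v (proj₁ up))
        where
        u = root v
        up : Up u v
        up = let (w , wv , dw) = parent kv eq in root-up (w , wv , trans (cong suc dw) (sym eq))
        tree : Tree u v
        tree = refl , up

        off-side : ∀ {a w} → dist w ≡ suc d → ¬ Side a w
        off-side dw m = 0≢1+n (trans (sym (side-flat (side-sym m))) dw)

        Lᵤᵥ : L u v ≡ φ v
        Lᵤᵥ = L-tree (off-side eq) tree

        βv : dist (β · v) ≡ suc d
        βv = trans (β-dist kv) eq

        not-above : ¬ Tree (β · v) (β · u)
        not-above t = <-irrefl refl (<-trans (tree-below tree)
          (subst₂ _<_ (β-dist kv) (β-dist (link-kept (proj₁ up))) (tree-below t)))

        go : Dec (Tree (β · u) (β · v)) → L (β · u) (β · v) ≡ L u v → φ (β · v) ≡ φ v ⊎ φ v ≡ suc zero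
        go (yes t) L≡ = inj₁ (trans (sym (L-tree (off-side βv) t)) (trans L≡ Lᵤᵥ))
        go (no ¬t) L≡ = inj₂ (trans (sym Lᵤᵥ) (trans (sym L≡) (L-other (off-side βv) ¬t not-above)))

      kept-preserved : PreservesKept α
      kept-preserved v kv = by-distance (dist v) refl
        where
        by-distance : ∀ d → dist v ≡ d → φ (α · v) ≡ φ v
        by-distance zero eq = cong φ (fixed (dist≡0 kv eq))
        by-distance (suc d) eq = agree (carried α respects dist-image kv eq)
            (carried (α ⁻¹) respects⁻¹ dist-image⁻¹ (kept-image α kv) (trans (dist-image kv) eq))
          where
          agree : φ (α · v) ≡ φ v ⊎ φ v ≡ suc zero →
            φ ((α ⁻¹) · α · v) ≡ φ (α · v) ⊎ φ (α · v) ≡ suc zero → φ (α · v) ≡ φ v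
          agree (inj₁ same) _ = same
          agree _ (inj₁ same) = trans (sym same) (cong φ (⁻¹-inverseˡ α v))
          agree (inj₂ φv) (inj₂ φαv) = trans φαv (sym φv)

-- What remains of unbreakability once the cycle is invariant: a pattern wins as soon as it forces
-- two adjacent vertices of the cycle to be fixed.
recognise : ∀ {G : Graph} {r : ℕ} {φ : VertexLabelling G (2 + r)} (N : Network G φ)
  (C : Circuit (Network._—_ N)) (P : Pattern (Graph.order G) r) →
  let open NetworkLemmas N ; open CircuitSides link-sym C ; open Pattern P in
  ∃[ α ] (∀ {a b} → Side a b → Side (α · a) (α · b)) ×
    (∀ {a b} → Side a b → κ (α · a) (α · b) ≡ κ a b) ×
    (α · p 0 ≡ p 0 → α · p 1 ≡ p 1 → ⊥)
recognise N C P with Network.unbreakable N (Recognition.L N C P) (Recognition.L-sym N C P)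
... | α , respects , _ , moved =
  α , I.side-image , I.κ-image , λ α₀ α₁ → moved (I.kept-preserved α₀ α₁)
  where module I = Recognition.Image N C P α respects

-- Branching networks with at least three labels

-- Meant for the positions of three neighbours of `p 0` on a longest path: one may be the next
-- vertex, while the other two close cycles.
two-beyond-first : ∀ {P : ℕ → Set} {i j l} → 1 ≤ i → 1 ≤ j → 1 ≤ l → i ≢ j → i ≢ l → j ≢ l →
  P i → P j → P l → ∃[ s ] ∃[ t ] 2 ≤ s × s < t × P s × P t
two-beyond-first {P} {i} {j} {l} 1≤i 1≤j 1≤l i≢j i≢l j≢l pi pj pl
  with m≤n⇒m<n∨m≡n 1≤i | m≤n⇒m<n∨m≡n 1≤j
... | inj₁ 2≤i | inj₁ 2≤j = order 2≤i 2≤j i≢j pi pj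
  where
  order : ∀ {a b} → 2 ≤ a → 2 ≤ b → a ≢ b → P a → P b → ∃[ s ] ∃[ t ] 2 ≤ s × s < t × P s × P t
  order {a} {b} 2≤a 2≤b a≢b pa pb with <-cmp a b
  ... | tri< a<b _ _ = a , b , 2≤a , a<b , pa , pb
  ... | tri≈ _ eq _ = ⊥-elim (a≢b eq)
  ... | tri> _ _ b<a = b , a , 2≤b , b<a , pb , pa
... | inj₂ refl | inj₂ refl = ⊥-elim (i≢j refl)
... | inj₂ refl | inj₁ 2≤j with m≤n⇒m<n∨m≡n 1≤l
...   | inj₂ refl = ⊥-elim (i≢l refl)
...   | inj₁ 2≤l with <-cmp j l
...     | tri< a<b _ _ = j , l , 2≤j , a<b , pj , pl
...     | tri≈ _ eq _ = ⊥-elim (j≢l eq)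
...     | tri> _ _ b<a = l , j , 2≤l , b<a , pl , pj
two-beyond-first {P} {i} {j} {l} 1≤i 1≤j 1≤l i≢j i≢l j≢l pi pj pl | inj₁ 2≤i | inj₂ refl
  with m≤n⇒m<n∨m≡n 1≤l
...   | inj₂ refl = ⊥-elim (j≢l refl)
...   | inj₁ 2≤l with <-cmp i l
...     | tri< a<b _ _ = i , l , 2≤i , a<b , pi , pl
...     | tri≈ _ eq _ = ⊥-elim (i≢l eq)
...     | tri> _ _ b<a = l , i , 2≤l , b<a , pl , pi

infixl 6 _⊞_
_⊞_ : Fin 3 → Fin 3 → Fin 3
zero ⊞ b = b
suc zero ⊞ zero = suc zero
suc zero ⊞ suc zero = suc (suc zero)
suc zero ⊞ suc (suc zero) = zero
suc (suc zero) ⊞ zero = suc (suc zero)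
suc (suc zero) ⊞ suc zero = zero
suc (suc zero) ⊞ suc (suc zero) = suc zero

⊞-comm : ∀ a b → a ⊞ b ≡ b ⊞ a
⊞-comm = from-yes (all? λ a → all? λ b → a ⊞ b ≟ b ⊞ a)

⊞-cancel : ∀ a b c → a ⊞ b ≡ a ⊞ c → b ≡ c
⊞-cancel = from-yes (all? λ a → all? λ b → all? λ c → (a ⊞ b ≟ a ⊞ c) →-dec (b ≟ c))

-- Doubling is injective modulo 3, and 2a = (a + b) + (c + a) - (b + c).
⊞-triangle : ∀ a b c a′ b′ c′ → a ⊞ b ≡ a′ ⊞ b′ → b ⊞ c ≡ b′ ⊞ c′ → c ⊞ a ≡ c′ ⊞ a′ → a ≡ a′
⊞-triangle = from-yes (all? λ a → all? λ b → all? λ c → all? λ a′ → all? λ b′ → all? λ c′ →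
  (a ⊞ b ≟ a′ ⊞ b′) →-dec ((b ⊞ c ≟ b′ ⊞ c′) →-dec ((c ⊞ a ≟ c′ ⊞ a′) →-dec (a ≟ a′))))

module LongestPath {G : Graph} {r : ℕ} {φ : VertexLabelling G r} (N : Network G φ)
  (has₂ : ∀ v → Network.Kept N v → Network.Has₂ N v) where

  open NetworkLemmas N
  open Paths _—_ public

  Stuck : ℕ → (ℕ → Vertex) → Set
  Stuck m p = IsPath (suc m) p × Kept (p 0) ×
    (∀ {x} → p 0 — x → ∃[ i ] 1 ≤ i × i ≤ m × p i ≡ x)

  single : ∀ x → IsPath 1 (λ _ → x)
  single x = (λ { {zero} {zero} _ _ _ → refl ; {suc _} (s≤s ()) ; {zero} {suc _} _ (s≤s ()) }) ,
    λ { _ (s≤s ()) }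

  stuck-path : ∀ {v} → Kept v → (∀ m p → Stuck m p → ⊥) → ⊥
  stuck-path {v} kv contra = longest stuck 1 (λ _ → v) (single v)
    where
    w = proj₁ (has₂ v kv)
    vw : v — w
    vw = let (_ , _ , _ , l , _) = has₂ v kv in l

    stuck : ∀ m p → IsPath m p → (∀ q → ¬ IsPath (suc m) q) → ⊥
    stuck zero p path max = max (λ _ → v) (single v)
    stuck (suc zero) p path max = max (v ∷ᵖ λ _ → w)
      (extend (single w) vw λ { (_ , _ , eq) → distinct-links vw (sym eq) })
    stuck (suc (suc m)) p path max = contra (suc m) p (path , link-kept (proj₂ path 0 (s≤s (s≤s z≤n))) , on-path)
      where
      on-path : ∀ {x} → p 0 — x → ∃[ i ] 1 ≤ i × i ≤ suc m × p i ≡ x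
      on-path {x} l with locate p (suc (suc m)) x
      ... | no fresh = ⊥-elim (max (x ∷ᵖ p) (extend path (link-sym l) fresh))
      ... | yes (zero , _ , refl) = ⊥-elim (link-irrefl l)
      ... | yes (suc i , s≤s i< , eq) = suc i , s≤s z≤n , i< , eq

  shorten : ∀ {m p s} → s ≤ m → IsPath (suc m) p → IsPath (suc s) p
  shorten s≤m (inj , steps) = (λ i< j< → inj (≤-trans i< (s≤s s≤m)) (≤-trans j< (s≤s s≤m))) ,
    λ i lt → steps i (≤-trans lt (s≤s s≤m))

  circuit : ∀ {m p s} → IsPath (suc m) p → 2 ≤ s → s ≤ m → p s — p 0 → Circuit _—_
  circuit path 2≤s s≤m closing = record
    { path = shorten s≤m path ; 2≤s = 2≤s ; closing = closing }

  -- Of two neighbours of `p 0` at most one is `p 1`.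
  chord : ∀ {m p} → Stuck m p → ∃[ s ] 2 ≤ s × s ≤ m × p s — p 0
  chord {m} {p} (path , k₀ , near) with has₂ (p 0) k₀
  ... | b , c , b≢c , ab , ac with near ab | near ac
  ... | zero , () , _ | _
  ... | _ | zero , () , _
  ... | suc (suc i) , _ , i≤m , refl | _ = suc (suc i) , s≤s (s≤s z≤n) , i≤m , link-sym ab
  ... | suc zero , _ | suc (suc j) , _ , j≤m , refl = suc (suc j) , s≤s (s≤s z≤n) , j≤m , link-sym ac
  ... | suc zero , _ , _ , refl | suc zero , _ , _ , eq = ⊥-elim (b≢c eq)

module FourLabels {G : Graph} {k : ℕ} {φ : VertexLabelling G (4 + k)} (N : Network G φ)
  (has₂ : ∀ v → Network.Kept N v → Network.Has₂ N v) where

  open NetworkLemmas N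
  open LongestPath N has₂

  module Colours {x y z : Vertex} (x≢y : x ≢ y) (x≢z : x ≢ z) where

    -- Without 1 there are still three labels: 2 and 3 for two adjacent sides, 0 for the rest.
    κ : Vertex → Vertex → Fin (4 + k)
    κ a b with samePair? x y a b | samePair? y z a b
    ... | yes _ | _ = suc (suc zero)
    ... | no _ | yes _ = suc (suc (suc zero))
    ... | no _ | no _ = zero

    κ-sym : ∀ a b → κ a b ≡ κ b a
    κ-sym a b with samePair? x y a b | samePair? x y b a
    ... | yes _ | yes _ = refl
    ... | yes m | no ¬m = ⊥-elim (¬m (samePair-swap m))
    ... | no ¬m | yes m = ⊥-elim (¬m (samePair-swap m))
    ... | no _ | no _ with samePair? y z a b | samePair? y z b a
    ... | yes _ | yes _ = refl
    ... | yes m | no ¬m = ⊥-elim (¬m (samePair-swap m))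
    ... | no ¬m | yes m = ⊥-elim (¬m (samePair-swap m))
    ... | no _ | no _ = refl

    κ≢1 : ∀ a b → κ a b ≢ suc zero
    κ≢1 a b eq with samePair? x y a b | samePair? y z a b
    κ≢1 a b () | yes _ | _
    κ≢1 a b () | no _ | yes _
    κ≢1 a b () | no _ | no _

    pattern-xyz : Pattern order (2 + k)
    pattern-xyz = record { κ = κ ; κ-sym = κ-sym ; κ≢1 = κ≢1 }

    κ-xy : κ x y ≡ suc (suc zero)
    κ-xy with samePair? x y x y
    ... | yes _ = refl
    ... | no ¬m = ⊥-elim (¬m (inj₁ (refl , refl)))

    κ-yz : κ y z ≡ suc (suc (suc zero))
    κ-yz with samePair? x y y z | samePair? y z y z
    ... | yes (inj₁ (eq , _)) | _ = ⊥-elim (x≢y (sym eq))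
    ... | yes (inj₂ (_ , eq)) | _ = ⊥-elim (x≢z (sym eq))
    ... | no _ | yes _ = refl
    ... | no _ | no ¬m = ⊥-elim (¬m (inj₁ (refl , refl)))

    from-xy : ∀ a b → κ a b ≡ suc (suc zero) → SamePair x y a b
    from-xy a b eq with samePair? x y a b | samePair? y z a b
    ... | yes m | _ = m
    from-xy a b () | no _ | yes _
    from-xy a b () | no _ | no _

    from-yz : ∀ a b → κ a b ≡ suc (suc (suc zero)) → SamePair y z a b
    from-yz a b eq with samePair? x y a b | samePair? y z a b
    from-yz a b () | yes _ | _
    ... | no _ | yes m = m
    from-yz a b () | no _ | no _

    pinned : ∀ {a b c} → κ a b ≡ κ x y → κ b c ≡ κ y z → a ≡ x × b ≡ y
    pinned {a} {b} {c} eq₁ eq₂ with from-xy a b (trans eq₁ κ-xy) | from-yz b c (trans eq₂ κ-yz)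
    ... | inj₁ eqs | _ = eqs
    ... | inj₂ (_ , b≡x) | inj₁ (b≡y , _) = ⊥-elim (x≢y (trans (sym b≡x) b≡y))
    ... | inj₂ (_ , b≡x) | inj₂ (b≡z , _) = ⊥-elim (x≢z (trans (sym b≡x) b≡z))

  no-circuit : Circuit _—_ → ⊥
  no-circuit C = unpinned
      (recognise N C (Colours.pattern-xyz p₀≢p₁ p₀≢p₂))
    where
    open CircuitSides link-sym C

    p₀≢p₁ : p 0 ≢ p 1
    p₀≢p₁ eq with injective (s≤s z≤n) (s≤s (<⇒≤ 2≤s)) eq
    ... | ()

    p₀≢p₂ : p 0 ≢ p 2
    p₀≢p₂ eq with injective (s≤s z≤n) (s≤s 2≤s) eq
    ... | ()

    κ = Colours.κ p₀≢p₁ p₀≢p₂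

    unpinned : ∃[ α ] (∀ {a b} → Side a b → Side (α · a) (α · b)) ×
      (∀ {a b} → Side a b → κ (α · a) (α · b) ≡ κ a b) × (α · p 0 ≡ p 0 → α · p 1 ≡ p 1 → ⊥) → ⊥
    unpinned (α , _ , κ-image , ¬pinned) =
      let (α₀ , α₁) = Colours.pinned p₀≢p₁ p₀≢p₂
            (κ-image (side-step (<⇒≤ 2≤s))) (κ-image (side-step 2≤s))
      in ¬pinned α₀ α₁

  impossible : ∀ {v} → Kept v → ⊥
  impossible kv = stuck-path kv λ m p st →
    let (s , 2≤s , s≤m , closing) = chord st in
    no-circuit (circuit (proj₁ st) 2≤s s≤m closing)

module ThreeLabels {G : Graph} {φ : VertexLabelling G 3} (N : Network G φ)
  (has₂ : ∀ v → Network.Kept N v → Network.Has₂ N v)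
  (small-near-big : ∀ u v → ¬ Network.Has₃ N u → Network._—_ N u v → Network.Has₃ N v) where

  open NetworkLemmas N
  open LongestPath N has₂

  module SingleMark {M : Vertex → Vertex → Set} (M? : ∀ a b → Dec (M a b)) (M-sym : ∀ {a b} → M a b → M b a) where

    κ : Vertex → Vertex → Fin 3
    κ a b with M? a b
    ... | yes _ = suc (suc zero)
    ... | no _ = zero

    κ-sym : ∀ a b → κ a b ≡ κ b a
    κ-sym a b with M? a b | M? b a
    ... | yes _ | yes _ = refl
    ... | yes m | no ¬m = ⊥-elim (¬m (M-sym m))
    ... | no ¬m | yes m = ⊥-elim (¬m (M-sym m))
    ... | no _ | no _ = refl

    κ≢1 : ∀ a b → κ a b ≢ suc zero
    κ≢1 a b eq with M? a b
    κ≢1 a b () | yes _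
    κ≢1 a b () | no _

    pattern-M : Pattern order 1
    pattern-M = record { κ = κ ; κ-sym = κ-sym ; κ≢1 = κ≢1 }

    κ-marked : ∀ a b c d → κ c d ≡ κ a b → M a b → M c d
    κ-marked a b c d eq m with M? a b | M? c d | eq
    ... | _ | yes m′ | _ = m′
    ... | yes _ | no _ | ()
    ... | no ¬m | no _ | _ = ⊥-elim (¬m m)

  Marked : (C : Circuit _—_) → (Vertex → Vertex → Set) → Set
  Marked C M = let open CircuitSides link-sym C in
    ∃[ α ] (∀ {a b} → Side a b → Side (α · a) (α · b)) ×
      (∀ {a b} → Side a b → M a b → M (α · a) (α · b)) ×
      (α · p 0 ≡ p 0 → α · p 1 ≡ p 1 → ⊥)

  recognise-mark : (C : Circuit _—_) →
    ∀ {M : Vertex → Vertex → Set} → (∀ a b → Dec (M a b)) → (∀ {a b} → M a b → M b a) → Marked C M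
  recognise-mark C {M} M? M-sym = restate (recognise N C pattern-M)
    where
    open CircuitSides link-sym C
    open SingleMark M? M-sym

    restate : ∃[ α ] (∀ {a b} → Side a b → Side (α · a) (α · b)) ×
      (∀ {a b} → Side a b → κ (α · a) (α · b) ≡ κ a b) × (α · p 0 ≡ p 0 → α · p 1 ≡ p 1 → ⊥) →
      Marked C M
    restate (α , side-image , κ-image , ¬pinned) = α , side-image ,
      (λ {a} {b} side → κ-marked a b (α · a) (α · b) (κ-image side)) , ¬pinned

  -- Only 0 and 2 are left for the cycle, so one side is marked with 2. Reversing it would exchange
  -- two ends of which just one has degree at least three.
  uneven : (C : Circuit _—_) → let open Circuit C in
    (Has₃ (p 0) × ¬ Has₃ (p 1)) ⊎ (¬ Has₃ (p 0) × Has₃ (p 1)) → ⊥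
  uneven C different = unpinned (recognise-mark C (samePair? (p 0) (p 1)) samePair-swap)
    where
    open CircuitSides link-sym C

    unpinned : Marked C (SamePair (p 0) (p 1)) → ⊥
    unpinned (α , _ , marked , ¬pinned) = go (marked (side-step (<⇒≤ 2≤s)) (inj₁ (refl , refl))) different
      where
      go : SamePair (p 0) (p 1) (α · p 0) (α · p 1) →
        (Has₃ (p 0) × ¬ Has₃ (p 1)) ⊎ (¬ Has₃ (p 0) × Has₃ (p 1)) → ⊥
      go (inj₁ (α₀ , α₁)) _ = ¬pinned α₀ α₁
      go (inj₂ (q₀ , q₁)) (inj₁ (big , small)) = small (subst Has₃ q₀ (has₃-image α big))
      go (inj₂ (q₀ , q₁)) (inj₂ (small , big)) = small (subst Has₃ q₁ (has₃-image α big))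

  -- `Hexapath` is used with `Side` for `R`: vertices of the cycle may have high degree in the
  -- network, but each has only two sides. Length at least six separates `p 0` from `p 5`.
  long : (C : Circuit _—_) → 5 ≤ Circuit.s C → ⊥
  long C 5≤s = unpinned (recognise-mark C mark? mark-sym)
    where
    open CircuitSides link-sym C

    1≤5 : 1 ≤ 5
    1≤5 = s≤s z≤n
    2≤5 : 2 ≤ 5
    2≤5 = s≤s (s≤s z≤n)
    3≤5 : 3 ≤ 5
    3≤5 = s≤s (s≤s (s≤s z≤n))
    4≤5 : 4 ≤ 5
    4≤5 = s≤s (s≤s (s≤s (s≤s z≤n)))

    apart : ∀ i j → i ≤ 5 → j ≤ 5 → i ≢ j → p i ≢ p j
    apart i j i≤ j≤ i≢j eq = i≢j (injective (s≤s (≤-trans i≤ 5≤s)) (s≤s (≤-trans j≤ 5≤s)) eq)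

    hexapath : Hexapath Side
    hexapath = record
      { w₀ = p 0 ; w₁ = p 1 ; w₂ = p 2 ; w₃ = p 3 ; w₄ = p 4 ; w₅ = p 5
      ; step₀₁ = side-step (≤-trans 1≤5 5≤s) ; step₁₂ = side-step 2≤s
      ; step₂₃ = side-step (≤-trans 3≤5 5≤s) ; step₃₄ = side-step (≤-trans 4≤5 5≤s)
      ; near₂ = side-near (≤-trans 3≤5 5≤s) ; near₃ = side-near (≤-trans 4≤5 5≤s) ; near₄ = side-near 5≤s
      ; ₀≢₁ = apart 0 1 z≤n 1≤5 λ () ; ₀≢₂ = apart 0 2 z≤n 2≤5 λ () ; ₀≢₃ = apart 0 3 z≤n 3≤5 λ ()
      ; ₀≢₄ = apart 0 4 z≤n 4≤5 λ () ; ₀≢₅ = apart 0 5 z≤n ≤-refl λ ()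
      ; ₁≢₂ = apart 1 2 1≤5 2≤5 λ () ; ₁≢₃ = apart 1 3 1≤5 3≤5 λ () ; ₁≢₄ = apart 1 4 1≤5 4≤5 λ ()
      ; ₂≢₃ = apart 2 3 2≤5 3≤5 λ () ; ₂≢₄ = apart 2 4 2≤5 4≤5 λ ()
      }

    open Hexapath hexapath using (Mark; mark?; mark-sym; pins)

    unpinned : Marked C Mark → ⊥
    unpinned (α , side-image , marked , ¬pinned) =
      let (α₀ , α₁ , _) = pins side-sym (λ side → link-irrefl (side-link side)) (α ·_) (·-injective α)
            side-image marked
      in ¬pinned α₀ α₁

  -- The three sums modulo 3 determine the labels of the corners, whereas `latin` supplies an
  -- automorphism that preserves the label of no kept vertex.
  triangle : ∀ {a b c} → a — b → b — c → c — a → ⊥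
  triangle {a} {b} {c} ab bc ca with latin _⊞_ ⊞-comm (λ {x} {y} {z} → ⊞-cancel x y z)
  ... | α , sums , off , moved = moved a (link-kept ab)
    (⊞-triangle _ _ _ _ _ _ (sums a b ab) (sums b c bc) (sums c a ca))

  impossible : ∀ {v} → Kept v → ⊥
  impossible kv = stuck-path kv stuck
    where
    stuck : ∀ m p → Stuck m p → ⊥
    stuck m p st@(path , k₀ , near) with chord st | has₃? (p 0) | has₃? (p 1)
    ... | s , 2≤s , s≤m , closing | no small₀ | _ =
      uneven (circuit path 2≤s s≤m closing)
        (inj₂ (small₀ , small-near-big _ _ small₀ (proj₂ path 0 (s≤s (≤-trans (<⇒≤ 2≤s) s≤m)))))
    ... | s , 2≤s , s≤m , closing | yes big₀ | no small₁ =
      uneven (circuit path 2≤s s≤m closing) (inj₁ (big₀ , small₁))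
    ... | _ | yes (b , c , d , b≢c , b≢d , c≢d , ab , ac , ad) | yes _ with near ab | near ac | near ad
    ... | i , 1≤i , i≤m , refl | j , 1≤j , j≤m , refl | l , 1≤l , l≤m , refl =
      two-chords (two-beyond-first {λ i → i ≤ m × p 0 — p i} 1≤i 1≤j 1≤l (b≢c ∘ cong p) (b≢d ∘ cong p) (c≢d ∘ cong p)
        (i≤m , ab) (j≤m , ac) (l≤m , ad))
      where
      two-chords : ∃[ s ] ∃[ t ] 2 ≤ s × s < t × (s ≤ m × p 0 — p s) × (t ≤ m × p 0 — p t) → ⊥
      two-chords (s , t , 2≤s , s<t , (s≤m , l₀ₛ) , (t≤m , l₀ₜ)) with 5 ≤? t
      ... | yes 5≤t = long (circuit path (≤-trans 2≤s (<⇒≤ s<t)) t≤m (link-sym l₀ₜ)) 5≤t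
      ... | no t≱5 = small s t 2≤s s<t (≤-pred (≰⇒> t≱5)) t≤m l₀ₛ l₀ₜ
        where
        -- Both chords now end at index 4 or earlier. Either `s` is 2 and the first three vertices
        -- form a triangle, or `s` and `t` are 3 and 4 and form one with `p 0`.
        small : ∀ s t → 2 ≤ s → s < t → t ≤ 4 → t ≤ m → p 0 — p s → p 0 — p t → ⊥
        small zero _ () _ _ _ _ _
        small (suc zero) _ (s≤s ()) _ _ _ _ _
        small (suc (suc zero)) t _ 2<t _ t≤m l₀₂ _ =
          triangle (proj₂ path 0 (s≤s (≤-trans (<⇒≤ (<⇒≤ 2<t)) t≤m))) (proj₂ path 1 (s≤s (≤-trans (<⇒≤ 2<t) t≤m))) (link-sym l₀₂)
        small (suc (suc (suc zero))) (suc (suc (suc (suc zero)))) _ _ _ 4≤m l₀₃ l₀₄ =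
          triangle l₀₃ (proj₂ path 3 (s≤s 4≤m)) (link-sym l₀₄)
        small (suc (suc (suc _))) (suc zero) _ (s≤s ()) _ _ _ _
        small (suc (suc (suc _))) (suc (suc zero)) _ (s≤s (s≤s ())) _ _ _ _
        small (suc (suc (suc _))) (suc (suc (suc zero))) _ (s≤s (s≤s (s≤s ()))) _ _ _ _
        small (suc (suc (suc (suc _)))) (suc (suc (suc (suc zero)))) _ (s≤s (s≤s (s≤s (s≤s ())))) _ _ _ _
        small _ (suc (suc (suc (suc (suc _))))) _ _ (s≤s (s≤s (s≤s (s≤s ())))) _ _ _

-- Branching networks with two labels

-- `β` permutes the vertices, so `φ` and its composite with `β` take the value 1 equally often; a
-- single change would alter that number by one.
no-single-change : ∀ {G : Graph} (φ : VertexLabelling G 2) → let open Automorphisms G in ∀ (β : Aut) (x : Vertex) →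
  (∀ v → v ≢ x → φ (β · v) ≡ φ v) → φ (β · x) ≢ φ x → ⊥
no-single-change {G} φ β x same changed = go (φ x) (φ (β · x)) refl refl
  where
  open Automorphisms G

  f fβ : Vertex → ℕ
  f v = toℕ (φ v)
  fβ v = toℕ (φ (β · v))

  equal : sum f ≡ sum fβ
  equal = sum-permute f (Automorphism.perm β)

  go : ∀ a b → φ x ≡ a → φ (β · x) ≡ b → ⊥
  go zero zero p q = changed (trans q (sym p))
  go (suc zero) (suc zero) p q = changed (trans q (sym p))
  go zero (suc zero) p q = <-irrefl equal (sum-strict f fβ le x lt)
    where
    lt : f x < fβ x
    lt rewrite p | q = s≤s z≤n
    le : ∀ v → f v ≤ fβ v
    le v with v ≟ x
    ... | yes refl = <⇒≤ lt
    ... | no v≢x = ≤-reflexive (cong toℕ (sym (same v v≢x)))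
  go (suc zero) zero p q = <-irrefl (sym equal) (sum-strict fβ f le x lt)
    where
    lt : fβ x < f x
    lt rewrite p | q = s≤s z≤n
    le : ∀ v → fβ v ≤ f v
    le v with v ≟ x
    ... | yes refl = <⇒≤ lt
    ... | no v≢x = ≤-reflexive (cong toℕ (same v v≢x))

⊕-exchange : ∀ a c a′ c′ → a′ ⊕ c′ ≡ a ⊕ c → a′ ⊕ a ≡ c′ ⊕ c
⊕-exchange = from-yes (all? λ a → all? λ c → all? λ a′ → all? λ c′ →
  (a′ ⊕ c′ ≟ a ⊕ c) →-dec (a′ ⊕ a ≟ c′ ⊕ c))

⊕-exchange-flipped : ∀ a c a′ c′ → a′ ⊕ c′ ≡ suc zero ⊕ (a ⊕ c) → a′ ⊕ a ≢ c′ ⊕ c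
⊕-exchange-flipped = from-yes (all? λ a → all? λ c → all? λ a′ → all? λ c′ →
  (a′ ⊕ c′ ≟ suc zero ⊕ (a ⊕ c)) →-dec ¬? (a′ ⊕ a ≟ c′ ⊕ c))

⊕≡0 : ∀ a b → a ⊕ b ≡ zero → a ≡ b
⊕≡0 = from-yes (all? λ a → all? λ b → (a ⊕ b ≟ zero) →-dec (a ≟ b))

⊕-self : ∀ a → a ⊕ a ≡ zero
⊕-self = from-yes (all? λ a → a ⊕ a ≟ zero)

samePair-first : ∀ {n} {u v a b : Fin n} → SamePair u v a b → a ≡ u ⊎ a ≡ v
samePair-first (inj₁ (p , _)) = inj₁ p
samePair-first (inj₂ (p , _)) = inj₂ p

samePair-second : ∀ {n} {u v a b : Fin n} → SamePair u v a b → b ≡ u ⊎ b ≡ v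
samePair-second = samePair-first ∘ samePair-swap

-- Without the flag an automorphism respecting L preserves φ or complements it at
-- all kept vertices.  The flag is meant to exclude the latter.
module Twist {G : Graph} {φ : VertexLabelling G 2} (N : Network G φ) (f₁ f₂ : Graph.Vertex G) where

  open NetworkLemmas N

  flag : Vertex → Vertex → Fin 2
  flag a b with samePair? f₁ f₂ a b
  ... | yes _ = suc zero
  ... | no _ = zero

  flag-yes : ∀ {a b} → SamePair f₁ f₂ a b → flag a b ≡ suc zero
  flag-yes {a} {b} m with samePair? f₁ f₂ a b
  ... | yes _ = refl
  ... | no ¬m = ⊥-elim (¬m m)

  flag-no : ∀ {a b} → ¬ SamePair f₁ f₂ a b → flag a b ≡ zero
  flag-no {a} {b} ¬m with samePair? f₁ f₂ a b
  ... | yes m = ⊥-elim (¬m m)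
  ... | no _ = refl

  L : Vertex → Vertex → Fin 2
  L a b = flag a b ⊕ (φ a ⊕ φ b)

  L-sym : ∀ a b → L a b ≡ L b a
  L-sym a b = cong₂ _⊕_ flag-sym (⊕-comm (φ a) (φ b))
    where
    flag-sym : flag a b ≡ flag b a
    flag-sym with samePair? f₁ f₂ a b
    ... | yes m = sym (flag-yes (samePair-swap m))
    ... | no ¬m = sym (flag-no (¬m ∘ samePair-swap))

  module Discrepancy (α : Aut) (respects : RespectsLinks L α) (off : PreservesOff α)
    (moved : ¬ PreservesKept α) where

    -- It is 1 exactly where `α` changes the label. It can jump only across the flagged link and the
    -- link that `α` maps onto it, and not if these coincide.
    δ : Vertex → Fin 2
    δ v = φ (α · v) ⊕ φ v

    Here There : Vertex → Vertex → Set
    Here a b = SamePair f₁ f₂ a b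
    There a b = SamePair f₁ f₂ (α · a) (α · b)

    there? : ∀ a b → Dec (There a b)
    there? a b = samePair? f₁ f₂ (α · a) (α · b)

    δ-plain : ∀ {a b} → a — b → ¬ Here a b → ¬ There a b → δ a ≡ δ b
    δ-plain {a} {b} l ¬h ¬t = ⊕-exchange (φ a) (φ b) _ _
      (trans (sym (cong (_⊕ (φ (α · a) ⊕ φ (α · b))) (flag-no ¬t)))
        (trans (respects a b l) (cong (_⊕ (φ a ⊕ φ b)) (flag-no ¬h))))

    δ-both : ∀ {a b} → a — b → Here a b → There a b → δ a ≡ δ b
    δ-both {a} {b} l h t = ⊕-exchange (φ a) (φ b) _ _
      (⊕-cancel {suc zero} (trans (sym (cong (_⊕ (φ (α · a) ⊕ φ (α · b))) (flag-yes t)))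
        (trans (respects a b l) (cong (_⊕ (φ a ⊕ φ b)) (flag-yes h)))))

    δ-here : ∀ {a b} → a — b → Here a b → ¬ There a b → δ a ≢ δ b
    δ-here {a} {b} l h ¬t = ⊕-exchange-flipped (φ a) (φ b) _ _
      (trans (sym (cong (_⊕ (φ (α · a) ⊕ φ (α · b))) (flag-no ¬t)))
        (trans (respects a b l) (cong (_⊕ (φ a ⊕ φ b)) (flag-yes h))))

    δ-fixed : ∀ {v} → α · v ≡ v → δ v ≡ zero
    δ-fixed {v} eq = trans (cong (_⊕ φ v) (cong φ eq)) (⊕-self (φ v))

    constant : (∀ {a b} → Here a b → There a b) → (∀ {a b} → There a b → Here a b) →
      ∀ {a} → Kept a → ∀ b → Kept b → δ b ≡ δ a
    constant h⇒t t⇒h {a} ka = spread next refl ka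
      where
      next : ∀ {b c} → δ b ≡ δ a → b — c → δ c ≡ δ a
      next {b} {c} eq l with samePair? f₁ f₂ b c
      ... | yes h = trans (sym (δ-both l h (h⇒t h))) eq
      ... | no ¬h = trans (sym (δ-plain l ¬h (¬h ∘ t⇒h))) eq

    nonzero : ∀ {a} → Kept a → (∀ b → Kept b → δ b ≡ δ a) → δ a ≢ zero
    nonzero ka const zero-at = moved λ b kb → ⊕≡0 _ _ (trans (const b kb) zero-at)

module TwoLabelBranching {G : Graph} {φ : VertexLabelling G 2} (N : Network G φ)
  (has₂ : ∀ v → Network.Kept N v → Network.Has₂ N v)
  (small-near-big : ∀ u v → ¬ Network.Has₃ N u → Network._—_ N u v → Network.Has₃ N v) where

  open NetworkLemmas N
  open Complementing N

  -- The link b — x is the beginning of a route from b to y: either x is y, or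
  -- x has degree two and y is its other neighbour.
  Port : Vertex → Vertex → Vertex → Set
  Port b x y = Has₃ b × b — x × ((Has₃ x × x ≡ y) ⊎ (¬ Has₃ x × x — y × y ≢ b))

  port : ∀ {b x} → Has₃ b → b — x → ∃[ y ] Port b x y
  port {b} {x} 3b bx with has₃? x
  ... | yes 3x = x , 3b , bx , inj₁ (3x , refl)
  ... | no ¬3x with other {b = b} (has₂ x (link-kept (link-sym bx)))
  ... | y , xy , y≢b = y , 3b , bx , inj₂ (¬3x , xy , y≢b)

  port-end : ∀ {b x y} → Port b x y → Has₃ y
  port-end (_ , _ , inj₁ (3x , refl)) = 3x
  port-end (_ , _ , inj₂ (¬3x , xy , _)) = small-near-big _ _ ¬3x xy

  port-≢ : ∀ {b x y} → Port b x y → b ≢ y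
  port-≢ (_ , bx , inj₁ (_ , refl)) = distinct-links bx
  port-≢ (_ , _ , inj₂ (_ , _ , y≢b)) = y≢b ∘ sym

  port-unique : ∀ {b x y y′} → Port b x y → Port b x y′ → y ≡ y′
  port-unique (_ , _ , inj₁ (_ , p)) (_ , _ , inj₁ (_ , q)) = trans (sym p) q
  port-unique (_ , _ , inj₁ (3x , _)) (_ , _ , inj₂ (¬3x , _)) = ⊥-elim (¬3x 3x)
  port-unique (_ , _ , inj₂ (¬3x , _)) (_ , _ , inj₁ (3x , _)) = ⊥-elim (¬3x 3x)
  port-unique (_ , bx , inj₂ (¬3x , xy , y≢b)) (_ , _ , inj₂ (_ , xy′ , y′≢b)) =
    [ (λ eq → ⊥-elim (y′≢b eq)) , sym ]′ (not-third ¬3x (link-sym bx) xy xy′ (y≢b ∘ sym))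

  Joined : Vertex → Vertex → Set
  Joined b y = ∃[ x ] Port b x y

  joined-sym : ∀ {b y} → Joined b y → Joined y b
  joined-sym {b} (x , π@(3b , bx , inj₁ (3x , refl))) = b , 3x , link-sym bx , inj₁ (3b , refl)
  joined-sym (x , π@(3b , bx , inj₂ (¬3x , xy , y≢b))) =
    x , port-end π , link-sym xy , inj₂ (¬3x , link-sym bx , y≢b ∘ sym)

  -- For a link `u — v` this says that the route beginning with `b — x` uses it: if `x` has degree
  -- two, both of its links belong to the route, so it suffices that `x` is an end of `u — v`.
  Touches : Vertex → Vertex → Vertex → Vertex → Set
  Touches u v b x = (Has₃ x × SamePair u v b x) ⊎ (¬ Has₃ x × (x ≡ u ⊎ x ≡ v))

  touches? : ∀ u v b x → Dec (Touches u v b x)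
  touches? u v b x = (has₃? x ×-dec samePair? u v b x) ⊎-dec (¬? (has₃? x) ×-dec (x ≟ u ⊎-dec x ≟ v))

  -- A link lies on one route only, up to direction. Of the opposite direction just `b ≡ y′` is
  -- kept, which already contradicts the injectivity of a path.
  touched-twice : ∀ {u v b x y b′ x′ y′} → u — v → Port b x y → Port b′ x′ y′ →
    Touches u v b x → Touches u v b′ x′ → (b ≡ b′ × x ≡ x′) ⊎ b ≡ y′
  touched-twice _ _ _ (inj₁ (_ , inj₁ (refl , refl))) (inj₁ (_ , inj₁ (refl , refl))) = inj₁ (refl , refl)
  touched-twice _ _ _ (inj₁ (_ , inj₂ (refl , refl))) (inj₁ (_ , inj₂ (refl , refl))) = inj₁ (refl , refl)
  touched-twice _ _ (_ , _ , inj₁ (_ , refl)) (inj₁ (_ , inj₁ (refl , refl))) (inj₁ (_ , inj₂ (refl , refl))) = inj₂ refl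
  touched-twice _ _ (_ , _ , inj₁ (_ , refl)) (inj₁ (_ , inj₂ (refl , refl))) (inj₁ (_ , inj₁ (refl , refl))) = inj₂ refl
  touched-twice _ _ (_ , _ , inj₂ (¬3x′ , _)) (inj₁ _) (inj₁ (3x′ , _)) = ⊥-elim (¬3x′ 3x′)
  touched-twice _ (3b , _) _ (inj₁ (3x , m)) (inj₂ (¬3x′ , e)) = ⊥-elim (¬3x′ (big e m))
    where
    big : ∀ {u v x′} → x′ ≡ u ⊎ x′ ≡ v → SamePair u v _ _ → Has₃ x′
    big (inj₁ refl) (inj₁ (refl , refl)) = 3b
    big (inj₁ refl) (inj₂ (refl , refl)) = 3x
    big (inj₂ refl) (inj₁ (refl , refl)) = 3x
    big (inj₂ refl) (inj₂ (refl , refl)) = 3b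
  touched-twice _ _ (3b′ , _) (inj₂ (¬3x , e)) (inj₁ (3x′ , m)) = ⊥-elim (¬3x (big e m))
    where
    big : ∀ {u v x} → x ≡ u ⊎ x ≡ v → SamePair u v _ _ → Has₃ x
    big (inj₁ refl) (inj₁ (refl , refl)) = 3b′
    big (inj₁ refl) (inj₂ (refl , refl)) = 3x′
    big (inj₂ refl) (inj₁ (refl , refl)) = 3x′
    big (inj₂ refl) (inj₂ (refl , refl)) = 3b′
  touched-twice uv π π′ (inj₂ (¬3x , inj₁ refl)) (inj₂ (¬3x′ , inj₂ refl)) =
    ⊥-elim (¬3x′ (small-near-big _ _ ¬3x uv))
  touched-twice uv π π′ (inj₂ (¬3x , inj₂ refl)) (inj₂ (¬3x′ , inj₁ refl)) =
    ⊥-elim (¬3x (small-near-big _ _ ¬3x′ uv))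
  touched-twice _ _ (_ , _ , inj₁ (3x′ , _)) (inj₂ _) (inj₂ (¬3x′ , _)) = ⊥-elim (¬3x′ 3x′)
  touched-twice _ (_ , bx , _) (_ , b′x , inj₂ (¬3x , xy′ , y′≢b′)) (inj₂ (_ , inj₁ refl)) (inj₂ (_ , inj₁ refl)) =
    [ (λ eq → inj₁ (eq , refl)) , inj₂ ]′ (not-third ¬3x (link-sym b′x) xy′ (link-sym bx) (y′≢b′ ∘ sym))
  touched-twice _ (_ , bx , _) (_ , b′x , inj₂ (¬3x , xy′ , y′≢b′)) (inj₂ (_ , inj₂ refl)) (inj₂ (_ , inj₂ refl)) =
    [ (λ eq → inj₁ (eq , refl)) , inj₂ ]′ (not-third ¬3x (link-sym b′x) xy′ (link-sym bx) (y′≢b′ ∘ sym))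

  open Paths Joined

  -- A route from `p 0` that returns to the path. On a longest path every neighbour of `p 0` begins
  -- one, as otherwise the path could be prolonged.
  record Entry (p : ℕ → Vertex) (m : ℕ) : Set where
    field
      neighbour : Vertex
      index : ℕ
      route : Port (p 0) neighbour (p index)
      1≤index : 1 ≤ index
      index≤m : index ≤ m

  open Entry

  -- Two walks from p 0 to p s₂, one through x₁ and one through x₃, avoid the link
  -- p 0 — x₂ and share no link.  As δ changes only across that link and across its
  -- preimage under α, one of the two walks shows δ (p 0) ≡ δ (p s₂).
  module Middle {p : ℕ → Vertex} {m : ℕ} (path : IsPath (suc m) p)
    (e₁ e₂ e₃ : Entry p m)
    (x₁≢x₂ : neighbour e₁ ≢ neighbour e₂) (x₂≢x₃ : neighbour e₂ ≢ neighbour e₃)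
    (x₁≢x₃ : neighbour e₁ ≢ neighbour e₃)
    (s₁≤s₂ : index e₁ ≤ index e₂) (s₂≤s₃ : index e₂ ≤ index e₃) where

    b x y : Vertex
    b = p 0
    x = neighbour e₂
    y = p (index e₂)

    3b : Has₃ b
    3b = proj₁ (route e₂)
    bx : b — x
    bx = proj₁ (proj₂ (route e₂))

    join : ∀ {i} → suc i ≤ m → Joined (p i) (p (suc i))
    join lt = proj₂ path _ (s≤s lt)

    StepTouched : Vertex → Vertex → ℕ → Set
    StepTouched u v i = ∃[ lt ] Touches u v (p i) (proj₁ (join {i} lt))

    Touched : Vertex → Vertex → Entry p m → ℕ → ℕ → Set
    Touched u v e from to = Touches u v b (neighbour e) ⊎ ∃[ i ] from ≤ i × i < to × StepTouched u v i

    no-return : ∀ {i} → 1 ≤ i → i ≤ m → b ≢ p i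
    no-return 1≤i i≤m eq with proj₁ path (s≤s z≤n) (s≤s i≤m) eq | 1≤i
    ... | refl | ()

    entry-step : ∀ {u v} → u — v → (e : Entry p m) → Touches u v b (neighbour e) →
      ∀ {i} → 1 ≤ i → StepTouched u v i → ⊥
    entry-step uv e t {i} 1≤i (lt , t′) with touched-twice uv (route e) (proj₂ (join lt)) t t′
    ... | inj₁ (eq , _) = no-return 1≤i (<⇒≤ lt) eq
    ... | inj₂ eq = no-return (s≤s z≤n) lt eq

    entry-entry : ∀ {u v} → u — v → (e e′ : Entry p m) → neighbour e ≢ neighbour e′ →
      Touches u v b (neighbour e) → Touches u v b (neighbour e′) → ⊥
    entry-entry uv e e′ x≢x′ t t′ with touched-twice uv (route e) (route e′) t t′
    ... | inj₁ (_ , eq) = x≢x′ eq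
    ... | inj₂ eq = port-≢ (route e′) eq

    step-step : ∀ {u v} → u — v → ∀ {i j} → i < j → StepTouched u v i → StepTouched u v j → ⊥
    step-step uv {i} {j} i<j (lt , t) (lt′ , t′) with touched-twice uv (proj₂ (join lt)) (proj₂ (join lt′)) t t′
    ... | inj₁ (eq , _) = <-irrefl (proj₁ path (s≤s (<⇒≤ lt)) (s≤s (<⇒≤ lt′)) eq) i<j
    ... | inj₂ eq = <-irrefl (proj₁ path (s≤s (<⇒≤ lt)) (s≤s lt′) eq) (m≤n⇒m≤1+n i<j)

    disjoint : ∀ {u v} → u — v → Touched u v e₁ (index e₁) (index e₂) → Touched u v e₃ (index e₂) (index e₃) → ⊥
    disjoint uv (inj₁ t) (inj₁ t′) = entry-entry uv e₁ e₃ x₁≢x₃ t t′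
    disjoint uv (inj₁ t) (inj₂ (i , s₂≤i , _ , t′)) = entry-step uv e₁ t (≤-trans (1≤index e₂) s₂≤i) t′
    disjoint uv (inj₂ (i , s₁≤i , _ , t)) (inj₁ t′) = entry-step uv e₃ t′ (≤-trans (1≤index e₁) s₁≤i) t
    disjoint uv (inj₂ (i , _ , i<s₂ , t)) (inj₂ (j , s₂≤j , _ , t′)) = step-step uv (<-≤-trans i<s₂ s₂≤j) t t′

    avoids : ∀ {u v} → u — v → Touches u v b x → (e : Entry p m) → x ≢ neighbour e →
      ∀ {from to} → 1 ≤ from → Touched u v e from to → ⊥
    avoids uv t e x≢ 1≤from (inj₁ t′) = entry-entry uv e₂ e x≢ t t′
    avoids uv t e x≢ 1≤from (inj₂ (i , from≤i , _ , t′)) = entry-step uv e₂ t (≤-trans 1≤from from≤i) t′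

    module _ (f-touches : Touches b x b x) where

      open Twist N b x

      module Walks (α : Aut) (respects : RespectsLinks L α) (off : PreservesOff α)
        (moved : ¬ PreservesKept α) where

        open Discrepancy α respects off moved

        h₁ h₂ : Vertex
        h₁ = (α ⁻¹) · b
        h₂ = (α ⁻¹) · x

        hh : h₁ — h₂
        hh = link-image (α ⁻¹) bx

        pull : ∀ {a c} → α · a ≡ c → a ≡ (α ⁻¹) · c
        pull {a} refl = sym (⁻¹-inverseˡ α a)

        there-pair : ∀ {a c} → There a c → SamePair h₁ h₂ a c
        there-pair (inj₁ (q , r)) = inj₁ (pull q , pull r)
        there-pair (inj₂ (q , r)) = inj₂ (pull q , pull r)

        across : ∀ {c z w} → Port c z w → ¬ Touches b x c z → ¬ Touches h₁ h₂ c z → δ c ≡ δ w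
        across (_ , cz , inj₁ (3z , refl)) ¬f ¬h =
          δ-plain cz (λ m → ¬f (inj₁ (3z , m))) (λ m → ¬h (inj₁ (3z , there-pair m)))
        across (_ , cz , inj₂ (¬3z , zw , _)) ¬f ¬h = trans
          (δ-plain cz (λ m → ¬f (inj₂ (¬3z , samePair-second m))) (λ m → ¬h (inj₂ (¬3z , samePair-second (there-pair m)))))
          (δ-plain zw (λ m → ¬f (inj₂ (¬3z , samePair-first m))) (λ m → ¬h (inj₂ (¬3z , samePair-first (there-pair m)))))

        Blocked : Entry p m → ℕ → ℕ → Set
        Blocked e from to = Touched b x e from to ⊎ Touched h₁ h₂ e from to

        along : ∀ e {from} to → from ≤ to → to ≤ m → δ (p from) ≡ δ (p to) ⊎ Blocked e from to
        along e {from} to from≤to to≤m with m≤n⇒m<n∨m≡n from≤to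
        along e to from≤to to≤m | inj₂ refl = inj₁ refl
        along e {from} (suc to) from≤to to≤m | inj₁ (s≤s from≤) with along e to from≤ (<⇒≤ to≤m)
        ... | inj₂ (inj₁ (inj₁ t)) = inj₂ (inj₁ (inj₁ t))
        ... | inj₂ (inj₁ (inj₂ (i , l , lt , t))) = inj₂ (inj₁ (inj₂ (i , l , m≤n⇒m≤1+n lt , t)))
        ... | inj₂ (inj₂ (inj₁ t)) = inj₂ (inj₂ (inj₁ t))
        ... | inj₂ (inj₂ (inj₂ (i , l , lt , t))) = inj₂ (inj₂ (inj₂ (i , l , m≤n⇒m≤1+n lt , t)))
        ... | inj₁ eq with touches? b x (p to) (proj₁ (join to≤m)) | touches? h₁ h₂ (p to) (proj₁ (join to≤m))
        ... | yes t | _ = inj₂ (inj₁ (inj₂ (to , from≤ , ≤-refl , to≤m , t)))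
        ... | no _ | yes t = inj₂ (inj₂ (inj₂ (to , from≤ , ≤-refl , to≤m , t)))
        ... | no ¬f | no ¬h = inj₁ (trans eq (across (proj₂ (join to≤m)) ¬f ¬h))

        enter : ∀ e {from to} → δ b ≡ δ (p (index e)) ⊎ Blocked e from to
        enter e with touches? b x b (neighbour e) | touches? h₁ h₂ b (neighbour e)
        ... | yes t | _ = inj₂ (inj₁ (inj₁ t))
        ... | no _ | yes t = inj₂ (inj₂ (inj₁ t))
        ... | no ¬f | no ¬h = inj₁ (across (route e) ¬f ¬h)

        combine : ∀ {u v w} {X : Set} → δ u ≡ δ v ⊎ X → δ v ≡ δ w ⊎ X → δ u ≡ δ w ⊎ X
        combine (inj₁ p) (inj₁ q) = inj₁ (trans p q)
        combine (inj₁ p) (inj₂ t) = inj₂ t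
        combine (inj₂ t) _ = inj₂ t

        flip≡ : ∀ {u v} {X : Set} → δ u ≡ δ v ⊎ X → δ v ≡ δ u ⊎ X
        flip≡ (inj₁ p) = inj₁ (sym p)
        flip≡ (inj₂ t) = inj₂ t

        walk₁ : δ b ≡ δ y ⊎ Blocked e₁ (index e₁) (index e₂)
        walk₁ = combine {b} {p (index e₁)} {y} (enter e₁) (along e₁ (index e₂) s₁≤s₂ (index≤m e₂))

        walk₂ : δ b ≡ δ y ⊎ Blocked e₃ (index e₂) (index e₃)
        walk₂ = combine {b} {p (index e₃)} {y} (enter e₃)
          (flip≡ {y} {p (index e₃)} (along e₃ (index e₃) s₂≤s₃ (index≤m e₃)))

        balanced : δ b ≡ δ y
        balanced with walk₁ | walk₂
        ... | inj₁ eq | _ = eq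
        ... | _ | inj₁ eq = eq
        ... | inj₂ (inj₁ t) | _ = ⊥-elim (avoids bx f-touches e₁ (x₁≢x₂ ∘ sym) (1≤index e₁) t)
        ... | _ | inj₂ (inj₁ t) = ⊥-elim (avoids bx f-touches e₃ x₂≢x₃ (1≤index e₂) t)
        ... | inj₂ (inj₂ t) | inj₂ (inj₂ t′) = ⊥-elim (disjoint hh t t′)

        fixed-link : There b x → (∀ {a c} → Here a c → There a c) × (∀ {a c} → There a c → Here a c)
        fixed-link (inj₁ (q , r)) =
          (λ { (inj₁ (refl , refl)) → inj₁ (q , r) ; (inj₂ (refl , refl)) → inj₂ (r , q) }) ,
          λ { (inj₁ (q′ , r′)) → inj₁ (·-injective α (trans q′ (sym q)) , ·-injective α (trans r′ (sym r)))
            ; (inj₂ (q′ , r′)) → inj₂ (·-injective α (trans q′ (sym r)) , ·-injective α (trans r′ (sym q))) }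
        fixed-link (inj₂ (q , r)) =
          (λ { (inj₁ (refl , refl)) → inj₂ (q , r) ; (inj₂ (refl , refl)) → inj₁ (r , q) }) ,
          λ { (inj₁ (q′ , r′)) → inj₂ (·-injective α (trans q′ (sym r)) , ·-injective α (trans r′ (sym q)))
            ; (inj₂ (q′ , r′)) → inj₁ (·-injective α (trans q′ (sym q)) , ·-injective α (trans r′ (sym r))) }

        kb : Kept b
        kb = link-kept bx

        constant-if-fixed : There b x → ∀ c → Kept c → δ c ≡ δ b
        constant-if-fixed t = let (h⇒t , t⇒h) = fixed-link t in constant h⇒t t⇒h kb

        not-fixed : There b x → α · b ≢ b
        not-fixed t αb = nonzero kb (constant-if-fixed t) (δ-fixed αb)

        -- Unless `α` maps the flagged link onto itself, `δ` jumps across it, contrary to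
        -- `balanced`. So `δ` is constant and equal to 1; then `b` is moved, and the link is
        -- reversed.
        direct : x ≡ y → Complements α × α · b ≡ y
        direct x≡y with there? b x
        ... | no ¬t = ⊥-elim (δ-here bx (inj₁ (refl , refl)) ¬t (trans balanced (cong δ (sym x≡y))))
        ... | yes t = (off , λ v kv eq → nonzero kb (constant-if-fixed t)
                (trans (sym (constant-if-fixed t v kv)) (trans (cong (_⊕ φ v) eq) (⊕-self (φ v))))) ,
              [ (λ αb → ⊥-elim (not-fixed t αb)) , (λ αb → trans αb x≡y) ]′ (samePair-first t)

        -- Here α fixes x and complements all other kept vertices, while τ complements
        -- all of them, so τ ⊙ α would change the label of x only.
        indirect : ¬ Has₃ x → x — y → y ≢ b → ⊥
        indirect ¬3x xy y≢b with there? b x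
        ... | yes t = [ not-fixed t , (λ αb → ¬3x (subst Has₃ αb (has₃-image α 3b))) ]′ (samePair-first t)
        ... | no ¬t with there? x y
        ...   | no ¬t′ = δ-here bx (inj₁ (refl , refl)) ¬t
                  (trans balanced (sym (δ-plain xy
                    [ (λ (x≡b , _) → distinct-links bx (sym x≡b)) , (λ (_ , y≡b) → y≢b y≡b) ]′ ¬t′)))
        -- Now `α` maps the link `x y` onto the flagged link. Degrees are preserved, so `y` must go
        -- to `b`, and `x` is fixed.
        ...   | yes (inj₁ (αx , αy)) = ¬3x (subst Has₃ αy (has₃-image α (port-end (route e₂))))
        ...   | yes (inj₂ (αx , αy)) = no-single-change φ (τ ⊙ α) x same changed
          where
          τ : Aut
          τ = proj₁ complementer
          comp : Complements τ
          comp = proj₂ complementer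

          δb≢0 : δ b ≢ zero
          δb≢0 δb = δ-here bx (inj₁ (refl , refl)) ¬t (trans δb (sym (δ-fixed αx)))

          elsewhere : ∀ v → Kept v → v ≡ x ⊎ δ v ≢ zero
          elsewhere = spread next (inj₂ δb≢0) kb
            where
            next : ∀ {a c} → a ≡ x ⊎ δ a ≢ zero → a — c → c ≡ x ⊎ δ c ≢ zero
            next (inj₁ refl) l with not-third ¬3x (link-sym bx) xy l (y≢b ∘ sym)
            ... | inj₁ refl = inj₂ δb≢0
            ... | inj₂ refl = inj₂ (δb≢0 ∘ trans balanced)
            next {a} {c} (inj₂ δa) l with a ≟ x | c ≟ x
            ... | _ | yes c≡x = inj₁ c≡x
            ... | yes refl | no _ = next (inj₁ refl) l
            ... | no a≢x | no c≢x = inj₂ (δa ∘ trans (δ-plain l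
                    [ c≢x ∘ proj₂ , a≢x ∘ proj₁ ]′
                    [ (λ (_ , q) → c≢x (·-injective α (trans q (sym αx)))) ,
                      (λ (q , _) → a≢x (·-injective α (trans q (sym αx)))) ]′))

          same : ∀ v → v ≢ x → φ (τ · α · v) ≡ φ v
          same v v≢x with kept? v
          ... | no ¬k = off-compose τ α (proj₁ comp) off v ¬k
          ... | yes k with elsewhere v k
          ...   | inj₁ eq = ⊥-elim (v≢x eq)
          ...   | inj₂ δv = other-label (proj₂ comp (α · v) (kept-image α k))
                    λ eq → δv (trans (cong (_⊕ φ v) eq) (⊕-self (φ v)))

          changed : φ (τ · α · x) ≢ φ x
          changed eq = proj₂ comp x (link-kept xy) (trans (cong (λ v → φ (τ · v)) (sym αx)) eq)

    Reversal : Set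
    Reversal = x ≡ y × ∃[ τ ] Complements τ × τ · b ≡ y

    reversal : Reversal
    reversal = go (proj₂ (proj₂ (route e₂)))
      where
      go : (Has₃ x × x ≡ y) ⊎ (¬ Has₃ x × x — y × y ≢ b) → Reversal
      go (inj₁ (3x , x≡y)) = x≡y , finish (unbreakable (Twist.L N b x) (Twist.L-sym N b x))
        where
        finish : ∃[ α ] RespectsLinks (Twist.L N b x) α × PreservesOff α × ¬ PreservesKept α →
          ∃[ τ ] Complements τ × τ · b ≡ y
        finish (α , respects , off , moved) =
          α , Walks.direct (inj₁ (3x , inj₁ (refl , refl))) α respects off moved x≡y
      go (inj₂ (¬3x , xy , y≢b)) = ⊥-elim (finish (unbreakable (Twist.L N b x) (Twist.L-sym N b x)))
        where
        finish : ∃[ α ] RespectsLinks (Twist.L N b x) α × PreservesOff α × ¬ PreservesKept α → ⊥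
        finish (α , respects , off , moved) =
          Walks.indirect (inj₂ (¬3x , inj₂ refl)) α respects off moved ¬3x xy y≢b

  MaxPath : ℕ → (ℕ → Vertex) → Set
  MaxPath m p = IsPath (suc m) p × Has₃ (p 0) × (∀ q → ¬ IsPath (suc (suc m)) q)

  entry : ∀ {m p x} → MaxPath m p → p 0 — x → ∃[ e ] neighbour {p} {m} e ≡ x
  entry {m} {p} {x} (path , 3p₀ , max) l = go (port 3p₀ l)
    where
    go : ∃[ y ] Port (p 0) x y → ∃[ e ] neighbour {p} {m} e ≡ x
    go (y , π) with locate p (suc m) y
    ... | no fresh = ⊥-elim (max (y ∷ᵖ p) (extend path (joined-sym (x , π)) fresh))
    ... | yes (zero , _ , eq) = ⊥-elim (port-≢ π eq)
    ... | yes (suc i , s≤s i≤m , refl) =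
      record { neighbour = x ; index = suc i ; route = π ; 1≤index = s≤s z≤n ; index≤m = i≤m } , refl

  Reversed : (ℕ → Vertex) → ℕ → Set
  Reversed p s = Joined (p 0) (p s) × ∃[ τ ] Complements τ × τ · p 0 ≡ p s

  module Entries {m p} (maxpath : MaxPath m p) where

    middle : ∀ (e₁ e₂ e₃ : Entry p m) → neighbour e₁ ≢ neighbour e₂ → neighbour e₂ ≢ neighbour e₃ →
      neighbour e₁ ≢ neighbour e₃ → index e₁ ≤ index e₂ → index e₂ ≤ index e₃ →
      neighbour e₂ ≡ p (index e₂) × Reversed p (index e₂)
    middle e₁ e₂ e₃ n₁₂ n₂₃ n₁₃ le le′ =
      let (eq , rev) = Middle.reversal (proj₁ maxpath) e₁ e₂ e₃ n₁₂ n₂₃ n₁₃ le le′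
      in eq , (neighbour e₂ , route e₂) , rev

    -- With equal indices either of `e₁` and `e₂` could count as the middle one, and `middle` would
    -- make both neighbours the vertex at that index.
    beyond-first : ∀ (e₁ e₂ e₃ : Entry p m) → neighbour e₁ ≢ neighbour e₂ → neighbour e₂ ≢ neighbour e₃ →
      neighbour e₁ ≢ neighbour e₃ → index e₁ ≤ index e₂ → index e₂ ≤ index e₃ →
      index e₁ < index e₂ × Reversed p (index e₂)
    beyond-first e₁ e₂ e₃ n₁₂ n₂₃ n₁₃ le le′ with m≤n⇒m<n∨m≡n le | middle e₁ e₂ e₃ n₁₂ n₂₃ n₁₃ le le′
    ... | inj₁ lt | _ , rev = lt , rev
    ... | inj₂ eq | at₂ , _ with middle e₂ e₁ e₃ (n₁₂ ∘ sym) n₁₃ n₂₃ (≤-reflexive (sym eq)) (≤-trans le le′)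
    ...   | at₁ , _ = ⊥-elim (n₁₂ (trans at₁ (trans (cong p eq) (sym at₂))))

    start : ∃[ s ] 2 ≤ s × s ≤ m × Reversed p s
    start with proj₁ (proj₂ maxpath)
    ... | b , c , d , b≢c , b≢d , c≢d , lb , lc , ld with entry maxpath lb | entry maxpath lc | entry maxpath ld
    ... | e₁ , refl | e₂ , refl | e₃ , refl = sort (≤-total (index e₁) (index e₂)) (≤-total (index e₂) (index e₃))
                                                (≤-total (index e₁) (index e₃))
      where
      Found : Set
      Found = ∃[ s ] 2 ≤ s × s ≤ m × Reversed p s

      found : ∀ (f₁ f₂ f₃ : Entry p m) → neighbour f₁ ≢ neighbour f₂ → neighbour f₂ ≢ neighbour f₃ →
        neighbour f₁ ≢ neighbour f₃ → index f₁ ≤ index f₂ → index f₂ ≤ index f₃ → Found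
      found f₁ f₂ f₃ n₁₂ n₂₃ n₁₃ le le′ =
        let (lt , rev) = beyond-first f₁ f₂ f₃ n₁₂ n₂₃ n₁₃ le le′
        in index f₂ , ≤-trans (s≤s (1≤index f₁)) lt , index≤m f₂ , rev

      sort : index e₁ ≤ index e₂ ⊎ index e₂ ≤ index e₁ → index e₂ ≤ index e₃ ⊎ index e₃ ≤ index e₂ →
        index e₁ ≤ index e₃ ⊎ index e₃ ≤ index e₁ → Found
      sort (inj₁ ₁₂) (inj₁ ₂₃) _ = found e₁ e₂ e₃ b≢c c≢d b≢d ₁₂ ₂₃
      sort (inj₁ ₁₂) (inj₂ ₃₂) (inj₁ ₁₃) = found e₁ e₃ e₂ b≢d (c≢d ∘ sym) b≢c ₁₃ ₃₂
      sort (inj₁ ₁₂) (inj₂ ₃₂) (inj₂ ₃₁) = found e₃ e₁ e₂ (b≢d ∘ sym) b≢c (c≢d ∘ sym) ₃₁ ₁₂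
      sort (inj₂ ₂₁) (inj₁ ₂₃) (inj₁ ₁₃) = found e₂ e₁ e₃ (b≢c ∘ sym) b≢d c≢d ₂₁ ₁₃
      sort (inj₂ ₂₁) (inj₁ ₂₃) (inj₂ ₃₁) = found e₂ e₃ e₁ c≢d (b≢d ∘ sym) (b≢c ∘ sym) ₂₃ ₃₁
      sort (inj₂ ₂₁) (inj₂ ₃₂) _ = found e₃ e₂ e₁ (c≢d ∘ sym) (b≢c ∘ sym) (b≢d ∘ sym) ₃₂ ₂₁

  third-neighbour : ∀ {a u v} → Has₃ a → ∃[ w ] a — w × w ≢ u × w ≢ v
  third-neighbour {a} {u} {v} (b , c , d , b≢c , b≢d , c≢d , ab , ac , ad) with b ≟ u | b ≟ v | c ≟ u | c ≟ v
  ... | no bu | no bv | _ | _ = b , ab , bu , bv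
  ... | _ | _ | no cu | no cv = c , ac , cu , cv
  ... | yes refl | _ | yes c≡b | _ = ⊥-elim (b≢c (sym c≡b))
  ... | yes refl | _ | no _ | yes refl = d , ad , b≢d ∘ sym , c≢d ∘ sym
  ... | no _ | yes refl | yes refl | _ = d , ad , c≢d ∘ sym , b≢d ∘ sym
  ... | no _ | yes refl | no _ | yes c≡b = ⊥-elim (b≢c (sym c≡b))

  -- Pósa rotation: the initial segment p 0, …, p t is reversed, and the step
  -- from p t to p (t + 1) is replaced by one from p 0.
  module Rotation {m t : ℕ} {p : ℕ → Vertex} (maxpath : MaxPath m p) (t<m : t < m)
    (joined : Joined (p 0) (p (suc t))) where

    path : IsPath (suc m) p
    path = proj₁ maxpath

    σ : ℕ → ℕ
    σ i with i ≤? t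
    ... | yes _ = t ∸ i
    ... | no _ = i

    σ-low : ∀ {i} → i ≤ t → σ i ≡ t ∸ i
    σ-low {i} i≤t with i ≤? t
    ... | yes _ = refl
    ... | no i≰t = ⊥-elim (i≰t i≤t)

    σ-high : ∀ {i} → t < i → σ i ≡ i
    σ-high {i} t<i with i ≤? t
    ... | yes i≤t = ⊥-elim (<⇒≱ t<i i≤t)
    ... | no _ = refl

    σ-bounded : ∀ {i} → i < suc m → σ i < suc m
    σ-bounded {i} lt with i ≤? t
    ... | yes _ = s≤s (≤-trans (m∸n≤m t i) (<⇒≤ t<m))
    ... | no _ = lt

    σ-injective : ∀ {i j} → σ i ≡ σ j → i ≡ j
    σ-injective {i} {j} eq with i ≤? t | j ≤? t
    ... | yes i≤t | yes j≤t = ∸-cancelˡ-≡ i≤t j≤t eq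
    ... | yes _ | no j≰t = ⊥-elim (j≰t (subst (_≤ t) eq (m∸n≤m t i)))
    ... | no i≰t | yes _ = ⊥-elim (i≰t (subst (_≤ t) (sym eq) (m∸n≤m t j)))
    ... | no _ | no _ = eq

    q : ℕ → Vertex
    q i = p (σ i)

    q-start : q 0 ≡ p t
    q-start = cong p (σ-low z≤n)

    q-after : q (suc t) ≡ p (suc t)
    q-after = cong p (σ-high ≤-refl)

    step : ∀ i → suc i < suc m → Joined (q i) (q (suc i))
    step i lt with <-cmp i t
    ... | tri< i<t _ _ = subst₂ Joined (sym (cong p (trans (σ-low (<⇒≤ i<t)) suc-∸))) (cong p (sym (σ-low i<t)))
          (joined-sym (proj₂ path (t ∸ suc i)
            (s≤s (≤-trans (≤-reflexive (sym suc-∸)) (≤-trans (m∸n≤m t i) (<⇒≤ t<m))))))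
      where
      suc-∸ : t ∸ i ≡ suc (t ∸ suc i)
      suc-∸ = +-∸-assoc 1 i<t
    -- The one new step: `q t` is `p 0`, and `joined` leads from there to `p (suc t)`.
    ... | tri≈ _ refl _ = subst₂ Joined (sym (cong p (trans (σ-low ≤-refl) (n∸n≡0 t)))) (sym q-after) joined
    ... | tri> _ _ t<i = subst₂ Joined (cong p (sym (σ-high t<i))) (cong p (sym (σ-high (m≤n⇒m≤1+n t<i))))
          (proj₂ path i lt)

    rotated : MaxPath m q
    rotated = ((λ i< j< eq → σ-injective (proj₁ path (σ-bounded i<) (σ-bounded j<) eq)) , step) ,
      subst Has₃ (sym q-start) (let (_ , 3pₜ , _) = proj₂ path t (s≤s t<m) in 3pₜ) ,
      proj₂ (proj₂ maxpath)

    first-entry : Entry q m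
    first-entry = record
      { neighbour = _ ; index = 1 ; route = proj₂ (step 0 (s≤s 1≤m)) ; 1≤index = ≤-refl ; index≤m = 1≤m }
      where
      1≤m : 1 ≤ m
      1≤m = ≤-trans (s≤s z≤n) t<m

    last-entry : Entry q m
    last-entry = record
      { neighbour = _ ; index = suc t
      ; route = subst₂ (λ a b → Port a _ b) (sym q-start) (sym q-after) (proj₂ (proj₂ path t (s≤s t<m)))
      ; 1≤index = s≤s z≤n ; index≤m = t<m }

  -- After the rotation the middle one of three routes from p t leads to an index
  -- below s, or it is the step to p s, which the unique complementing automorphism
  -- already maps to p 0.
  no-reversal : ∀ s → Acc _<_ s → ∀ m p → MaxPath m p → 2 ≤ s → s ≤ m → ¬ Reversed p s
  no-reversal zero _ _ _ _ ()
  no-reversal (suc zero) _ _ _ _ (s≤s ())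
  no-reversal (suc (suc t)) (acc smaller) m p maxpath _ s≤m (joined , τ , comp , τp₀) =
    with-third (third-neighbour {u = neighbour e₁} {v = neighbour e₂} (proj₁ (proj₂ rotated)))
    where
    open Rotation maxpath s≤m joined
    open Entries rotated

    e₁ e₂ : Entry q m
    e₁ = first-entry
    e₂ = last-entry

    e₁≢e₂ : neighbour e₁ ≢ neighbour e₂
    e₁≢e₂ eq with proj₁ (proj₁ rotated) (s≤s (1≤m)) (s≤s s≤m)
      (port-unique (route e₁) (subst (λ x → Port (q 0) x (q (index e₂))) (sym eq) (route e₂)))
      where
      1≤m : 1 ≤ m
      1≤m = ≤-trans (s≤s z≤n) s≤m
    ... | ()

    not-last : ¬ Reversed q (suc (suc t))
    not-last (_ , τ′ , comp′ , τ′q₀) with proj₁ path (s≤s z≤n) (s≤s (<⇒≤ s≤m)) p₀≡pₜ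
      where
      p₀≡pₜ : p 0 ≡ p (suc t)
      p₀≡pₜ = ·-injective τ (trans τp₀ (trans (sym q-after) (trans (sym τ′q₀)
        (trans (complements-unique τ′ τ comp′ comp (q 0)) (cong (τ ·_) q-start)))))
    ... | ()

    -- If `e₃` ends at `suc (suc t)` or beyond, a middle route ends at that index, contrary to
    -- `not-last`. If it ends earlier, it is itself the middle one, and the index has decreased.
    conclude : ∀ e₃ → neighbour e₃ ≢ neighbour e₁ → neighbour e₃ ≢ neighbour e₂ → ⊥
    conclude e₃ n₁ n₂ with ≤-total (index e₂) (index e₃)
    ... | inj₁ le = not-last (proj₂ (middle e₁ e₂ e₃ e₁≢e₂ (n₂ ∘ sym) (n₁ ∘ sym) (s≤s z≤n) le))
    ... | inj₂ ge with m≤n⇒m<n∨m≡n ge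
    ...   | inj₂ eq = not-last (subst (Reversed q) eq
              (proj₂ (middle e₁ e₃ e₂ (n₁ ∘ sym) n₂ e₁≢e₂ (1≤index e₃) ge)))
    ...   | inj₁ lt with beyond-first e₁ e₃ e₂ (n₁ ∘ sym) n₂ e₁≢e₂ (1≤index e₃) ge
    ...     | 1<s , rev = no-reversal (index e₃) (smaller lt) m q rotated 1<s (index≤m e₃) rev

    with-third : ∃[ w ] q 0 — w × w ≢ neighbour e₁ × w ≢ neighbour e₂ → ⊥
    with-third (w , l , n₁ , n₂) with entry rotated l
    ... | e₃ , refl = conclude e₃ n₁ n₂

  impossible : ∀ {b} → Has₃ b → ⊥
  impossible {b} 3b = longest stuck 1 (λ _ → b) single
    where
    single : IsPath 1 (λ _ → b)
    single = (λ { {zero} {zero} _ _ _ → refl ; {suc _} (s≤s ()) ; {zero} {suc _} _ (s≤s ()) }) , λ { _ (s≤s ()) }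

    two : ∃[ p ] IsPath 2 p
    two = let (x , _ , _ , _ , _ , _ , l , _) = 3b
              (y , π) = port 3b l
          in y ∷ᵖ (λ _ → b) , extend single (joined-sym (x , π)) λ { (_ , _ , eq) → port-≢ π eq }

    stuck : ∀ m p → IsPath m p → (∀ q → ¬ IsPath (suc m) q) → ⊥
    stuck zero p path max = max (λ _ → b) single
    stuck (suc zero) p path max = max (proj₁ two) (proj₂ two)
    stuck (suc (suc m)) p path max =
      let (_ , 3p₀ , _) = proj₂ path 0 (s≤s (s≤s z≤n))
          maxpath = path , 3p₀ , max
          (s , 2≤s , s≤m , rev) = Entries.start maxpath
      in no-reversal s (<-wellFounded s) (suc m) p maxpath 2≤s s≤m rev

-- Exclusion of all shapes and conclusion

module TwoOrMoreLabels (G : Graph) (connected : Connected G) (cycle : Cycle G) {k : ℕ}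
  (φ : VertexLabelling G (2 + k)) (rigid : Rigid G φ) (unbreakable : Unbreakable G φ) where

  open Automorphisms G using (Vertex; Aut; _·_; ·-injective)
  open Skeletons G connected using (Skeleton; irreducible)

  N : Network G φ
  N = FromSkeleton.network G connected φ rigid unbreakable (proj₁ irreducible) (proj₂ irreducible)

  open NetworkLemmas N using (Kept; kept-image; Singleton; Pair; Ring; Branching; classify; PreservesKept; RespectsLinks; PreservesOff)

  kept : ∃[ v ] Kept v
  kept = Skeleton.ρ (proj₁ irreducible) v₀ , Skeleton.ρ-idempotent (proj₁ irreducible) v₀
    where
    v₀ : Vertex
    v₀ = Cycle.vertices cycle zero

  no-singleton : ¬ Singleton
  no-singleton (a , ka , only) = finish (Network.unbreakable N (λ _ _ → zero) (λ _ _ → refl))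
    where
    finish : ∃[ α ] RespectsLinks (λ _ _ → zero) α × PreservesOff α × ¬ PreservesKept α → ⊥
    finish (α , _ , _ , moved) = moved λ v kv →
      cong φ (trans (only (α · v) (kept-image α kv)) (sym (only v kv)))

  -- The contraction serves only to exhibit an invariant pair. Its single link could not exclude the
  -- swap, so the edges of `G` are labelled afresh from the pair.
  no-pair : ¬ Pair
  no-pair (a , b , a≢b , ka , kb , only) = PairRoot.impossible G connected cycle φ unbreakable a b a≢b pair
    where
    pair : ∀ α → (α · a ≡ a × α · b ≡ b) ⊎ (α · a ≡ b × α · b ≡ a)
    pair α with only (α · a) (kept-image α ka) | only (α · b) (kept-image α kb)
    ... | inj₁ p | inj₂ q = inj₁ (p , q)
    ... | inj₂ p | inj₁ q = inj₂ (p , q)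
    ... | inj₁ p | inj₁ q = ⊥-elim (a≢b (·-injective α (trans p (sym q))))
    ... | inj₂ p | inj₂ q = ⊥-elim (a≢b (·-injective α (trans p (sym q))))

no-ring : ∀ {G : Graph} {k} (φ : VertexLabelling G (2 + k)) (N : Network G φ) {v} → Network.Kept N v →
  ¬ NetworkLemmas.Ring N
no-ring {k = zero} φ N kv (has₂ , ¬has₃) = TwoLabelRing.impossible N has₂ ¬has₃ kv
no-ring {k = suc k} φ N kv (has₂ , ¬has₃) = ManyLabelRing.impossible N has₂ ¬has₃ kv

no-branching : ∀ {G : Graph} {k} (φ : VertexLabelling G (2 + k)) (N : Network G φ) {v} → Network.Kept N v →
  ¬ NetworkLemmas.Branching N
no-branching {k = zero} φ N kv (has₂ , (_ , 3b) , big) = TwoLabelBranching.impossible N has₂ big 3b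
no-branching {k = suc zero} φ N kv (has₂ , _ , big) = ThreeLabels.impossible N has₂ big kv
no-branching {k = suc (suc k)} φ N kv (has₂ , _ , big) = FourLabels.impossible N has₂ kv

no-unbreakable : ∀ (G : Graph) → Connected G → Cycle G → ∀ {r} (φ : VertexLabelling G r) →
  Rigid G φ → ¬ Unbreakable G φ
no-unbreakable G connected cycle {zero} φ rigid unbreakable with φ (Cycle.vertices cycle zero)
... | ()
no-unbreakable G connected cycle {suc zero} φ rigid unbreakable =
  proj₂ (proj₂ (unbreakable (λ _ _ → zero) (λ _ _ → refl))) λ v → only (φ _) (φ v)
  where
  only : (a b : Fin 1) → a ≡ b
  only zero zero = refl
no-unbreakable G connected cycle {suc (suc k)} φ rigid unbreakable =
  [ no-singleton , [ no-pair , [ no-ring φ N (proj₂ kept) , no-branching φ N (proj₂ kept) ]′ ]′ ]′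
    (NetworkLemmas.classify N (proj₂ kept))
  where
  open TwoOrMoreLabels G connected cycle φ rigid unbreakable

theorem2p1 : (G : Graph) → Connected G → Cycle G →
    ∃[ d ] ∃[ r ] (IsDistinguishingIndex G d × IsDistinguishingNumber G r × d ≤ r)
theorem2p1 G connected cycle =
  -- Labelling each vertex by itself is distinguishing, so `order` bounds the search for the least
  -- number.
  let (r , (φ , φ-dist) , r-least) = least distinguishing-number? order (id , λ _ p → p)
      -- Edge labellings with `r` labels can be searched, so refuting their absence produces one.
      -- This also shows that the distinguishing index exists.
      ψ = decidable-stable (distinguishing-edge? e₀ r) λ none →
        no-unbreakable G connected cycle φ φ-dist λ L L-sym → break none φ-dist L L-sym
      (d , d-dist , d-least) = least (distinguishing-edge? e₀) r ψ
  in d , r , (d-dist , d-least) , ((φ , φ-dist) , r-least) , d-least r ψ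
  where
  open Automorphisms G
  e₀ = Cycle.closes cycle

  break : ∀ {r} {φ : VertexLabelling G r} →
    ¬ (∃ λ (ψ : EdgeLabelling G r) → DistinguishingEdge G ψ) → Rigid G φ → Unbreakable G φ
  break none φ-dist L L-sym with broken L
  ... | inj₁ ok = ⊥-elim (none (fromMatrix L L-sym ok))
  ... | inj₂ (α , p , x , q) = α , p , λ φα → q (φ-dist α φα x)
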